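{- Let $q$ range over prime powers with $q\equiv 3\pmod 4$, and let $r=r(q)$ be a positive integer with $r\equiv 0$ or $1\pmod 4$, $r\to\infty$ and $r/q^{1/4}\to 0$ as $q\to\infty$. Let $\tilde N_r$ denote the number of subsets $S\subseteq\mathbb{F}_q$ with $|S|=r$ such that the induced subdigraph $PT_q[S]$ of the Paley tournament is even. Then $$\tilde N_r=(1+o(1))\,2^{1-r}\binom{q}{r}\quad\text{as } q\to\infty.$$
   Context: For $q\equiv 3\pmod 4$ a prime power, the Paley tournament $PT_q$ is the digraph on $\mathbb{F}_q$ in which $(x,y)$ is an arc iff $x-y$ is a nonzero square in $\mathbb{F}_q$ (a tournament since $-1$ is a nonsquare). For $S\subseteq\mathbb{F}_q$, the out-degree of $v\in S$ in $PT_q[S]$ is the number of $y\in S$ with $(v,y)$ an arc. An induced subdigraph is even if every vertex has even out-degree in it. -}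

module Defs where

open import Level using (0ℓ)
import Data.Empty as Empty
open import Data.Nat using (ℕ; zero; suc)
import Data.Nat as ℕ
open import Data.Nat.Divisibility using (_∣_; _∣?_)
open import Data.Nat.Primality using (Prime)
open import Data.Bool using (Bool; true; false)
open import Data.Fin using (Fin)
open import Data.Fin.Properties using (any?; all?)
open import Data.Fin.Subset using (Subset; _∈_; _∩_; ∣_∣)
open import Data.Fin.Subset.Properties using (_∈?_)
open import Data.Vec using (Vec; []; _∷_; tabulate)
open import Data.List using (List; []; _∷_; map; _++_; length; filter)
open import Data.Product using (Σ; ∃; ∃-syntax; _×_; _,_)
open import Data.Sum using (_⊎_)
open import Relation.Nullary using (¬_; Dec; yes; no; does)
open import Relation.Nullary.Decidable using (_×-dec_; ¬?; _→-dec_)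
open import Relation.Binary using (Decidable)
open import Relation.Binary.PropositionalEquality using (_≡_)
open import Algebra.Bundles using (CommutativeRing)

record FiniteField : Set₁ where
  field
    commRing : CommutativeRing 0ℓ 0ℓ
  open CommutativeRing commRing public
  field
    _≟_       : Decidable _≈_
    0≉1       : ¬ (0# ≈ 1#)
    inverse   : ∀ x → ¬ (x ≈ 0#) → ∃[ y ] (x * y ≈ 1#)
    size      : ℕ
    enum      : Fin size → Carrier
    enum-inj  : ∀ i j → enum i ≈ enum j → i ≡ j
    enum-surj : ∀ x → ∃[ i ] (enum i ≈ x)

module _ (F : FiniteField) where
  open FiniteField F

  IsNonzeroSquare : Carrier → Set
  IsNonzeroSquare x = ¬ (x ≈ 0#) × ∃[ y ] (y * y ≈ x)

  isNonzeroSquare? : ∀ x → Dec (IsNonzeroSquare x)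
  isNonzeroSquare? x = ¬? (x ≟ 0#) ×-dec sq?
    where
    sq? : Dec (∃[ y ] (y * y ≈ x))
    sq? with any? (λ i → (enum i * enum i) ≟ x)
    ... | yes (i , p) = yes (enum i , p)
    ... | no ¬p = no λ { (y , p) → helper y p (enum-surj y) }
      where
      helper : ∀ y → y * y ≈ x → ∃[ i ] (enum i ≈ y) → Empty.⊥
      helper y p (i , e) = ¬p (i , trans (*-cong e e) p)


  PaleyArc : Fin size → Fin size → Set
  PaleyArc i j = IsNonzeroSquare (enum i - enum j)

  outNbr : Fin size → Subset size
  outNbr v = tabulate (λ j → does (isNonzeroSquare? (enum v - enum j)))

  outDeg : Subset size → Fin size → ℕ
  outDeg S v = ∣ S ∩ outNbr v ∣

  IsEvenInduced : Subset size → Set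
  IsEvenInduced S = ∀ v → v ∈ S → 2 ∣ outDeg S v

  isEvenInduced? : ∀ S → Dec (IsEvenInduced S)
  isEvenInduced? S = all? (λ v → (v ∈? S) →-dec (2 ∣? outDeg S v))

allSubsets : (n : ℕ) → List (Subset n)
allSubsets zero = [] ∷ []
allSubsets (suc n) = map (true ∷_) (allSubsets n) ++ map (false ∷_) (allSubsets n)

evenCount : (F : FiniteField) → ℕ → ℕ
evenCount F r =
  length (filter (λ S → (∣ S ∣ Data.Nat.≟ r) ×-dec isEvenInduced? F S)
                 (allSubsets (FiniteField.size F)))
  where import Data.Nat

IsPrimePower : ℕ → Set
IsPrimePower q = Σ ℕ λ p → Σ ℕ λ k → Prime p × 1 ℕ.≤ k × q ≡ p ℕ.^ k

Admissible : ℕ → Set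
Admissible q = IsPrimePower q × q ℕ.% 4 ≡ 3

{-# OPTIONS --safe #-}

-- Let χ be the quadratic character of the field and f_T = ∏_{t ∈ T} (X - t).  A set S of size r is even iff
-- ∏_{y ∈ S} s(v - y) = 1 for all v ∈ S, where s = -1 on nonzero squares and s = 1 elsewhere.  Expanding
-- ∏_{v ∈ S} (1 + ∏_{y ∈ S} s(v - y)) over subsets T of S with complement U gives
--   2ʳ · #even = ∑_{(T,U)} ± ∏_{y ∈ U} χ(f_T(y)),
-- where the sign depends only on |T| and |U|.  The terms T = ∅ and U = ∅ give 2 (q choose r), as r ≡ 0, 1 mod 4.
-- In the other terms we may sum over the larger of the two sets, by antisymmetry of χ(a - b).  For fixed T the sum
-- over U is an elementary symmetric function of the values χ(f_T(y)) ∈ {0, 1, -1}; these satisfy a three-term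
-- recursion by Newton's identities, and are at most (q/64)ᵘ / u! once the character sum ∑ χ(f_T(y)) is at most q/128.
-- Such a weak form of Weil's bound, uniform in |T| ≤ r = o(q^(1/4)), follows from Stepanov's method: a nonzero
-- polynomial ∑ (p_j + f^((q-1)/2) s_j) X^(qj) of small degree vanishes to high order wherever χ(f_T) takes a given value ±1.
-- Finally the size of a finite field is a prime power: if q = pᵏ m, comparing coefficients in
-- (1 + X)^q = 1 + X^q = (1 + X^(pᵏ))ᵐ shows that p divides m unless m = 1.

module Submission where

open import Defs
open import Level using (0ℓ)
open import Algebra.Bundles using (CommutativeRing)
open import Data.Bool as Bool using (Bool; true; false; if_then_else_)
open import Data.Empty using (⊥-elim)
open import Data.Fin as Fin using (Fin; zero; suc; toℕ; fromℕ<; finToFun; funToFin)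
open import Data.Fin.Permutation using (permutation)
import Data.Fin.Properties as Fin
open import Data.Fin.Subset using (Subset; _∩_) renaming (∣_∣ to card; _∈_ to _∈ˢ_)
open import Data.Integer as ℤ using (ℤ; +_; ∣_∣; 0ℤ; 1ℤ; -1ℤ)
import Data.Integer.Properties as ℤ
import Data.Integer.Solver as ℤSolver
open import Data.List using (List; []; _∷_; _++_; map; drop; length; filter; tabulate)
open import Data.List.Membership.Propositional using (_∈_)
open import Data.List.Properties using (filter-++; length-++; length-map; length-tabulate)
open import Data.List.Relation.Binary.Pointwise as Pointwise using (Pointwise; []; _∷_)
open import Data.List.Relation.Binary.Sublist.Propositional using (_⊆_; []; _∷_; _∷ʳ_)
open import Data.List.Relation.Binary.Sublist.Propositional.Properties using (All-resp-⊆)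
open import Data.List.Relation.Ternary.Interleaving.Propositional using (Interleaving; []; consˡ; consʳ)
open import Data.List.Relation.Unary.All as All using (All; []; _∷_)
import Data.List.Relation.Unary.All.Properties as All
open import Data.List.Relation.Unary.AllPairs as AllPairs using (AllPairs; []; _∷_)
import Data.List.Relation.Unary.AllPairs.Properties as AllPairs
open import Data.List.Relation.Unary.Any using (here; there)
open import Data.Nat as ℕ using (ℕ; zero; suc; NonZero; _!; _≤_; _<_; z≤n; s≤s)
open import Data.Nat.Combinatorics using (_C_; nC1≡n; nCk+nC[k+1]≡[n+1]C[k+1])
open import Data.Nat.Coprimality using (prime⇒coprime; coprime-Bézout)
open import Data.Nat.Divisibility using (_∣_; divides; m%n≡0⇒n∣m)
open import Data.Nat.DivMod using (m≡m%n+[m/n]*n; m%n<n)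
open import Data.Nat.GCD using (module Bézout)
open import Data.Nat.ListAction using (product)
open import Data.Nat.Primality using (Prime; prime⇒nonZero; prime⇒nonTrivial)
open import Data.Nat.Primality.Factorisation using (PrimeFactorisation; factorise)
import Data.Nat.Properties as ℕ
import Data.Nat.Solver as ℕSolver
open import Data.Product using (∃-syntax; _×_; _,_; proj₁; proj₂)
open import Data.Sum using (_⊎_; inj₁; inj₂; [_,_]′)
open import Data.Unit using (tt)
open import Data.Vec as Vec using ([]; _∷_; here; there)
open import Function using (_∘_)
open import Relation.Binary.Definitions using (tri<; tri≈; tri>)
open import Relation.Binary.PropositionalEquality as ≡ using (_≡_)
open import Relation.Nullary using (¬_; Dec; yes; no; does; contradiction)
open import Relation.Nullary.Decidable using (decidable-stable; dec-true; dec-false; _×-dec_; ¬?)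
open import Relation.Unary using (Decidable)

-- The obstacle is the number of error terms: ordered pairs of disjoint sets of total size r
-- outnumber the r-subsets by the factor 2^r, so the cancellation in the inner sums has to win by
-- more than that. A saving of 64^u for the larger set, with u ≥ r/2, is at least 8^r; this leaves a
-- relative error of order 2^(-r) after all counting losses. A character sum bound that saves only a
-- large constant is therefore enough, provided that it holds for every nonempty T of size at most
-- r.
--
-- Two devices keep Stepanov's argument elementary. Orders of vanishing are read off the
-- coefficients of p(X + a), that is, from Hasse derivatives, which is correct in every
-- characteristic. Linear algebra is replaced by counting: as the field is finite, more unknowns
-- than conditions give two coefficient tuples that meet the same conditions, and the difference of
-- their polynomials is the auxiliary polynomial.
--
-- Estimates are cleared of denominators: `suc n` times the error being at most the main term
-- expresses a relative error of at most 1/(n + 1).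

Ring₀ : Set₁
Ring₀ = CommutativeRing 0ℓ 0ℓ

-- Commutative rings and their homomorphisms

module Solver (R : Ring₀) where
  open import Algebra.Solver.Ring.NaturalCoefficients.Default (CommutativeRing.commutativeSemiring R) public
    using (solve; _:=_; _:+_; _:*_; con)

module RingLemmas (R : Ring₀) where
  open CommutativeRing R
  open Solver R
  open import Algebra.Properties.Semiring.Exp semiring public
    using (_^_; ^-congˡ; ^-congʳ; ^-homo-*; ^-assocʳ)
  open import Algebra.Properties.CommutativeSemiring.Exp commutativeSemiring public
    using (^-distrib-*)
  open import Algebra.Properties.Ring ring public
    using (-‿distribˡ-*; -0#≈0#; -‿+-comm; -‿involutive; x[y-z]≈xy-xz)

  x-x≈0 : ∀ x → x - x ≈ 0#
  x-x≈0 = -‿inverseʳ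

  x≈y⇒x-y≈0 : ∀ {x y} → x ≈ y → x - y ≈ 0#
  x≈y⇒x-y≈0 {x} {y} e = trans (+-congʳ e) (x-x≈0 y)

  [x-y]+y≈x : ∀ x y → (x - y) + y ≈ x
  [x-y]+y≈x x y = trans (+-assoc _ _ _) (trans (+-congˡ (-‿inverseˡ y)) (+-identityʳ x))

  [x+y]-y≈x : ∀ x y → (x + y) - y ≈ x
  [x+y]-y≈x x y = trans (+-assoc _ _ _) (trans (+-congˡ (-‿inverseʳ y)) (+-identityʳ x))

  x-y≈0⇒x≈y : ∀ {x y} → x - y ≈ 0# → x ≈ y
  x-y≈0⇒x≈y {x} {y} e = trans (sym ([x-y]+y≈x x y)) (trans (+-congʳ e) (+-identityˡ y))

  +-cancelʳ : ∀ {x y} z → x + z ≈ y + z → x ≈ y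
  +-cancelʳ {x} {y} z e = trans (sym ([x+y]-y≈x x z)) (trans (+-congʳ e) ([x+y]-y≈x y z))

  -- This and the next four identities are instantiated at polynomial rings: the first three drive
  -- the descent in `simple-root-descent`, the other two expand and square the auxiliary polynomials
  -- of Stepanov's method.
  c[xy]²≈x[c[xy²]] : ∀ c x y → c * ((x * y) * (x * y)) ≈ x * (c * (x * (y * y)))
  c[xy]²≈x[c[xy²]] = solve 3 (λ c x y → c :* ((x :* y) :* (x :* y)) := x :* (c :* (x :* (y :* y)))) refl

  x[[xc]y²]≈c[xy]² : ∀ c x y → x * ((x * c) * (y * y)) ≈ c * ((x * y) * (x * y))
  x[[xc]y²]≈c[xy]² = solve 3 (λ c x y → x :* ((x :* c) :* (y :* y)) := c :* ((x :* y) :* (x :* y))) refl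

  x[yz]≈y[xz] : ∀ x y z → x * (y * z) ≈ y * (x * z)
  x[yz]≈y[xz] = solve 3 (λ x y z → x :* (y :* z) := y :* (x :* z)) refl

  u[p+gs+xr] : ∀ u p g s x r → u * ((p + g * s) + x * r) ≈ (u * p + (u * g) * s) + x * (u * r)
  u[p+gs+xr] = solve 6 (λ u p g s x r → u :* ((p :+ g :* s) :+ x :* r) :=
    (u :* p :+ (u :* g) :* s) :+ x :* (u :* r)) refl

  f[gs]²≈[fg²]s² : ∀ f g s → f * ((g * s) * (g * s)) ≈ (f * (g * g)) * (s * s)
  f[gs]²≈[fg²]s² = solve 3 (λ f g s → f :* ((g :* s) :* (g :* s)) := (f :* (g :* g)) :* (s :* s)) refl

  +-cancelˡ : ∀ {x y z} → z + x ≈ z + y → x ≈ y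
  +-cancelˡ {x} {y} {z} e = +-cancelʳ z (trans (+-comm x z) (trans e (+-comm z y)))

  [p+y]-[p+x]≈y-x : ∀ p x y → (p + y) - (p + x) ≈ y - x
  [p+y]-[p+x]≈y-x p x y = +-cancelʳ (p + x) (trans ([x-y]+y≈x _ _) (trans (+-congˡ (sym ([x-y]+y≈x y x)))
    (solve 3 (λ p x d → p :+ (d :+ x) := d :+ (p :+ x)) refl p x (y - x))))

  p-p′≈[p+x]-[p′+x] : ∀ p p′ x → p - p′ ≈ (p + x) - (p′ + x)
  p-p′≈[p+x]-[p′+x] p p′ x = sym (trans (+-cong (+-comm p x) (-‿cong (+-comm p′ x))) ([p+y]-[p+x]≈y-x x p′ p))

  0^suc≈0 : ∀ n → 0# ^ suc n ≈ 0#
  0^suc≈0 n = zeroˡ _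

  1^n≈1 : ∀ n → 1# ^ n ≈ 1#
  1^n≈1 zero    = refl
  1^n≈1 (suc n) = trans (*-identityˡ _) (1^n≈1 n)

-- Constants, evaluation, translation and specialisation are all packaged this way, so that an
-- identity between composites out of a polynomial ring can be checked on generators by
-- `polyHom-unique`.
record Hom (A B : Ring₀) : Set where
  private
    module A = CommutativeRing A
    module B = CommutativeRing B
    module Aₗ = RingLemmas A
    module Bₗ = RingLemmas B
  field
    ⟦_⟧    : A.Carrier → B.Carrier
    ⟦⟧-cong : ∀ {x y} → x A.≈ y → ⟦ x ⟧ B.≈ ⟦ y ⟧
    +-homo : ∀ x y → ⟦ x A.+ y ⟧ B.≈ ⟦ x ⟧ B.+ ⟦ y ⟧
    *-homo : ∀ x y → ⟦ x A.* y ⟧ B.≈ ⟦ x ⟧ B.* ⟦ y ⟧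
    0-homo : ⟦ A.0# ⟧ B.≈ B.0#
    1-homo : ⟦ A.1# ⟧ B.≈ B.1#

  neg-homo : ∀ x → ⟦ A.- x ⟧ B.≈ B.- ⟦ x ⟧
  neg-homo x = Bₗ.+-cancelʳ ⟦ x ⟧
    (B.trans (B.sym (+-homo _ _)) (B.trans (⟦⟧-cong (A.-‿inverseˡ x)) (B.trans 0-homo (B.sym (B.-‿inverseˡ _)))))

  sub-homo : ∀ x y → ⟦ x A.- y ⟧ B.≈ ⟦ x ⟧ B.- ⟦ y ⟧
  sub-homo x y = B.trans (+-homo _ _) (B.+-congˡ (neg-homo y))

  ^-homo : ∀ x n → ⟦ x Aₗ.^ n ⟧ B.≈ ⟦ x ⟧ Bₗ.^ n
  ^-homo x zero    = 1-homo
  ^-homo x (suc n) = B.trans (*-homo _ _) (B.*-congˡ (^-homo x n))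

idHom : ∀ A → Hom A A
idHom A = record { ⟦_⟧ = λ x → x ; ⟦⟧-cong = λ e → e ; +-homo = λ _ _ → refl ; *-homo = λ _ _ → refl
                 ; 0-homo = refl ; 1-homo = refl }
  where open CommutativeRing A

_∘ₕ_ : ∀ {A B C} → Hom B C → Hom A B → Hom A C
_∘ₕ_ {C = C} g f = record
  { ⟦_⟧ = λ x → g.⟦ f.⟦ x ⟧ ⟧
  ; ⟦⟧-cong = λ e → g.⟦⟧-cong (f.⟦⟧-cong e)
  ; +-homo = λ x y → trans (g.⟦⟧-cong (f.+-homo x y)) (g.+-homo _ _)
  ; *-homo = λ x y → trans (g.⟦⟧-cong (f.*-homo x y)) (g.*-homo _ _)
  ; 0-homo = trans (g.⟦⟧-cong f.0-homo) g.0-homo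
  ; 1-homo = trans (g.⟦⟧-cong f.1-homo) g.1-homo
  }
  where
  open CommutativeRing C
  module f = Hom f
  module g = Hom g

-- Polynomials as coefficient lists

module Series (R : Ring₀) where
  open CommutativeRing R
  open Solver R
  open import Relation.Binary.Reasoning.Setoid setoid

  Ser : Set
  Ser = ℕ → Carrier

  tail : Ser → Ser
  tail f n = f (suc n)

  infix 4 _≗_
  _≗_ : Ser → Ser → Set
  f ≗ g = ∀ n → f n ≈ g n

  infixl 7 _⊛_
  -- The Cauchy product, by recursion on the degree, peeling off the constant term of the left
  -- factor. `⊛-sucʳ` is the mirror image of this recursion, and commutativity follows by playing
  -- one against the other.
  _⊛_ : Ser → Ser → Ser
  (f ⊛ g) zero    = f 0 * g 0
  (f ⊛ g) (suc n) = f 0 * g (suc n) + (tail f ⊛ g) n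

  ⊛-cong : ∀ {f f′ g g′} → f ≗ f′ → g ≗ g′ → f ⊛ g ≗ f′ ⊛ g′
  ⊛-cong p q zero    = *-cong (p 0) (q 0)
  ⊛-cong p q (suc n) = +-cong (*-cong (p 0) (q (suc n))) (⊛-cong (λ k → p (suc k)) q n)

  ⊛-zeroˡ : ∀ {f} g → (∀ n → f n ≈ 0#) → ∀ n → (f ⊛ g) n ≈ 0#
  ⊛-zeroˡ g z zero    = trans (*-congʳ (z 0)) (zeroˡ _)
  ⊛-zeroˡ g z (suc n) = trans (+-cong (trans (*-congʳ (z 0)) (zeroˡ _)) (⊛-zeroˡ g (λ k → z (suc k)) n)) (+-identityˡ _)

  ⊛-distribʳ : ∀ h f g n → ((λ k → f k + g k) ⊛ h) n ≈ (f ⊛ h) n + (g ⊛ h) n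
  ⊛-distribʳ h f g zero    = distribʳ _ _ _
  ⊛-distribʳ h f g (suc n) = trans (+-cong (distribʳ _ _ _) (⊛-distribʳ h (tail f) (tail g) n))
    (solve 4 (λ a b c d → (a :+ b) :+ (c :+ d) := (a :+ c) :+ (b :+ d)) refl _ _ _ _)

  ⊛-distribˡ : ∀ h f g n → (h ⊛ (λ k → f k + g k)) n ≈ (h ⊛ f) n + (h ⊛ g) n
  ⊛-distribˡ h f g zero    = distribˡ _ _ _
  ⊛-distribˡ h f g (suc n) = trans (+-cong (distribˡ _ _ _) (⊛-distribˡ (tail h) f g n))
    (solve 4 (λ a b c d → (a :+ b) :+ (c :+ d) := (a :+ c) :+ (b :+ d)) refl _ _ _ _)

  ⊛-scaleˡ : ∀ c f g n → ((λ k → c * f k) ⊛ g) n ≈ c * (f ⊛ g) n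
  ⊛-scaleˡ c f g zero    = *-assoc _ _ _
  ⊛-scaleˡ c f g (suc n) = trans (+-cong (*-assoc _ _ _) (⊛-scaleˡ c (tail f) g n)) (sym (distribˡ _ _ _))

  ⊛-sucʳ : ∀ f g n → (f ⊛ g) (suc n) ≈ (f ⊛ tail g) n + f (suc n) * g 0
  ⊛-sucʳ f g zero    = refl
  ⊛-sucʳ f g (suc n) = trans (+-congˡ (⊛-sucʳ (tail f) g n)) (sym (+-assoc _ _ _))

  ⊛-comm : ∀ f g → f ⊛ g ≗ g ⊛ f
  ⊛-comm f g zero    = *-comm _ _
  ⊛-comm f g (suc n) = begin
    f 0 * g (suc n) + (tail f ⊛ g) n ≈⟨ +-cong (*-comm _ _) (⊛-comm (tail f) g n) ⟩
    g (suc n) * f 0 + (g ⊛ tail f) n ≈⟨ +-comm _ _ ⟩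
    (g ⊛ tail f) n + g (suc n) * f 0 ≈⟨ ⊛-sucʳ g f n ⟨
    (g ⊛ f) (suc n)                  ∎

  ⊛-assoc : ∀ f g h → (f ⊛ g) ⊛ h ≗ f ⊛ (g ⊛ h)
  ⊛-assoc f g h zero    = *-assoc _ _ _
  ⊛-assoc f g h (suc n) = begin
    (f 0 * g 0) * h (suc n) + (tail (f ⊛ g) ⊛ h) n
      ≈⟨ +-congˡ (trans (⊛-distribʳ h (λ k → f 0 * g (suc k)) (tail f ⊛ g) n)
           (+-cong (⊛-scaleˡ (f 0) (tail g) h n) (⊛-assoc (tail f) g h n))) ⟩
    (f 0 * g 0) * h (suc n) + (f 0 * (tail g ⊛ h) n + (tail f ⊛ (g ⊛ h)) n)
      ≈⟨ solve 5 (λ a b c d e → (a :* b) :* c :+ (a :* d :+ e) := a :* (b :* c :+ d) :+ e) refl _ _ _ _ _ ⟩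
    f 0 * (g 0 * h (suc n) + (tail g ⊛ h) n) + (tail f ⊛ (g ⊛ h)) n ∎

  ⊛-degree : ∀ d e f g → (∀ n → d < n → f n ≈ 0#) → (∀ n → e < n → g n ≈ 0#) →
             ∀ n → d ℕ.+ e < n → (f ⊛ g) n ≈ 0#
  ⊛-degree d e f g zf zg zero ()
  ⊛-degree zero e f g zf zg (suc n) lt = trans
    (+-cong (trans (*-congˡ (zg _ lt)) (zeroʳ _)) (⊛-zeroˡ g (λ k → zf (suc k) (s≤s z≤n)) n)) (+-identityˡ _)
  ⊛-degree (suc d) e f g zf zg (suc n) (s≤s lt) = trans
    (+-cong (trans (*-congˡ (zg _ (ℕ.≤-trans (s≤s (ℕ.m≤n+m e (suc d))) (s≤s lt)))) (zeroʳ _))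
      (⊛-degree d e (tail f) g (λ k l → zf (suc k) (s≤s l)) zg n lt)) (+-identityˡ _)

  ⊛-lead : ∀ d e f g → (∀ n → d < n → f n ≈ 0#) → (∀ n → e < n → g n ≈ 0#) →
           (f ⊛ g) (d ℕ.+ e) ≈ f d * g e
  ⊛-lead zero zero f g zf zg = refl
  ⊛-lead zero (suc e) f g zf zg =
    trans (+-congˡ (⊛-zeroˡ g (λ k → zf (suc k) (s≤s z≤n)) e)) (+-identityʳ _)
  ⊛-lead (suc d) e f g zf zg = trans
    (+-cong (trans (*-congˡ (zg _ (s≤s (ℕ.m≤n+m e d)))) (zeroʳ _)) (⊛-lead d e (tail f) g (λ k l → zf (suc k) (s≤s l)) zg))
    (+-identityˡ _)

  ⊛-order : ∀ i j f g → (∀ n → n < i → f n ≈ 0#) → (∀ n → n < j → g n ≈ 0#) →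
            ∀ n → n < i ℕ.+ j → (f ⊛ g) n ≈ 0#
  ⊛-order zero j f g zf zg zero lt = trans (*-congˡ (zg 0 lt)) (zeroʳ _)
  ⊛-order zero j f g zf zg (suc n) lt = trans
    (+-cong (trans (*-congˡ (zg _ lt)) (zeroʳ _)) (⊛-order 0 j (tail f) g (λ _ ()) zg n (ℕ.<-trans (ℕ.n<1+n n) lt))) (+-identityˡ _)
  ⊛-order (suc i) j f g zf zg zero lt = trans (*-congʳ (zf 0 (s≤s z≤n))) (zeroˡ _)
  ⊛-order (suc i) j f g zf zg (suc n) (s≤s lt) = trans
    (+-cong (trans (*-congʳ (zf 0 (s≤s z≤n))) (zeroˡ _))
      (⊛-order i j (tail f) g (λ k l → zf (suc k) (s≤s l)) zg n lt)) (+-identityˡ _)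

module Polynomial (R : Ring₀) where
  open CommutativeRing R
  open RingLemmas R
  open Series R

  Poly : Set
  Poly = List Carrier

  coef : Poly → ℕ → Carrier
  coef []      _       = 0#
  coef (c ∷ p) zero    = c
  coef (c ∷ p) (suc n) = coef p n

  infix 4 _≋_
  -- Coefficient lists may end in zeros, so equality is coefficientwise. The record wrapper allows p
  -- and q to be recovered from the type of a proof.
  record _≋_ (p q : Poly) : Set where
    constructor ≋⟨_⟩
    field at : ∀ n → coef p n ≈ coef q n
  open _≋_ public

  infixl 6 _⊕_
  infixl 7 _⊗_ _·_
  infix 8 ⊖_

  opaque
    _⊕_ : Poly → Poly → Poly
    []      ⊕ q       = q
    (c ∷ p) ⊕ []      = c ∷ p
    (c ∷ p) ⊕ (d ∷ q) = (c + d) ∷ (p ⊕ q)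

    _·_ : Carrier → Poly → Poly
    c · p = map (c *_) p

    _⊗_ : Poly → Poly → Poly
    []      ⊗ q = []
    (c ∷ p) ⊗ q = (c · q) ⊕ (0# ∷ (p ⊗ q))

    ⊖_ : Poly → Poly
    ⊖ p = map (-_) p

    coef-⊕ : ∀ p q n → coef (p ⊕ q) n ≈ coef p n + coef q n
    coef-⊕ []      q       n       = sym (+-identityˡ _)
    coef-⊕ (c ∷ p) []      n       = sym (+-identityʳ _)
    coef-⊕ (c ∷ p) (d ∷ q) zero    = refl
    coef-⊕ (c ∷ p) (d ∷ q) (suc n) = coef-⊕ p q n

    coef-· : ∀ c p n → coef (c · p) n ≈ c * coef p n
    coef-· c []      n       = sym (zeroʳ _)
    coef-· c (d ∷ p) zero    = refl
    coef-· c (d ∷ p) (suc n) = coef-· c p n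

    coef-⊖ : ∀ p n → coef (⊖ p) n ≈ - coef p n
    coef-⊖ []      n       = sym -0#≈0#
    coef-⊖ (d ∷ p) zero    = refl
    coef-⊖ (d ∷ p) (suc n) = coef-⊖ p n

    coef-⊗ : ∀ p q n → coef (p ⊗ q) n ≈ (coef p ⊛ coef q) n
    coef-⊗ [] q n = sym (⊛-zeroˡ (coef q) (λ _ → refl) n)
    coef-⊗ (c ∷ p) q n = trans (coef-⊕ (c · q) (0# ∷ (p ⊗ q)) n) (trans (+-congʳ (coef-· c q n)) (lem n))
      where
      lem : ∀ n → c * coef q n + coef (0# ∷ (p ⊗ q)) n ≈ (coef (c ∷ p) ⊛ coef q) n
      lem zero    = +-identityʳ _
      lem (suc n) = +-congˡ (coef-⊗ p q n)

  private
    one-⊛ : ∀ f n → (coef (1# ∷ []) ⊛ f) n ≈ f n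
    one-⊛ f zero    = *-identityˡ _
    one-⊛ f (suc n) = trans (+-cong (*-identityˡ _) (⊛-zeroˡ f (λ _ → refl) n)) (+-identityʳ _)

    ⊗-comm : ∀ p q → p ⊗ q ≋ q ⊗ p
    ⊗-comm p q = ≋⟨ (λ n → trans (coef-⊗ p q n) (trans (⊛-comm (coef p) (coef q) n) (sym (coef-⊗ q p n)))) ⟩

    ⊗-distribʳ : ∀ r p q → (p ⊕ q) ⊗ r ≋ (p ⊗ r) ⊕ (q ⊗ r)
    ⊗-distribʳ r p q = ≋⟨ (λ n → trans (coef-⊗ (p ⊕ q) r n) (trans (⊛-cong {g = coef r} (coef-⊕ p q) (λ _ → refl) n)
      (trans (⊛-distribʳ (coef r) (coef p) (coef q) n)
        (trans (sym (+-cong (coef-⊗ p r n) (coef-⊗ q r n))) (sym (coef-⊕ (p ⊗ r) (q ⊗ r) n)))))) ⟩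

    ⊗-distribˡ : ∀ r p q → r ⊗ (p ⊕ q) ≋ (r ⊗ p) ⊕ (r ⊗ q)
    ⊗-distribˡ r p q = ≋⟨ (λ n → trans (coef-⊗ r (p ⊕ q) n) (trans (⊛-cong {f = coef r} (λ _ → refl) (coef-⊕ p q) n)
      (trans (⊛-distribˡ (coef r) (coef p) (coef q) n)
        (trans (sym (+-cong (coef-⊗ r p n) (coef-⊗ r q n))) (sym (coef-⊕ (r ⊗ p) (r ⊗ q) n)))))) ⟩

    ⊗-assoc : ∀ p q r → (p ⊗ q) ⊗ r ≋ p ⊗ (q ⊗ r)
    ⊗-assoc p q r = ≋⟨ (λ n → trans (coef-⊗ (p ⊗ q) r n) (trans (⊛-cong {g = coef r} (coef-⊗ p q) (λ _ → refl) n)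
      (trans (⊛-assoc (coef p) (coef q) (coef r) n)
        (trans (sym (⊛-cong {f = coef p} (λ _ → refl) (coef-⊗ q r) n)) (sym (coef-⊗ p (q ⊗ r) n)))))) ⟩

    one-⊗ : ∀ p → (1# ∷ []) ⊗ p ≋ p
    one-⊗ p = ≋⟨ (λ n → trans (coef-⊗ (1# ∷ []) p n) (one-⊛ (coef p) n)) ⟩

    ≋-trans : ∀ {p q r} → p ≋ q → q ≋ r → p ≋ r
    ≋-trans e f = ≋⟨ (λ n → trans (at e n) (at f n)) ⟩

    ⊕-inverseˡ : ∀ p → (⊖ p) ⊕ p ≋ []
    ⊕-inverseˡ p = ≋⟨ (λ n → trans (coef-⊕ (⊖ p) p n) (trans (+-congʳ (coef-⊖ p n)) (-‿inverseˡ _))) ⟩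

    ⊕-comm : ∀ p q → p ⊕ q ≋ q ⊕ p
    ⊕-comm p q = ≋⟨ (λ n → trans (coef-⊕ p q n) (trans (+-comm _ _) (sym (coef-⊕ q p n)))) ⟩

    ⊕-identityʳ : ∀ p → p ⊕ [] ≋ p
    ⊕-identityʳ p = ≋⟨ (λ n → trans (coef-⊕ p [] n) (+-identityʳ _)) ⟩

  polyRing : Ring₀
  polyRing = record
    { Carrier = Poly ; _≈_ = _≋_ ; _+_ = _⊕_ ; _*_ = _⊗_ ; -_ = ⊖_ ; 0# = [] ; 1# = 1# ∷ []
    ; isCommutativeRing = record
      { isRing = record
        { +-isAbelianGroup = record
          { isGroup = record
            { isMonoid = record
              { isSemigroup = record
                { isMagma = record
                  { isEquivalence = record
                    { refl = ≋⟨ (λ _ → refl) ⟩ ; sym = λ e → ≋⟨ (λ n → sym (at e n)) ⟩ ; trans = ≋-trans }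
                  ; ∙-cong = λ {p} {p′} {q} {q′} e f → ≋⟨ (λ n → trans (coef-⊕ p q n)
                      (trans (+-cong (at e n) (at f n)) (sym (coef-⊕ p′ q′ n)))) ⟩ }
                ; assoc = λ p q r → ≋⟨ (λ n → trans (coef-⊕ (p ⊕ q) r n) (trans (+-congʳ (coef-⊕ p q n))
                    (trans (+-assoc _ _ _) (trans (sym (+-congˡ (coef-⊕ q r n))) (sym (coef-⊕ p (q ⊕ r) n)))))) ⟩ }
              ; identity = (λ p → ≋-trans (⊕-comm [] p) (⊕-identityʳ p)) , ⊕-identityʳ }
            ; inverse = ⊕-inverseˡ , (λ p → ≋-trans (⊕-comm p (⊖ p)) (⊕-inverseˡ p))
            ; ⁻¹-cong = λ {p} {q} e → ≋⟨ (λ n → trans (coef-⊖ p n) (trans (-‿cong (at e n)) (sym (coef-⊖ q n)))) ⟩ }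
          ; comm = ⊕-comm }
        ; *-cong = λ {p} {p′} {q} {q′} e f → ≋⟨ (λ n → trans (coef-⊗ p q n)
            (trans (⊛-cong (at e) (at f) n) (sym (coef-⊗ p′ q′ n)))) ⟩
        ; *-assoc = ⊗-assoc
        ; *-identity = one-⊗ , (λ p → ≋-trans (⊗-comm p (1# ∷ [])) (one-⊗ p))
        ; distrib = ⊗-distribˡ , ⊗-distribʳ }
      ; *-comm = ⊗-comm }
    }

  private
    module P = CommutativeRing polyRing
    module Pₗ = RingLemmas polyRing

  Const : Carrier → Poly
  Const c = c ∷ []

  X : Poly
  X = 0# ∷ 1# ∷ []

  coef-Const-⊗ : ∀ c p n → coef (Const c ⊗ p) n ≈ c * coef p n
  coef-Const-⊗ c p zero    = coef-⊗ (Const c) p 0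
  coef-Const-⊗ c p (suc n) = trans (coef-⊗ (Const c) p (suc n))
    (trans (+-congˡ (⊛-zeroˡ (coef p) (λ _ → refl) n)) (+-identityʳ _))

  constHom : Hom R polyRing
  constHom = record
    { ⟦_⟧ = Const
    ; ⟦⟧-cong = λ e → ≋⟨ (λ { zero → e ; (suc n) → refl }) ⟩
    ; +-homo = λ c d → ≋⟨ (λ { zero → sym (coef-⊕ (Const c) (Const d) 0)
                             ; (suc n) → sym (trans (coef-⊕ (Const c) (Const d) (suc n)) (+-identityˡ _)) }) ⟩
    ; *-homo = λ c d → ≋⟨ (λ { zero → sym (coef-Const-⊗ c (Const d) 0)
                             ; (suc n) → sym (trans (coef-Const-⊗ c (Const d) (suc n)) (zeroʳ _)) }) ⟩
    ; 0-homo = ≋⟨ (λ { zero → refl ; (suc n) → refl }) ⟩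
    ; 1-homo = P.refl
    }

  coef-X-⊗-zero : ∀ p → coef (X ⊗ p) 0 ≈ 0#
  coef-X-⊗-zero p = trans (coef-⊗ X p 0) (zeroˡ _)

  coef-X-⊗-suc : ∀ p n → coef (X ⊗ p) (suc n) ≈ coef p n
  coef-X-⊗-suc p n = trans (coef-⊗ X p (suc n))
    (trans (+-congʳ (zeroˡ _)) (trans (+-identityˡ _) (one-⊛ (coef p) n)))

  ∷-decompose : ∀ c p → c ∷ p ≋ Const c ⊕ X ⊗ p
  ∷-decompose c p = ≋⟨ (λ { zero → sym (trans (coef-⊕ (Const c) (X ⊗ p) 0) (trans (+-congˡ (coef-X-⊗-zero p)) (+-identityʳ _)))
                          ; (suc n) → sym (trans (coef-⊕ (Const c) (X ⊗ p) (suc n)) (trans (+-identityˡ _) (coef-X-⊗-suc p n))) }) ⟩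

  Deg≤ : ℕ → Poly → Set
  Deg≤ d p = ∀ n → d < n → coef p n ≈ 0#

  Ord≥ : ℕ → Poly → Set
  Ord≥ m p = ∀ n → n < m → coef p n ≈ 0#

  Deg≤-cong : ∀ {d p q} → p ≋ q → Deg≤ d p → Deg≤ d q
  Deg≤-cong e z n lt = trans (sym (at e n)) (z n lt)

  Deg≤-mono : ∀ {d e p} → d ≤ e → Deg≤ d p → Deg≤ e p
  Deg≤-mono le z n lt = z n (ℕ.≤-<-trans le lt)

  Deg≤-⊕ : ∀ {d p q} → Deg≤ d p → Deg≤ d q → Deg≤ d (p ⊕ q)
  Deg≤-⊕ {p = p} {q} a b n lt = trans (coef-⊕ p q n) (trans (+-cong (a n lt) (b n lt)) (+-identityˡ _))

  Deg≤-⊖ : ∀ {d p} → Deg≤ d p → Deg≤ d (⊖ p)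
  Deg≤-⊖ {p = p} a n lt = trans (coef-⊖ p n) (trans (-‿cong (a n lt)) -0#≈0#)

  Deg≤-⊗ : ∀ {d e p q} → Deg≤ d p → Deg≤ e q → Deg≤ (d ℕ.+ e) (p ⊗ q)
  Deg≤-⊗ {d} {e} {p} {q} a b n lt = trans (coef-⊗ p q n) (⊛-degree d e (coef p) (coef q) a b n lt)

  Deg≤-Const : ∀ c → Deg≤ 0 (Const c)
  Deg≤-Const c (suc n) lt = refl

  Deg≤-X : Deg≤ 1 X
  Deg≤-X (suc zero) (s≤s ())
  Deg≤-X (suc (suc n)) lt = refl

  Deg≤-^ : ∀ {d p} n → Deg≤ d p → Deg≤ (n ℕ.* d) (p Pₗ.^ n)
  Deg≤-^ zero    a = Deg≤-Const 1#
  Deg≤-^ {p = p} (suc n) a = Deg≤-⊗ {p = p} {q = p Pₗ.^ n} a (Deg≤-^ n a)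

  lead-⊗ : ∀ {d e} p q → Deg≤ d p → Deg≤ e q → coef (p ⊗ q) (d ℕ.+ e) ≈ coef p d * coef q e
  lead-⊗ {d} {e} p q a b = trans (coef-⊗ p q (d ℕ.+ e)) (⊛-lead d e (coef p) (coef q) a b)

  Ord≥-cong : ∀ {m p q} → p ≋ q → Ord≥ m p → Ord≥ m q
  Ord≥-cong e z n lt = trans (sym (at e n)) (z n lt)

  Ord≥-mono : ∀ {m m′ p} → m ≤ m′ → Ord≥ m′ p → Ord≥ m p
  Ord≥-mono le z n lt = z n (ℕ.<-≤-trans lt le)

  Ord≥-⊗ : ∀ {i j p q} → Ord≥ i p → Ord≥ j q → Ord≥ (i ℕ.+ j) (p ⊗ q)
  Ord≥-⊗ {i} {j} {p} {q} a b n lt = trans (coef-⊗ p q n) (⊛-order i j (coef p) (coef q) a b n lt)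

  Ord≥-⊗ʳ : ∀ {m} p {q} → Ord≥ m q → Ord≥ m (p ⊗ q)
  Ord≥-⊗ʳ p {q} b = Ord≥-⊗ {0} {p = p} {q} (λ _ ()) b

  Ord≥-^ : ∀ {m p} n → Ord≥ m p → Ord≥ (n ℕ.* m) (p Pₗ.^ n)
  Ord≥-^ zero    a n ()
  Ord≥-^ {p = p} (suc n) a = Ord≥-⊗ {p = p} {q = p Pₗ.^ n} a (Ord≥-^ n a)

  Ord≥-X : Ord≥ 1 X
  Ord≥-X zero lt = refl
  Ord≥-X (suc n) (s≤s ())

-- The universal property of R[X]. Different choices of h and α give the value at a point, the
-- translate p(X + a), the substitution of a polynomial for X, and the maps between polynomials in
-- one and in two variables.
module Evaluation {R A : Ring₀} (h : Hom R A) (α : CommutativeRing.Carrier A) where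
  open CommutativeRing A
  open Solver A
  open Polynomial R
  private
    module R = CommutativeRing R
    module h = Hom h
  open import Relation.Binary.Reasoning.Setoid setoid

  eval : Poly → Carrier
  eval []      = 0#
  eval (c ∷ p) = h.⟦ c ⟧ + α * eval p

  private
    eval-zero : ∀ p → (∀ n → coef p n R.≈ R.0#) → eval p ≈ 0#
    eval-zero []      z = refl
    eval-zero (c ∷ p) z = trans
      (+-cong (trans (h.⟦⟧-cong (z 0)) h.0-homo) (trans (*-congˡ (eval-zero p (λ n → z (suc n)))) (zeroʳ _)))
      (+-identityˡ _)

    eval-cong : ∀ p q → (∀ n → coef p n R.≈ coef q n) → eval p ≈ eval q
    eval-cong []      q       e = sym (eval-zero q (λ n → R.sym (e n)))
    eval-cong (c ∷ p) []      e = eval-zero (c ∷ p) e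
    eval-cong (c ∷ p) (d ∷ q) e = +-cong (h.⟦⟧-cong (e 0)) (*-congˡ (eval-cong p q (λ n → e (suc n))))

    opaque
     unfolding _⊕_

     eval-⊕ : ∀ p q → eval (p ⊕ q) ≈ eval p + eval q
     eval-⊕ []      q       = sym (+-identityˡ _)
     eval-⊕ (c ∷ p) []      = sym (+-identityʳ _)
     eval-⊕ (c ∷ p) (d ∷ q) = trans (+-cong (h.+-homo c d) (*-congˡ (eval-⊕ p q)))
       (solve 5 (λ c d a p q → (c :+ d) :+ a :* (p :+ q) := (c :+ a :* p) :+ (d :+ a :* q)) refl _ _ _ _ _)

     eval-· : ∀ c p → eval (c · p) ≈ h.⟦ c ⟧ * eval p
     eval-· c []      = sym (zeroʳ _)
     eval-· c (d ∷ p) = trans (+-cong (h.*-homo c d) (*-congˡ (eval-· c p)))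
       (solve 4 (λ c d a p → c :* d :+ a :* (c :* p) := c :* (d :+ a :* p)) refl _ _ _ _)

     eval-⊗ : ∀ p q → eval (p ⊗ q) ≈ eval p * eval q
     eval-⊗ []      q = sym (zeroˡ _)
     eval-⊗ (c ∷ p) q = begin
       eval ((c · q) ⊕ (R.0# ∷ (p ⊗ q)))                  ≈⟨ eval-⊕ (c · q) (R.0# ∷ (p ⊗ q)) ⟩
       eval (c · q) + (h.⟦ R.0# ⟧ + α * eval (p ⊗ q))
         ≈⟨ +-cong (eval-· c q) (trans (+-congʳ h.0-homo) (trans (+-identityˡ _) (*-congˡ (eval-⊗ p q)))) ⟩
       h.⟦ c ⟧ * eval q + α * (eval p * eval q)
         ≈⟨ solve 4 (λ c q a p → c :* q :+ a :* (p :* q) := (c :+ a :* p) :* q) refl _ _ _ _ ⟩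
       (h.⟦ c ⟧ + α * eval p) * eval q                    ∎

  eval-Const : ∀ c → eval (Const c) ≈ h.⟦ c ⟧
  eval-Const c = trans (+-congˡ (zeroʳ _)) (+-identityʳ _)

  eval-X : eval X ≈ α
  eval-X = trans (+-cong h.0-homo (trans (*-congˡ (trans (eval-Const R.1#) h.1-homo)) (*-identityʳ _))) (+-identityˡ _)

  evalHom : Hom polyRing A
  evalHom = record
    { ⟦_⟧ = eval ; ⟦⟧-cong = λ {p} {q} e → eval-cong p q (at e) ; +-homo = eval-⊕ ; *-homo = eval-⊗
    ; 0-homo = refl ; 1-homo = trans (eval-Const R.1#) h.1-homo }

module _ {R A : Ring₀} where
  open CommutativeRing A
  open Polynomial R

  -- Induction along c + X p. It replaces coefficient computations whenever two routes between rings
  -- have to agree, as in `coef₀-shift`, `shift-inverse` and `sp-ψ`.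
  polyHom-unique : (f g : Hom polyRing A) → (∀ c → Hom.⟦_⟧ f (Const c) ≈ Hom.⟦_⟧ g (Const c)) →
                   Hom.⟦_⟧ f X ≈ Hom.⟦_⟧ g X → ∀ p → Hom.⟦_⟧ f p ≈ Hom.⟦_⟧ g p
  polyHom-unique f g eC eX [] = trans (Hom.0-homo f) (sym (Hom.0-homo g))
  polyHom-unique f g eC eX (c ∷ p) =
    trans (f.⟦⟧-cong (∷-decompose c p)) (trans (f.+-homo _ _) (trans
      (+-cong (eC c) (trans (f.*-homo X p) (trans (*-cong eX (polyHom-unique f g eC eX p)) (sym (g.*-homo X p)))))
      (trans (sym (g.+-homo _ _)) (sym (g.⟦⟧-cong (∷-decompose c p))))))
    where
    module f = Hom f
    module g = Hom g

-- Polynomials over a finite field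

module FieldPoly (F : FiniteField) where
  open FiniteField F hiding (zero)
  open RingLemmas commRing
  open Polynomial commRing
  open Solver commRing
  module P = CommutativeRing polyRing
  module Pₗ = RingLemmas polyRing
  open import Relation.Binary.Reasoning.Setoid setoid

  *-zero-product : ∀ {x y} → x * y ≈ 0# → x ≈ 0# ⊎ y ≈ 0#
  *-zero-product {x} {y} e with x ≟ 0#
  ... | yes x0 = inj₁ x0
  ... | no x≉0 with inverse x x≉0
  ...   | z , xz≈1 = inj₂ (begin
    y           ≈⟨ *-identityˡ y ⟨
    1# * y      ≈⟨ *-congʳ xz≈1 ⟨
    x * z * y   ≈⟨ solve 3 (λ x y z → x :* z :* y := z :* (x :* y)) refl x y z ⟩
    z * (x * y) ≈⟨ *-congˡ e ⟩
    z * 0#      ≈⟨ zeroʳ z ⟩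
    0#          ∎)

  *-nonzero : ∀ {x y} → x ≉ 0# → y ≉ 0# → x * y ≉ 0#
  *-nonzero nx ny e = [ nx , ny ]′ (*-zero-product e)

  *-cancelˡ-nonzero : ∀ {x y z} → x ≉ 0# → x * y ≈ x * z → y ≈ z
  *-cancelˡ-nonzero {x} {y} {z} nx e =
    [ ⊥-elim ∘ nx , x-y≈0⇒x≈y ]′ (*-zero-product (trans (x[y-z]≈xy-xz x y z) (x≈y⇒x-y≈0 e)))

  ^-nonzero : ∀ {x} n → x ≉ 0# → x ^ n ≉ 0#
  ^-nonzero zero    nx e = 0≉1 (sym e)
  ^-nonzero (suc n) nx   = *-nonzero nx (^-nonzero n nx)

  index : Carrier → Fin size
  index x = proj₁ (enum-surj x)

  enum-index : ∀ x → enum (index x) ≈ x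
  enum-index x = proj₂ (enum-surj x)

  -- Multiplication by x permutes the nonzero elements.
  module _ (x : Carrier) (x≉0 : x ≉ 0#) where
    open import Algebra.Properties.CommutativeMonoid.Sum *-commutativeMonoid
      using () renaming (sum to prod; sum-permute to prod-permute; ∑-distrib-+ to prod-distrib;
        sum-cong-≋ to prod-cong; sum-remove to prod-remove; sum-replicate to prod-replicate;
        sum-replicate-zero to prod-ones)

    private
      y : Carrier
      y = proj₁ (inverse x x≉0)

      yx≈1 : y * x ≈ 1#
      yx≈1 = trans (*-comm y x) (proj₂ (inverse x x≉0))

      -- The products run over all elements, so zero has to be patched. `vals` turns zero into 1,
      -- `ones-but` is the factor by which multiplication by x changes `vals`, and `zeros-but` is
      -- the complementary factor with product x. Their total products 1 and x give x^size = x, with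
      -- no exponent size - 1.
      vals ones-but zeros-but : Carrier → Carrier
      vals z with z ≟ 0#
      ... | yes _ = 1#
      ... | no  _ = z
      ones-but z with z ≟ 0#
      ... | yes _ = 1#
      ... | no  _ = x
      zeros-but z with z ≟ 0#
      ... | yes _ = x
      ... | no  _ = 1#

      vals-nonzero : ∀ z → vals z ≉ 0#
      vals-nonzero z with z ≟ 0#
      ... | yes _ = λ e → 0≉1 (sym e)
      ... | no nz = nz

      vals-cong : ∀ {z w} → z ≈ w → vals z ≈ vals w
      vals-cong {z} {w} e with z ≟ 0# | w ≟ 0#
      ... | yes _ | yes _ = refl
      ... | yes p | no ¬q = ⊥-elim (¬q (trans (sym e) p))
      ... | no ¬p | yes q = ⊥-elim (¬p (trans e q))
      ... | no _  | no _  = e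

      vals-* : ∀ z → vals (x * z) ≈ ones-but z * vals z
      vals-* z with z ≟ 0# | (x * z) ≟ 0#
      ... | yes _ | yes _ = sym (*-identityˡ _)
      ... | yes p | no ¬q = ⊥-elim (¬q (trans (*-congˡ p) (zeroʳ x)))
      ... | no ¬p | yes q = ⊥-elim (*-nonzero x≉0 ¬p q)
      ... | no _  | no _  = refl

      all-x : ∀ z → x ≈ ones-but z * zeros-but z
      all-x z with z ≟ 0#
      ... | yes _ = sym (*-identityˡ _)
      ... | no  _ = sym (*-identityʳ _)

      inverse-index : ∀ a b → a * b ≈ 1# → ∀ i → index (a * enum (index (b * enum i))) ≡ i
      inverse-index a b ab i = enum-inj _ _ (begin
        enum (index (a * enum (index (b * enum i)))) ≈⟨ enum-index _ ⟩
        a * enum (index (b * enum i))                ≈⟨ *-congˡ (enum-index _) ⟩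
        a * (b * enum i)                             ≈⟨ *-assoc _ _ _ ⟨
        a * b * enum i                               ≈⟨ *-congʳ ab ⟩
        1# * enum i                                  ≈⟨ *-identityˡ _ ⟩
        enum i                                       ∎)

      prod-nonzero : ∀ {n} (f : Fin n → Carrier) → (∀ i → f i ≉ 0#) → prod f ≉ 0#
      prod-nonzero {zero}  f nz e = 0≉1 (sym e)
      prod-nonzero {suc n} f nz   = *-nonzero (nz zero) (prod-nonzero (f ∘ suc) (nz ∘ suc))

      prod-ones-but : prod (ones-but ∘ enum) ≈ 1#
      prod-ones-but = sym (*-cancelˡ-nonzero (prod-nonzero (vals ∘ enum) (vals-nonzero ∘ enum)) (begin
        prod (vals ∘ enum) * 1#  ≈⟨ *-identityʳ _ ⟩
        prod (vals ∘ enum)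
          ≈⟨ prod-permute (vals ∘ enum) (permutation (λ i → index (x * enum i)) (λ i → index (y * enum i))
               (inverse-index x y (trans (*-comm x y) yx≈1)) (inverse-index y x yx≈1)) ⟩
        prod (λ i → vals (enum (index (x * enum i))))
          ≈⟨ prod-cong (λ i → trans (vals-cong (enum-index _)) (vals-* (enum i))) ⟩
        prod (λ i → ones-but (enum i) * vals (enum i)) ≈⟨ prod-distrib (ones-but ∘ enum) (vals ∘ enum) ⟩
        prod (ones-but ∘ enum) * prod (vals ∘ enum)    ≈⟨ *-comm _ _ ⟩
        prod (vals ∘ enum) * prod (ones-but ∘ enum)    ∎))

      prod-single : ∀ {n} (f : Fin n → Carrier) (i : Fin n) → (∀ j → ¬ (i ≡ j) → f j ≈ 1#) → prod f ≈ f i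
      prod-single {suc n} f zero h = trans (*-congˡ (trans (prod-cong (λ j → h (suc j) λ ())) (prod-ones n))) (*-identityʳ _)
      prod-single {suc n} f (suc i) h = trans (*-cong (h zero λ ()) (prod-single (f ∘ suc) i (λ j ne → h (suc j) λ { ≡.refl → ne ≡.refl })))
        (*-identityˡ _)

      zeros-but-zero : ∀ z → z ≈ 0# → zeros-but z ≈ x
      zeros-but-zero z e with z ≟ 0#
      ... | yes _ = refl
      ... | no ¬e = ⊥-elim (¬e e)

      zeros-but-nonzero : ∀ z → z ≉ 0# → zeros-but z ≈ 1#
      zeros-but-nonzero z ne with z ≟ 0#
      ... | yes e = ⊥-elim (ne e)
      ... | no _ = refl

      prod-zeros-but : prod (zeros-but ∘ enum) ≈ x
      prod-zeros-but = trans
        (prod-single (zeros-but ∘ enum) (index 0#)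
          (λ j ne → zeros-but-nonzero _ (λ e → ne (enum-inj _ _ (trans (enum-index 0#) (sym e))))))
        (zeros-but-zero _ (enum-index 0#))

    fermat-nonzero : x ^ size ≈ x
    fermat-nonzero = begin
      x ^ size                                             ≈⟨ prod-replicate size ⟨
      prod (λ (_ : Fin size) → x)                          ≈⟨ prod-cong (λ i → all-x (enum i)) ⟩
      prod (λ i → ones-but (enum i) * zeros-but (enum i))  ≈⟨ prod-distrib (ones-but ∘ enum) (zeros-but ∘ enum) ⟩
      prod (ones-but ∘ enum) * prod (zeros-but ∘ enum)     ≈⟨ *-cong prod-ones-but prod-zeros-but ⟩
      1# * x                                               ≈⟨ *-identityˡ x ⟩
      x                                                    ∎

  size>0 : 0 < size
  size>0 with size | index 0#
  ... | suc n | _ = s≤s z≤n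

  fermat : ∀ x → x ^ size ≈ x
  fermat x with x ≟ 0#
  ... | no nz = fermat-nonzero x nz
  ... | yes e = trans (^-congˡ size e) (trans (lem size>0) (sym e))
    where
    lem : ∀ {n} → 0 < n → 0# ^ n ≈ 0#
    lem {suc n} _ = 0^suc≈0 n

  module At (a : Carrier) where
    open Evaluation (idHom commRing) a public using () renaming (eval to ev; evalHom to evHom; eval-X to ev-X; eval-Const to ev-Const)
  open At public using (ev; evHom)

  -- The coefficients of p(X + a) are the Hasse derivatives of p at a. Hence `Ord≥ m (shift a p)`
  -- says that p vanishes to order m at a, also when m exceeds the characteristic.
  module Sh (a : Carrier) where
    open Evaluation constHom (X ⊕ Const a) public using () renaming (eval to shift; evalHom to shiftHom; eval-X to shift-X; eval-Const to shift-Const)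
  open Sh public using (shift; shiftHom)

  linear : Carrier → Poly
  linear t = X ⊕ Const (- t)

  ev-linear : ∀ a t → ev a (linear t) ≈ a - t
  ev-linear a t = trans (Hom.+-homo (evHom a) X (Const (- t))) (+-cong (At.ev-X a) (At.ev-Const a (- t)))

  Const-cong : ∀ {c d} → c ≈ d → Const c ≋ Const d
  Const-cong = Hom.⟦⟧-cong constHom

  shift-linear : ∀ b u → shift b (X ⊕ Const u) ≋ X ⊕ Const (b + u)
  shift-linear b u = P.trans (Hom.+-homo (shiftHom b) X (Const u))
    (P.trans (P.+-cong (Sh.shift-X b) (Sh.shift-Const b u)) (P.trans (P.+-assoc X (Const b) (Const u))
      (P.+-congˡ {x = X} (P.sym (Hom.+-homo constHom b u)))))

  coef-linear-0 : ∀ u → coef (X ⊕ Const u) 0 ≈ u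
  coef-linear-0 u = trans (coef-⊕ X (Const u) 0) (+-identityˡ u)

  coef-linear-1 : ∀ u → coef (X ⊕ Const u) 1 ≈ 1#
  coef-linear-1 u = trans (coef-⊕ X (Const u) 1) (+-identityʳ 1#)

  coef₀Hom : Hom polyRing commRing
  coef₀Hom = record
    { ⟦_⟧ = λ p → coef p 0 ; ⟦⟧-cong = λ e → at e 0 ; +-homo = λ p q → coef-⊕ p q 0
    ; *-homo = λ p q → coef-⊗ p q 0 ; 0-homo = refl ; 1-homo = refl }

  coef₀-shift : ∀ a p → coef (shift a p) 0 ≈ ev a p
  coef₀-shift a = polyHom-unique (coef₀Hom ∘ₕ shiftHom a) (evHom a)
    (λ c → trans (at (Sh.shift-Const a c) 0) (sym (At.ev-Const a c)))
    (trans (at (Sh.shift-X a) 0) (trans (coef-linear-0 a) (sym (At.ev-X a))))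

  shift-inverse : ∀ a b → a + b ≈ 0# → ∀ p → shift a (shift b p) ≋ p
  shift-inverse a b e = polyHom-unique (shiftHom a ∘ₕ shiftHom b) (idHom polyRing)
    (λ c → P.trans (Hom.⟦⟧-cong (shiftHom a) (Sh.shift-Const b c)) (Sh.shift-Const a c))
    (P.trans (Hom.⟦⟧-cong (shiftHom a) (Sh.shift-X b)) (P.trans (shift-linear a b)
      (P.trans (P.+-congˡ {x = X} (P.trans (Const-cong e) (Hom.0-homo constHom))) (P.+-identityʳ X))))

  Deg≤-shift : ∀ a d p → Deg≤ d p → Deg≤ d (shift a p)
  Deg≤-shift a d [] z n lt = refl
  Deg≤-shift a zero (c ∷ p) z = Deg≤-cong {q = shift a (c ∷ p)} (P.sym e) (Deg≤-Const c)
    where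
    e : shift a (c ∷ p) ≋ Const c
    e = P.trans (Hom.⟦⟧-cong (shiftHom a) {c ∷ p} {Const c} ≋⟨ (λ { zero → refl ; (suc n) → z (suc n) (s≤s z≤n) }) ⟩)
          (Sh.shift-Const a c)
  Deg≤-shift a (suc d) (c ∷ p) z = Deg≤-⊕ {p = Const c} {(X ⊕ Const a) ⊗ shift a p}
    (Deg≤-mono {p = Const c} z≤n (Deg≤-Const c))
    (Deg≤-⊗ {1} {d} {X ⊕ Const a} {shift a p}
      (Deg≤-⊕ {p = X} {Const a} Deg≤-X (Deg≤-mono {p = Const a} z≤n (Deg≤-Const a)))
      (Deg≤-shift a d p (λ n lt → z (suc n) (s≤s lt))))

  Deg≤-linear : ∀ u → Deg≤ 1 (X ⊕ Const u)
  Deg≤-linear u = Deg≤-⊕ {p = X} {Const u} Deg≤-X (Deg≤-mono {p = Const u} z≤n (Deg≤-Const u))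

  coef-drop : ∀ m p n → coef (drop m p) n ≈ coef p (m ℕ.+ n)
  coef-drop zero    p       n = refl
  coef-drop (suc m) []      n = refl
  coef-drop (suc m) (c ∷ p) n = coef-drop m p n

  coef-X^-⊗ : ∀ m p n → coef (X Pₗ.^ m ⊗ p) (m ℕ.+ n) ≈ coef p n
  coef-X^-⊗ zero    p n = at (P.*-identityˡ p) n
  coef-X^-⊗ (suc m) p n = trans (at (P.*-assoc X (X Pₗ.^ m) p) (suc m ℕ.+ n))
    (trans (coef-X-⊗-suc (X Pₗ.^ m ⊗ p) (m ℕ.+ n)) (coef-X^-⊗ m p n))

  Ord≥-X^ : ∀ m → Ord≥ m (X Pₗ.^ m)
  Ord≥-X^ m = Ord≥-mono {p = X Pₗ.^ m} (ℕ.≤-reflexive (≡.sym (ℕ.*-identityʳ m))) (Ord≥-^ {p = X} m Ord≥-X)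

  Ord≥-⊗ˡ : ∀ {m p} q → Ord≥ m p → Ord≥ m (p ⊗ q)
  Ord≥-⊗ˡ {m} {p} q z = Ord≥-cong {q = p ⊗ q} (P.*-comm q p) (Ord≥-⊗ʳ q {p} z)

  factor-X^ : ∀ m p → Ord≥ m p → p ≋ X Pₗ.^ m ⊗ drop m p
  factor-X^ m p z = ≋⟨ lem ⟩
    where
    lem : ∀ n → coef p n ≈ coef (X Pₗ.^ m ⊗ drop m p) n
    lem n with n ℕ.<? m
    ... | yes lt = trans (z n lt) (sym (Ord≥-⊗ˡ {m} {X Pₗ.^ m} (drop m p) (Ord≥-X^ m) n lt))
    ... | no ¬lt with ℕ.m≤n⇒∃[o]m+o≡n (ℕ.≮⇒≥ ¬lt)
    ...   | k , ≡.refl = sym (trans (coef-X^-⊗ m (drop m p) k) (coef-drop m p k))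

  coef-linear-⊗-zero : ∀ u p → coef ((X ⊕ Const u) ⊗ p) 0 ≈ u * coef p 0
  coef-linear-⊗-zero u p = trans (coef-⊗ (X ⊕ Const u) p 0) (*-congʳ (coef-linear-0 u))

  coef-linear-⊗-suc : ∀ u p n → coef ((X ⊕ Const u) ⊗ p) (suc n) ≈ coef p n + u * coef p (suc n)
  coef-linear-⊗-suc u p n = trans (at (P.distribʳ p X (Const u)) (suc n))
    (trans (coef-⊕ (X ⊗ p) (Const u ⊗ p) (suc n)) (+-cong (coef-X-⊗-suc p n) (coef-Const-⊗ u p (suc n))))

  -- As u ≠ 0, the polynomial X + u is invertible as a power series, so multiplication by it cannot
  -- raise the order: once the coefficient of p at n is zero, the product at n + 1 is u times the
  -- coefficient of p there.
  Ord≥-cancel-linear : ∀ {m u} p → u ≉ 0# → Ord≥ m ((X ⊕ Const u) ⊗ p) → Ord≥ m p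
  Ord≥-cancel-linear {m} {u} p nu z zero lt =
    [ ⊥-elim ∘ nu , (λ e → e) ]′ (*-zero-product (trans (sym (coef-linear-⊗-zero u p)) (z 0 lt)))
  Ord≥-cancel-linear {m} {u} p nu z (suc n) lt =
    [ ⊥-elim ∘ nu , (λ e → e) ]′ (*-zero-product (begin
      u * coef p (suc n)                ≈⟨ +-identityˡ _ ⟨
      0# + u * coef p (suc n)           ≈⟨ +-congʳ (Ord≥-cancel-linear {m} p nu z n (ℕ.<-trans (ℕ.n<1+n n) lt)) ⟨
      coef p n + u * coef p (suc n)     ≈⟨ coef-linear-⊗-suc u p n ⟨
      coef ((X ⊕ Const u) ⊗ p) (suc n)  ≈⟨ z (suc n) lt ⟩
      0#                                ∎))

  Ord≥-cancel-linear^ : ∀ {m u} k p → u ≉ 0# → Ord≥ m ((X ⊕ Const u) Pₗ.^ k ⊗ p) → Ord≥ m p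
  Ord≥-cancel-linear^ zero p nu z = Ord≥-cong {q = p} (P.*-identityˡ p) z
  Ord≥-cancel-linear^ {m} {u} (suc k) p nu z = Ord≥-cancel-linear^ {m} k p nu
    (Ord≥-cancel-linear {m} ((X ⊕ Const u) Pₗ.^ k ⊗ p) nu
      (Ord≥-cong {q = (X ⊕ Const u) ⊗ ((X ⊕ Const u) Pₗ.^ k ⊗ p)} (P.*-assoc (X ⊕ Const u) ((X ⊕ Const u) Pₗ.^ k) p) z))

  -- Instead of dividing, translate a to the origin, drop the first m coefficients, and translate
  -- back.
  factor-linear^ : ∀ m a {d} p → Ord≥ m (shift a p) → Deg≤ (m ℕ.+ d) p →
                   ∃[ s ] (p ≋ linear a Pₗ.^ m ⊗ s × Deg≤ d s)
  factor-linear^ m a {d} p z dp = s , e , ds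
    where
    pₐ sₐ s : Poly
    pₐ = shift a p
    sₐ = drop m pₐ
    s  = shift (- a) sₐ
    dsₐ : Deg≤ d sₐ
    dsₐ n lt = trans (coef-drop m pₐ n) (Deg≤-shift a _ p dp (m ℕ.+ n) (ℕ.+-monoʳ-< m lt))
    ds : Deg≤ d s
    ds = Deg≤-shift (- a) d sₐ dsₐ
    e : p ≋ linear a Pₗ.^ m ⊗ s
    e = P.trans (P.sym (shift-inverse (- a) a (-‿inverseˡ a) p))
      (P.trans (Hom.⟦⟧-cong (shiftHom (- a)) (factor-X^ m pₐ z))
      (P.trans (Hom.*-homo (shiftHom (- a)) (X Pₗ.^ m) sₐ)
        (P.*-congʳ {x = s} (P.trans (Hom.^-homo (shiftHom (- a)) X m) (Pₗ.^-congˡ m (Sh.shift-X (- a)))))))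

  shift≋0⇒≋0 : ∀ a p → shift a p ≋ [] → p ≋ []
  shift≋0⇒≋0 a p e = P.trans (P.sym (shift-inverse (- a) a (-‿inverseˡ a) p)) (Hom.⟦⟧-cong (shiftHom (- a)) e)

  Distinct : List Carrier → Set
  Distinct = AllPairs _≉_

  -- Splitting off (X - a)^m lowers the degree by m. At any other point b this factor becomes (X +
  -- (b - a))^m, with b - a ≠ 0, so the cofactor inherits the order m there. If m exceeds L, every
  -- coefficient of the translate vanishes and p would be zero.
  roots-bound : ∀ m {L} p → Deg≤ L p → ¬ (p ≋ []) → ∀ as → Distinct as → All (λ a → Ord≥ m (shift a p)) as →
                length as ℕ.* m ≤ L
  roots-bound m p dp np [] _ _ = z≤n
  roots-bound m {L} p dp np (a ∷ as) (a# ∷ uniq) (z ∷ zs) with m ℕ.≤? L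
  ... | no m≰L = ⊥-elim (np (shift≋0⇒≋0 a p ≋⟨ allzero ⟩))
    where
    allzero : ∀ n → coef (shift a p) n ≈ 0#
    allzero n with n ℕ.<? m
    ... | yes lt = z n lt
    ... | no ¬lt = Deg≤-shift a L p dp n (ℕ.<-≤-trans (ℕ.≰⇒> m≰L) (ℕ.≮⇒≥ ¬lt))
  ... | yes m≤L with ℕ.m≤n⇒∃[o]m+o≡n m≤L
  ...   | d , ≡.refl with factor-linear^ m a p z dp
  ...     | s , e , ds = ℕ.+-monoʳ-≤ m (roots-bound m s ds ns as uniq (All.map rest (All.zip (a# , zs))))
    where
    ns : ¬ (s ≋ [])
    ns s0 = np (P.trans e (P.trans (P.*-congˡ {x = linear a Pₗ.^ m} s0) (P.zeroʳ (linear a Pₗ.^ m))))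
    rest : ∀ {b} → (a ≉ b) × Ord≥ m (shift b p) → Ord≥ m (shift b s)
    rest {b} (a≉b , zb) = Ord≥-cancel-linear^ m (shift b s) (λ e → a≉b (sym (x-y≈0⇒x≈y e)))
      (Ord≥-cong {q = (X ⊕ Const (b - a)) Pₗ.^ m ⊗ shift b s} e′ zb)
      where
      e′ : shift b p ≋ (X ⊕ Const (b - a)) Pₗ.^ m ⊗ shift b s
      e′ = P.trans (Hom.⟦⟧-cong (shiftHom b) e) (P.trans (Hom.*-homo (shiftHom b) (linear a Pₗ.^ m) s)
             (P.*-congʳ {x = shift b s} (P.trans (Hom.^-homo (shiftHom b) (linear a) m) (Pₗ.^-congˡ m (shift-linear b (- a))))))

  elements : List Carrier
  elements = tabulate enum

  elements-distinct : Distinct elements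
  elements-distinct = AllPairs.tabulate⁺ (λ {i} {j} ne e → ne (enum-inj i j e))

  vanishing⇒≋0 : ∀ {L} p → Deg≤ L p → L < size → (∀ a → ev a p ≈ 0#) → p ≋ []
  vanishing⇒≋0 {L} p dp lt z = ≋⟨ (λ n → decidable-stable (coef p n ≟ 0#) (λ nz → ℕ.<⇒≱ lt (bound (λ e → nz (at e n))))) ⟩
    where
    ord : ∀ a → Ord≥ 1 (shift a p)
    ord a zero _ = trans (coef₀-shift a p) (z a)
    ord a (suc n) (s≤s ())
    bound : ¬ (p ≋ []) → size ≤ L
    bound np = ≡.subst (_≤ L) (≡.trans (ℕ.*-identityʳ _) (length-tabulate enum))
      (roots-bound 1 p dp np elements elements-distinct (All.universal ord elements))

  Deg≤-linear^ : ∀ u n → Deg≤ n ((X ⊕ Const u) Pₗ.^ n)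
  Deg≤-linear^ u n = Deg≤-mono {p = (X ⊕ Const u) Pₗ.^ n} (ℕ.≤-reflexive (ℕ.*-identityʳ n)) (Deg≤-^ {p = X ⊕ Const u} n (Deg≤-linear u))

  lead-linear^ : ∀ u n → coef ((X ⊕ Const u) Pₗ.^ n) n ≈ 1#
  lead-linear^ u zero = refl
  lead-linear^ u (suc n) = trans (lead-⊗ {1} {n} (X ⊕ Const u) ((X ⊕ Const u) Pₗ.^ n) (Deg≤-linear u) (Deg≤-linear^ u n))
    (trans (*-congʳ (coef-linear-1 u)) (trans (*-identityˡ _) (lead-linear^ u n)))
  -- Writing X as X + 0 lets the facts about (X + u)^n supply the degree and leading coefficient of
  -- X^n too.
  X≋X⊕0 : X ≋ X ⊕ Const 0#
  X≋X⊕0 = P.trans (P.sym (P.+-identityʳ X)) (P.+-congˡ {x = X} (P.sym (Hom.0-homo constHom)))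

  -- Both sides have the same leading term and agree as functions, so their difference has too many roots.
  frobenius : ∀ a → (X ⊕ Const a) Pₗ.^ size ≋ X Pₗ.^ size ⊕ Const a
  frobenius a = Pₗ.x-y≈0⇒x≈y {A} {B} (helper size>0 ≡.refl)
    where
    A B D : Poly
    A = (X ⊕ Const a) Pₗ.^ size
    B = X Pₗ.^ size ⊕ Const a
    D = A P.- B
    X^ : Poly
    X^ = (X ⊕ Const 0#) Pₗ.^ size
    B≋ : B ≋ X^ ⊕ Const a
    B≋ = P.+-congʳ {x = Const a} (Pₗ.^-congˡ size X≋X⊕0)
    vanish : ∀ b → ev b D ≈ 0#
    vanish b = trans (Hom.sub-homo (evHom b) A B) (x≈y⇒x-y≈0 (begin
      ev b A                  ≈⟨ Hom.^-homo (evHom b) (X ⊕ Const a) size ⟩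
      ev b (X ⊕ Const a) ^ size
        ≈⟨ ^-congˡ size (trans (Hom.+-homo (evHom b) X (Const a)) (+-cong (At.ev-X b) (At.ev-Const b a))) ⟩
      (b + a) ^ size          ≈⟨ fermat (b + a) ⟩
      b + a                   ≈⟨ +-congʳ (fermat b) ⟨
      b ^ size + a            ≈⟨ +-cong (trans (Hom.^-homo (evHom b) X size) (^-congˡ size (At.ev-X b))) (At.ev-Const b a) ⟨
      ev b (X Pₗ.^ size) + ev b (Const a) ≈⟨ Hom.+-homo (evHom b) (X Pₗ.^ size) (Const a) ⟨
      ev b B ∎))
    helper : ∀ {n} → 0 < n → n ≡ size → D ≋ []
    helper {suc n} _ eq = vanishing⇒≋0 D deg (≡.subst (n <_) eq (ℕ.n<1+n n)) vanish
      where
      DegA : Deg≤ size A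
      DegA = Deg≤-linear^ a size
      DegB : Deg≤ size (X^ ⊕ Const a)
      DegB = Deg≤-⊕ {p = X^} {Const a} (Deg≤-linear^ 0# size) (Deg≤-mono {p = Const a} z≤n (Deg≤-Const a))
      Const-at : ∀ k → 0 < k → coef (Const a) k ≈ 0#
      Const-at (suc k) _ = refl
      deg : Deg≤ n D
      deg k lt = trans (coef-⊕ A (⊖ B) k) (trans (+-congˡ (trans (coef-⊖ B k) (-‿cong (at B≋ k)))) (x≈y⇒x-y≈0 (go k lt)))
        where
        go : ∀ k → n < k → coef A k ≈ coef (X^ ⊕ Const a) k
        go k lt with k ℕ.≟ size
        ... | yes ≡.refl = trans (lead-linear^ a size) (sym (trans (coef-⊕ X^ (Const a) size)
                (trans (+-cong (lead-linear^ 0# size) (Const-at size size>0)) (+-identityʳ _))))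
        ... | no ne = trans (DegA k gt) (sym (DegB k gt))
          where
          gt : size < k
          gt = ℕ.≤∧≢⇒< (≡.subst (_≤ k) eq lt) (ne ∘ ≡.sym)

-- Stepanov's method

module Truncation (R : Ring₀) where
  open CommutativeRing R
  open Series R
  open Polynomial R

  infix 4 _≋_[modX^_]
  record _≋_[modX^_] (p q : Poly) (m : ℕ) : Set where
    constructor mod⟨_⟩
    field atₘ : ∀ n → n < m → coef p n ≈ coef q n
  open _≋_[modX^_] public

  private variable
    m : ℕ
    p p′ q q′ r : Poly

  mod-≋ : p ≋ q → p ≋ q [modX^ m ]
  mod-≋ e = mod⟨ (λ n _ → at e n) ⟩

  mod-sym : p ≋ q [modX^ m ] → q ≋ p [modX^ m ]
  mod-sym e = mod⟨ (λ n lt → sym (atₘ e n lt)) ⟩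

  mod-trans : p ≋ q [modX^ m ] → q ≋ r [modX^ m ] → p ≋ r [modX^ m ]
  mod-trans e f = mod⟨ (λ n lt → trans (atₘ e n lt) (atₘ f n lt)) ⟩

  mod-⊕ : p ≋ p′ [modX^ m ] → q ≋ q′ [modX^ m ] → p ⊕ q ≋ p′ ⊕ q′ [modX^ m ]
  mod-⊕ {p} {p′} {q = q} {q′} e f = mod⟨ (λ n lt →
    trans (coef-⊕ p q n) (trans (+-cong (atₘ e n lt) (atₘ f n lt)) (sym (coef-⊕ p′ q′ n)))) ⟩

  mod-⊗ : p ≋ p′ [modX^ m ] → q ≋ q′ [modX^ m ] → p ⊗ q ≋ p′ ⊗ q′ [modX^ m ]
  mod-⊗ {p} {p′} {m} {q} {q′} e f = mod⟨ (λ n lt → trans (coef-⊗ p q n)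
      (trans (go (coef p) (coef p′) n (λ k le → atₘ e k (ℕ.≤-<-trans le lt)) (λ k le → atₘ f k (ℕ.≤-<-trans le lt)))
        (sym (coef-⊗ p′ q′ n)))) ⟩
    where
    go : ∀ a a′ n → (∀ k → k ≤ n → a k ≈ a′ k) → (∀ k → k ≤ n → coef q k ≈ coef q′ k) →
         (a ⊛ coef q) n ≈ (a′ ⊛ coef q′) n
    go a a′ zero    x y = *-cong (x 0 z≤n) (y 0 z≤n)
    go a a′ (suc n) x y = +-cong (*-cong (x 0 z≤n) (y (suc n) ℕ.≤-refl))
      (go (tail a) (tail a′) n (λ k le → x (suc k) (s≤s le)) (λ k le → y k (ℕ.m≤n⇒m≤1+n le)))

  mod-refl : p ≋ p [modX^ m ]
  mod-refl = mod⟨ (λ _ _ → refl) ⟩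

  mod-zero : Ord≥ m p → p ≋ [] [modX^ m ]
  mod-zero z = mod⟨ z ⟩

  mod-Deg≤ : ∀ {L} → L < m → Deg≤ L p → Deg≤ L q → p ≋ q [modX^ m ] → p ≋ q
  mod-Deg≤ {m} {p} {q} {L} L<m dp dq e = ≋⟨ go ⟩
    where
    go : ∀ n → coef p n ≈ coef q n
    go n with n ℕ.<? m
    ... | yes lt = atₘ e n lt
    ... | no ¬lt = trans (dp n (ℕ.<-≤-trans L<m (ℕ.≮⇒≥ ¬lt))) (sym (dq n (ℕ.<-≤-trans L<m (ℕ.≮⇒≥ ¬lt))))

module TruncatedBinomial (A : Ring₀) (f w : CommutativeRing.Carrier A) where
  open CommutativeRing A
  open RingLemmas A
  open Solver A
  open import Relation.Binary.Reasoning.Setoid setoid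

  -- binom n m = ∑_{i<m} (n choose i) wⁱ fᵐ⁻ⁱ, built by Pascal's rule
  binom : ℕ → ℕ → Carrier
  binom _       zero    = 0#
  binom zero    (suc m) = f ^ suc m
  binom (suc n) (suc m) = binom n (suc m) + w * binom n m

  -- This is f^n (1 + w/f)^n, cut off after m terms and cleared of the denominator f^m. Since
  -- `binom n m` is homogeneous of degree m in f and w, the large exponent n survives only in the
  -- factor f^n.
  binom-expansion : ∀ n m → ∃[ r ] (f ^ m * (f + w) ^ n ≈ f ^ n * binom n m + w ^ m * r)
  binom-expansion n zero = (f + w) ^ n , sym (trans (+-congʳ (zeroʳ _)) (+-identityˡ _))
  binom-expansion zero (suc m) = 0# , (begin
    f ^ suc m * 1#                     ≈⟨ *-comm _ _ ⟩
    1# * f ^ suc m                     ≈⟨ +-identityʳ _ ⟨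
    1# * f ^ suc m + 0#                ≈⟨ +-congˡ (zeroʳ _) ⟨
    1# * f ^ suc m + w ^ suc m * 0#    ∎)
  binom-expansion (suc n) (suc m) with binom-expansion n (suc m) | binom-expansion n m
  ... | r₁ , e₁ | r₂ , e₂ = f * r₁ + f * r₂ , (begin
    f ^ suc m * ((f + w) * (f + w) ^ n)
      ≈⟨ solve 4 (λ f w a b → (f :* a) :* ((f :+ w) :* b) := f :* ((f :* a) :* b) :+ (w :* f) :* (a :* b)) refl f w _ _ ⟩
    f * (f ^ suc m * (f + w) ^ n) + (w * f) * (f ^ m * (f + w) ^ n)
      ≈⟨ +-cong (*-congˡ e₁) (*-congˡ e₂) ⟩
    f * (f ^ n * binom n (suc m) + w ^ suc m * r₁) + (w * f) * (f ^ n * binom n m + w ^ m * r₂)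
      ≈⟨ solve 8 (λ f w a b c v x y → f :* (a :* b :+ (w :* v) :* x) :+ (w :* f) :* (a :* c :+ v :* y) :=
                    (f :* a) :* (b :+ w :* c) :+ (w :* v) :* (f :* x :+ f :* y)) refl f w _ _ _ _ _ _ ⟩
    f ^ suc n * binom (suc n) (suc m) + w ^ suc m * (f * r₁ + f * r₂) ∎)

-- Numbering tuples turns the pigeonhole principle for `Fin` into one for tuples: this direction is
-- used for the conditions, `finToFun-injective` for the unknown coefficients.
funToFin-injective : ∀ {m n} (f g : Fin m → Fin n) → funToFin f ≡ funToFin g → ∀ i → f i ≡ g i
funToFin-injective f g e i =
  ≡.trans (≡.sym (Fin.finToFun-funToFin f i)) (≡.trans (≡.cong (λ k → finToFun k i) e) (Fin.finToFun-funToFin g i))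

finToFun-injective : ∀ {m n} (k l : Fin (m ℕ.^ n)) → (∀ i → finToFun {m} {n} k i ≡ finToFun l i) → k ≡ l
finToFun-injective {m} {n} k l e = ≡.trans (≡.sym (Fin.funToFin-finToFin {n} {m} k))
  (≡.trans (funToFin-cong (finToFun k) (finToFun l) e) (Fin.funToFin-finToFin {n} {m} l))
  where
  funToFin-cong : ∀ {m n} (f g : Fin m → Fin n) → (∀ i → f i ≡ g i) → funToFin f ≡ funToFin g
  funToFin-cong {zero}  f g e = ≡.refl
  funToFin-cong {suc m} f g e = ≡.cong₂ Fin.combine (e zero) (funToFin-cong (f ∘ suc) (g ∘ suc) (e ∘ suc))

-- Monic polynomials with prescribed roots

module RootPolynomial (F : FiniteField) where
  open FiniteField F hiding (zero)
  open RingLemmas commRing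
  open Polynomial commRing
  open FieldPoly F
  open Truncation commRing
  open import Relation.Binary.Reasoning.Setoid setoid

  rootPoly : List Carrier → Poly
  rootPoly []      = Const 1#
  rootPoly (t ∷ T) = linear t ⊗ rootPoly T

  rootVal : List Carrier → Carrier → Carrier
  rootVal []      x = 1#
  rootVal (t ∷ T) x = (x - t) * rootVal T x

  ev-rootPoly : ∀ T a → ev a (rootPoly T) ≈ rootVal T a
  ev-rootPoly []      a = At.ev-Const a 1#
  ev-rootPoly (t ∷ T) a = trans (Hom.*-homo (evHom a) (linear t) (rootPoly T)) (*-cong (ev-linear a t) (ev-rootPoly T a))

  Deg≤-rootPoly : ∀ T → Deg≤ (length T) (rootPoly T)
  Deg≤-rootPoly []      = Deg≤-Const 1#
  Deg≤-rootPoly (t ∷ T) = Deg≤-⊗ {1} {p = linear t} {rootPoly T} (Deg≤-linear (- t)) (Deg≤-rootPoly T)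

  rootVal-nonzero : ∀ {x} T → All (x ≉_) T → rootVal T x ≉ 0#
  rootVal-nonzero []      _        e = 0≉1 (sym e)
  rootVal-nonzero (t ∷ T) (n ∷ ns)   = *-nonzero (n ∘ x-y≈0⇒x≈y) (rootVal-nonzero T ns)

  -- By `frobenius` each factor (X - t)^size equals X^size - t, which is congruent to -t; the
  -- product of these constants is the value at 0.
  rootPoly^size : ∀ T → rootPoly T Pₗ.^ size ≋ Const (rootVal T 0#) [modX^ size ]
  rootPoly^size [] = mod-≋ (Pₗ.1^n≈1 size)
  rootPoly^size (t ∷ T) =
    mod-trans (mod-≋ (Pₗ.^-distrib-* (linear t) (rootPoly T) size))
    (mod-trans (mod-⊗ (mod-trans (mod-≋ (frobenius (- t))) (mod-⊕ {q = Const (- t)} (mod-zero (Ord≥-X^ size)) mod-refl)) (rootPoly^size T))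
      (mod-≋ (P.trans (P.*-congʳ {x = Const (rootVal T 0#)} (P.+-identityˡ (Const (- t)))) (P.trans (P.sym (Hom.*-homo constHom (- t) (rootVal T 0#)))
        (Const-cong (*-congʳ (sym (+-identityˡ (- t)))))))))

  linear-cancel : ∀ t p q → linear t ⊗ p ≋ linear t ⊗ q → p ≋ q
  linear-cancel t p q e = Pₗ.x-y≈0⇒x≈y {p} {q} (shift≋0⇒≋0 t D
    ≋⟨ (λ n → trans (sym (coef-X-⊗-suc (shift t D) n)) (at e′ (suc n))) ⟩)
    where
    D : Poly
    D = p P.- q
    shift-t : shift t (linear t) ≋ X
    shift-t = P.trans (shift-linear t (- t)) (P.trans (P.+-congˡ {x = X} (P.trans (Const-cong (-‿inverseʳ t)) (Hom.0-homo constHom))) (P.+-identityʳ X))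
    e′ : X ⊗ shift t D ≋ []
    e′ = P.trans (P.sym (P.*-congʳ {x = shift t D} shift-t)) (P.trans (P.sym (Hom.*-homo (shiftHom t) (linear t) D))
      (Hom.⟦⟧-cong (shiftHom t) {linear t ⊗ D} {[]} (P.trans (Pₗ.x[y-z]≈xy-xz (linear t) p q) (Pₗ.x≈y⇒x-y≈0 e))))

  factor-root : ∀ t {d} p → ev t p ≈ 0# → Deg≤ (suc d) p → ∃[ s ] (p ≋ linear t ⊗ s × Deg≤ d s)
  factor-root t {d} p e dp with factor-linear^ 1 t {d} p (λ { zero _ → trans (coef₀-shift t p) e ; (suc n) (s≤s ()) }) dp
  ... | s , e′ , ds = s , P.trans e′ (P.*-congʳ {x = s} (P.*-identityʳ (linear t))) , ds

  factor-root₀ : ∀ t p → ev t p ≈ 0# → Deg≤ 0 p → p ≋ []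
  factor-root₀ t p e dp with factor-linear^ 1 t {0} p (λ { zero _ → trans (coef₀-shift t p) e ; (suc n) (s≤s ()) }) (Deg≤-mono {p = p} z≤n dp)
  ... | s , e′ , ds = P.trans p≋ (P.trans (Const-cong c≈0) (Hom.0-homo constHom))
    where
    p≋ : p ≋ Const (coef p 0)
    p≋ = ≋⟨ (λ { zero → refl ; (suc n) → dp (suc n) (s≤s z≤n) }) ⟩
    c≈0 : coef p 0 ≈ 0#
    c≈0 = trans (sym (At.ev-Const t (coef p 0))) (trans (Hom.⟦⟧-cong (evHom t) (P.sym p≋)) e)

  -- The order of vanishing at t is odd on the left and even on the right, so both p and s vanish (descent on the degree).
  simple-root-descent : ∀ t f c → ev t f ≉ 0# → c ≉ 0# → ∀ d p s → Deg≤ d p → Deg≤ d s →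
    (linear t ⊗ f) ⊗ (p ⊗ p) ≋ Const c ⊗ (s ⊗ s) → p ≋ [] × s ≋ []
  simple-root-descent t f c nf nc = go
    where
    ℓ : Poly
    ℓ = linear t
    evℓ : ev t ℓ ≈ 0#
    evℓ = trans (ev-linear t t) (x-x≈0 t)
    square-root-zero : ∀ {x} → x * x ≈ 0# → x ≈ 0#
    square-root-zero e = [ (λ z → z) , (λ z → z) ]′ (*-zero-product e)
    s-root : ∀ p s → (ℓ ⊗ f) ⊗ (p ⊗ p) ≋ Const c ⊗ (s ⊗ s) → ev t s ≈ 0#
    s-root p s e = square-root-zero ([ ⊥-elim ∘ nc , (λ z → z) ]′ (*-zero-product (begin
      c * (ev t s * ev t s)              ≈⟨ *-cong (At.ev-Const t c) (Hom.*-homo (evHom t) s s) ⟨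
      ev t (Const c) * ev t (s ⊗ s)      ≈⟨ Hom.*-homo (evHom t) (Const c) (s ⊗ s) ⟨
      ev t (Const c ⊗ (s ⊗ s))           ≈⟨ Hom.⟦⟧-cong (evHom t) e ⟨
      ev t ((ℓ ⊗ f) ⊗ (p ⊗ p))           ≈⟨ Hom.*-homo (evHom t) (ℓ ⊗ f) (p ⊗ p) ⟩
      ev t (ℓ ⊗ f) * ev t (p ⊗ p)        ≈⟨ *-congʳ (trans (Hom.*-homo (evHom t) ℓ f) (trans (*-congʳ evℓ) (zeroˡ _))) ⟩
      0# * ev t (p ⊗ p)                  ≈⟨ zeroˡ _ ⟩
      0#                                 ∎)))
    p-root : ∀ p s₁ → f ⊗ (p ⊗ p) ≋ Const c ⊗ (ℓ ⊗ (s₁ ⊗ s₁)) → ev t p ≈ 0#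
    p-root p s₁ e = square-root-zero ([ ⊥-elim ∘ nf , (λ z → z) ]′ (*-zero-product (begin
      ev t f * (ev t p * ev t p)         ≈⟨ *-congˡ (Hom.*-homo (evHom t) p p) ⟨
      ev t f * ev t (p ⊗ p)              ≈⟨ Hom.*-homo (evHom t) f (p ⊗ p) ⟨
      ev t (f ⊗ (p ⊗ p))                 ≈⟨ Hom.⟦⟧-cong (evHom t) e ⟩
      ev t (Const c ⊗ (ℓ ⊗ (s₁ ⊗ s₁)))   ≈⟨ Hom.*-homo (evHom t) (Const c) (ℓ ⊗ (s₁ ⊗ s₁)) ⟩
      ev t (Const c) * ev t (ℓ ⊗ (s₁ ⊗ s₁))
        ≈⟨ *-congˡ (trans (Hom.*-homo (evHom t) ℓ (s₁ ⊗ s₁)) (trans (*-congʳ evℓ) (zeroˡ _))) ⟩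
      ev t (Const c) * 0#                ≈⟨ zeroʳ _ ⟩
      0#                                 ∎)))
    step₁ : ∀ p s₁ → (ℓ ⊗ f) ⊗ (p ⊗ p) ≋ Const c ⊗ ((ℓ ⊗ s₁) ⊗ (ℓ ⊗ s₁)) → f ⊗ (p ⊗ p) ≋ Const c ⊗ (ℓ ⊗ (s₁ ⊗ s₁))
    step₁ p s₁ e = linear-cancel t (f ⊗ (p ⊗ p)) (Const c ⊗ (ℓ ⊗ (s₁ ⊗ s₁))) (P.trans (P.sym (P.*-assoc ℓ f (p ⊗ p))) (P.trans e
      (Pₗ.c[xy]²≈x[c[xy²]] (Const c) ℓ s₁)))
    step₂ : ∀ p₁ s₁ → f ⊗ ((ℓ ⊗ p₁) ⊗ (ℓ ⊗ p₁)) ≋ Const c ⊗ (ℓ ⊗ (s₁ ⊗ s₁)) → (ℓ ⊗ f) ⊗ (p₁ ⊗ p₁) ≋ Const c ⊗ (s₁ ⊗ s₁)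
    step₂ p₁ s₁ e = linear-cancel t ((ℓ ⊗ f) ⊗ (p₁ ⊗ p₁)) (Const c ⊗ (s₁ ⊗ s₁)) (P.trans
      (Pₗ.x[[xc]y²]≈c[xy]² f ℓ p₁)
      (P.trans e (Pₗ.x[yz]≈y[xz] (Const c) ℓ (s₁ ⊗ s₁))))
    subst-s : ∀ p {s s′} → s ≋ s′ → (ℓ ⊗ f) ⊗ (p ⊗ p) ≋ Const c ⊗ (s ⊗ s) → (ℓ ⊗ f) ⊗ (p ⊗ p) ≋ Const c ⊗ (s′ ⊗ s′)
    subst-s p es e = P.trans e (P.*-congˡ {x = Const c} (P.*-cong es es))
    go : ∀ d p s → Deg≤ d p → Deg≤ d s → (ℓ ⊗ f) ⊗ (p ⊗ p) ≋ Const c ⊗ (s ⊗ s) → p ≋ [] × s ≋ []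
    go zero p s dp ds e = factor-root₀ t p (p-root p [] (step₁ p []
        (subst-s p (P.trans s≋0 (P.sym (P.zeroʳ ℓ))) e))) dp , s≋0
      where
      s≋0 : s ≋ []
      s≋0 = factor-root₀ t s (s-root p s e) ds
    go (suc d) p s dp ds e =
      let s₁ , es , ds₁ = factor-root t s (s-root p s e) ds
          e₁ = step₁ p s₁ (subst-s p es e)
          p₁ , ep , dp₁ = factor-root t p (p-root p s₁ e₁) dp
          p₁≋0 , s₁≋0 = go d p₁ s₁ dp₁ ds₁ (step₂ p₁ s₁ (P.trans (P.*-congˡ {x = f} (P.*-cong (P.sym ep) (P.sym ep))) e₁))
      in P.trans ep (P.trans (P.*-congˡ {x = ℓ} p₁≋0) (P.zeroʳ ℓ)) ,
         P.trans es (P.trans (P.*-congˡ {x = ℓ} s₁≋0) (P.zeroʳ ℓ))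

-- Polynomials in a point x and an increment ε

module Bivariate (F : FiniteField) where
  open FiniteField F hiding (zero)
  open Polynomial commRing
  open FieldPoly F
  module Q = Polynomial polyRing
  module QR = CommutativeRing Q.polyRing
  module Qₗ = RingLemmas Q.polyRing
  private
    module QS = Series polyRing

  module Psi = Evaluation (Q.constHom ∘ₕ constHom) (Q.X Q.⊕ Q.Const X)
  module Sp (a : Carrier) = Evaluation (constHom ∘ₕ evHom a) X

  -- p(x) ↦ p(x + ε) and its specialisation at x = a; Q.X is ε and Q.Const X is x.
  ψ : Poly → Q.Poly
  ψ = Psi.eval

  ψHom : Hom polyRing Q.polyRing
  ψHom = Psi.evalHom

  sp : Carrier → Q.Poly → Poly
  sp a = Sp.eval a

  spHom : Carrier → Hom Q.polyRing polyRing
  spHom a = Sp.evalHom a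

  sp-Const : ∀ a p → sp a (Q.Const p) ≋ Const (ev a p)
  sp-Const a p = Sp.eval-Const a p

  -- Expanding p(x + ε) in ε and then setting x = a is the Taylor expansion at a: both sides are
  -- homomorphisms that fix constants and send X to X + a.
  sp-ψ : ∀ a p → sp a (ψ p) ≋ shift a p
  sp-ψ a = polyHom-unique (spHom a ∘ₕ ψHom) (shiftHom a)
    (λ c → P.trans (Hom.⟦⟧-cong (spHom a) (Psi.eval-Const c)) (P.trans (sp-Const a (Const c))
      (P.trans (Const-cong (At.ev-Const a c)) (P.sym (Sh.shift-Const a c)))))
    (P.trans (Hom.⟦⟧-cong (spHom a) Psi.eval-X) (P.trans (Hom.+-homo (spHom a) Q.X (Q.Const X))
      (P.trans (P.+-cong (Sp.eval-X a) (P.trans (sp-Const a X) (Const-cong (At.ev-X a)))) (P.sym (Sh.shift-X a)))))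

  coef-sp : ∀ a H m → coef (sp a H) m ≈ ev a (Q.coef H m)
  coef-sp a [] m = refl
  coef-sp a (c ∷ H) zero = trans (coef-⊕ (Const (ev a c)) (X ⊗ sp a H) 0) (trans (+-congˡ (coef-X-⊗-zero (sp a H))) (+-identityʳ _))
  coef-sp a (c ∷ H) (suc m) = trans (coef-⊕ (Const (ev a c)) (X ⊗ sp a H) (suc m))
    (trans (+-identityˡ _) (trans (coef-X-⊗-suc (sp a H) m) (coef-sp a H m)))

  -- The degree in x of every coefficient in ε. It measures how many field elements it takes to
  -- record a condition at all points a at once.
  XDeg≤ : ℕ → Q.Poly → Set
  XDeg≤ d H = ∀ m → Deg≤ d (Q.coef H m)

  XDeg≤-mono : ∀ {d e H} → d ≤ e → XDeg≤ d H → XDeg≤ e H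
  XDeg≤-mono {H = H} le z m = Deg≤-mono {p = Q.coef H m} le (z m)

  XDeg≤-cong : ∀ {d H K} → H Q.≋ K → XDeg≤ d H → XDeg≤ d K
  XDeg≤-cong {H = H} {K} e z m = Deg≤-cong {q = Q.coef K m} (Q.at e m) (z m)

  XDeg≤-⊕ : ∀ {d H K} → XDeg≤ d H → XDeg≤ d K → XDeg≤ d (H Q.⊕ K)
  XDeg≤-⊕ {H = H} {K} a b m = Deg≤-cong {q = Q.coef (H Q.⊕ K) m} (P.sym (Q.coef-⊕ H K m))
    (Deg≤-⊕ {p = Q.coef H m} {Q.coef K m} (a m) (b m))

  XDeg≤-⊖ : ∀ {d H} → XDeg≤ d H → XDeg≤ d (Q.⊖ H)
  XDeg≤-⊖ {H = H} a m = Deg≤-cong {q = Q.coef (Q.⊖ H) m} (P.sym (Q.coef-⊖ H m)) (Deg≤-⊖ {p = Q.coef H m} (a m))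

  XDeg≤-⊗ : ∀ {d e H K} → XDeg≤ d H → XDeg≤ e K → XDeg≤ (d ℕ.+ e) (H Q.⊗ K)
  XDeg≤-⊗ {d} {e} {H} {K} a b m =
      Deg≤-cong {q = Q.coef (H Q.⊗ K) m} (P.sym (Q.coef-⊗ H K m)) (go (Q.coef H) (Q.coef K) a b m)
    where
    go : ∀ f g → (∀ n → Deg≤ d (f n)) → (∀ n → Deg≤ e (g n)) → ∀ n → Deg≤ (d ℕ.+ e) ((f QS.⊛ g) n)
    go f g a b zero    = Deg≤-⊗ {p = f 0} {g 0} (a 0) (b 0)
    go f g a b (suc n) = Deg≤-⊕ {p = f 0 ⊗ g (suc n)} {(QS.tail f QS.⊛ g) n}
      (Deg≤-⊗ {p = f 0} {g (suc n)} (a 0) (b (suc n))) (go (QS.tail f) g (a ∘ suc) b n)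

  XDeg≤-Const : ∀ {d} p → Deg≤ d p → XDeg≤ d (Q.Const p)
  XDeg≤-Const p z zero    = z
  XDeg≤-Const p z (suc m) = λ _ _ → refl

  XDeg≤-X : XDeg≤ 0 Q.X
  XDeg≤-X zero          = λ _ _ → refl
  XDeg≤-X (suc zero)    = Deg≤-Const 1#
  XDeg≤-X (suc (suc m)) = λ _ _ → refl

  XDeg≤-^ : ∀ {d H} n → XDeg≤ d H → XDeg≤ (n ℕ.* d) (H Qₗ.^ n)
  XDeg≤-^ zero z = XDeg≤-Const (Const 1#) (Deg≤-Const 1#)
  XDeg≤-^ {H = H} (suc n) z = XDeg≤-⊗ {H = H} {H Qₗ.^ n} z (XDeg≤-^ n z)

  XDeg≤-ψ : ∀ d p → Deg≤ d p → XDeg≤ d (ψ p)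
  XDeg≤-ψ d [] z m = λ _ _ → refl
  XDeg≤-ψ zero (c ∷ p) z = XDeg≤-cong {H = Q.Const (Const c)} (QR.sym (QR.trans
      (Hom.⟦⟧-cong ψHom {c ∷ p} {Const c} ≋⟨ (λ { zero → refl ; (suc n) → z (suc n) (s≤s z≤n) }) ⟩) (Psi.eval-Const c)))
    (XDeg≤-Const (Const c) (Deg≤-Const c))
  XDeg≤-ψ (suc d) (c ∷ p) z = XDeg≤-⊕ {H = Q.Const (Const c)} {(Q.X Q.⊕ Q.Const X) Q.⊗ ψ p}
    (XDeg≤-Const (Const c) (Deg≤-mono {p = Const c} z≤n (Deg≤-Const c)))
    (XDeg≤-⊗ {1} {d} {Q.X Q.⊕ Q.Const X} {ψ p}
      (XDeg≤-⊕ {H = Q.X} {Q.Const X} (XDeg≤-mono {H = Q.X} z≤n XDeg≤-X) (XDeg≤-Const X Deg≤-X))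
      (XDeg≤-ψ d p (λ n lt → z (suc n) (s≤s lt))))

-- M is the order of vanishing, J the number of blocks X^(size j), and D bounds the degree of the
-- unknown polynomials. The number N = n + 1 is (size - 1)/2, so f^N takes only the values 0, 1 and
-- -1 on the field.
module Stepanov (F : FiniteField) (n : ℕ) (size≡ : FiniteField.size F ≡ suc (suc n ℕ.+ suc n)) (M J D : ℕ) where
  open FiniteField F hiding (zero)
  open RingLemmas commRing
  open Polynomial commRing
  open FieldPoly F
  open Truncation commRing
  open RootPolynomial F
  open Bivariate F
  open import Relation.Binary.Reasoning.Setoid setoid

  private
    N : ℕ
    N = suc n

  -- The list of roots is nonempty because the independence argument descends at a simple root t of
  -- f, and f(0) ≠ 0 because f^size is congruent to f(0) modulo X^size. The level σ is 1 or -1 in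
  -- the application.
  module _ (t : Carrier) (ts : List Carrier) (distinct : Distinct (t ∷ ts)) (0∉ : rootVal (t ∷ ts) 0# ≉ 0#)
           (σ : Carrier) (σ≉0 : σ ≉ 0#) where
    T : List Carrier
    T = t ∷ ts

    d : ℕ
    d = length T

    f : Poly
    f = rootPoly T

    -- The difference w = f(x + ε) - f(x) vanishes at ε = 0, so w^M may be ignored modulo ε^M. There
    -- f(x)^M f(x + ε)^N is congruent to f(x)^N G, and G has degree at most M d in x.
    fᵠ w G : Q.Poly
    fᵠ = Q.Const f
    w  = ψ f QR.- fᵠ

    module B = TruncatedBinomial Q.polyRing fᵠ w
    G = B.binom N M

    Row : Set
    Row = Poly × Poly

    SmallRow : Row → Set
    SmallRow (p , s) = Deg≤ D p × Deg≤ D s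

    -- ∑ⱼ (pⱼ + fᴺ sⱼ) X^(size·j)
    auxPoly : List Row → Poly
    auxPoly []             = []
    auxPoly ((p , s) ∷ cs) = (p ⊕ f Pₗ.^ N ⊗ s) ⊕ X Pₗ.^ size ⊗ auxPoly cs

    -- A polynomial in x and ε (the outer variable).  At a point x = a with f(a)ᴺ = σ it agrees modulo εᴹ with
    -- f(a)ᴹ · auxPoly(a + ε), yet its degree in x does not involve N or size.
    conditions : List Row → Q.Poly
    conditions []             = []
    conditions ((p , s) ∷ cs) = (fᵠ Qₗ.^ M Q.⊗ ψ p Q.⊕ Q.Const (Const σ) Q.⊗ (G Q.⊗ ψ s)) Q.⊕ Q.Const X Q.⊗ conditions cs

    XDeg≤-w : XDeg≤ d w
    XDeg≤-w = XDeg≤-⊕ {H = ψ f} {Q.⊖ fᵠ} (XDeg≤-ψ d f (Deg≤-rootPoly T))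
      (XDeg≤-⊖ {H = fᵠ} (XDeg≤-Const f (Deg≤-rootPoly T)))

    XDeg≤-binom : ∀ k m → XDeg≤ (m ℕ.* d) (B.binom k m)
    XDeg≤-binom k       zero    _ = λ _ _ → refl
    XDeg≤-binom zero    (suc m)   = XDeg≤-^ {H = fᵠ} (suc m) (XDeg≤-Const f (Deg≤-rootPoly T))
    XDeg≤-binom (suc k) (suc m)   = XDeg≤-⊕ {H = B.binom k (suc m)} {w Q.⊗ B.binom k m} (XDeg≤-binom k (suc m))
      (XDeg≤-⊗ {H = w} {B.binom k m} XDeg≤-w (XDeg≤-binom k m))

    XDeg≤-conditions : ∀ cs → All SmallRow cs → XDeg≤ (M ℕ.* d ℕ.+ D ℕ.+ length cs) (conditions cs)
    XDeg≤-conditions [] _ m = λ _ _ → refl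
    XDeg≤-conditions ((p , s) ∷ cs) ((dp , ds) ∷ small) =
      XDeg≤-⊕ {H = fᵠ Qₗ.^ M Q.⊗ ψ p Q.⊕ Q.Const (Const σ) Q.⊗ (G Q.⊗ ψ s)} {Q.Const X Q.⊗ conditions cs}
        (XDeg≤-mono {H = fᵠ Qₗ.^ M Q.⊗ ψ p Q.⊕ Q.Const (Const σ) Q.⊗ (G Q.⊗ ψ s)} (ℕ.m≤m+n _ _)
          (XDeg≤-⊕ {H = fᵠ Qₗ.^ M Q.⊗ ψ p} {Q.Const (Const σ) Q.⊗ (G Q.⊗ ψ s)}
            (XDeg≤-⊗ {H = fᵠ Qₗ.^ M} {ψ p} (XDeg≤-^ {H = fᵠ} M (XDeg≤-Const f (Deg≤-rootPoly T))) (XDeg≤-ψ D p dp))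
            (XDeg≤-⊗ {0} {H = Q.Const (Const σ)} {G Q.⊗ ψ s} (XDeg≤-Const (Const σ) (Deg≤-Const σ))
              (XDeg≤-⊗ {H = G} {ψ s} (XDeg≤-binom N M) (XDeg≤-ψ D s ds)))))
        (XDeg≤-mono {H = Q.Const X Q.⊗ conditions cs} (ℕ.≤-reflexive (≡.sym (ℕ.+-suc _ (length cs))))
          (XDeg≤-⊗ {1} {H = Q.Const X} {conditions cs} (XDeg≤-Const X Deg≤-X) (XDeg≤-conditions cs small)))

    Deg≤-auxPoly : ∀ cs → All SmallRow cs → Deg≤ (D ℕ.+ N ℕ.* d ℕ.+ length cs ℕ.* size) (auxPoly cs)
    Deg≤-auxPoly [] _ n _ = refl
    Deg≤-auxPoly ((p , s) ∷ cs) ((dp , ds) ∷ small) =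
      Deg≤-⊕ {p = p ⊕ f Pₗ.^ N ⊗ s} {X Pₗ.^ size ⊗ auxPoly cs}
        (Deg≤-mono {p = p ⊕ f Pₗ.^ N ⊗ s} (ℕ.m≤m+n _ _) (Deg≤-⊕ {p = p} {f Pₗ.^ N ⊗ s}
          (Deg≤-mono {p = p} (ℕ.m≤m+n D _) dp)
          (Deg≤-mono {p = f Pₗ.^ N ⊗ s} (ℕ.≤-reflexive (ℕ.+-comm (N ℕ.* d) D))
            (Deg≤-⊗ {p = f Pₗ.^ N} {s} (Deg≤-^ {p = f} N (Deg≤-rootPoly T)) ds))))
        (Deg≤-mono {p = X Pₗ.^ size ⊗ auxPoly cs} (ℕ.≤-reflexive lem)
          (Deg≤-⊗ {p = X Pₗ.^ size} {auxPoly cs} (Deg≤-^ {p = X} size Deg≤-X) (Deg≤-auxPoly cs small)))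
      where
      lem : size ℕ.* 1 ℕ.+ (D ℕ.+ N ℕ.* d ℕ.+ length cs ℕ.* size) ≡ D ℕ.+ N ℕ.* d ℕ.+ (size ℕ.+ length cs ℕ.* size)
      lem = ≡.trans (≡.cong (ℕ._+ (D ℕ.+ N ℕ.* d ℕ.+ length cs ℕ.* size)) (ℕ.*-identityʳ size))
        (≡.trans (≡.sym (ℕ.+-assoc size (D ℕ.+ N ℕ.* d) _)) (≡.trans (≡.cong (ℕ._+ (length cs ℕ.* size)) (ℕ.+-comm size (D ℕ.+ N ℕ.* d)))
          (ℕ.+-assoc (D ℕ.+ N ℕ.* d) size _)))

    module _ (M≤size : M ≤ size) (a : Carrier) (fa : rootVal T a ^ N ≈ σ) where
      fₐ : Carrier
      fₐ = ev a f

      sp-w : Ord≥ 1 (sp a w)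
      sp-w zero _ = trans (at (Hom.sub-homo (spHom a) (ψ f) fᵠ) 0)
        (trans (coef-⊕ (sp a (ψ f)) (⊖ sp a fᵠ) 0)
        (trans (+-cong (trans (at (sp-ψ a f) 0) (coef₀-shift a f)) (trans (coef-⊖ (sp a fᵠ) 0) (-‿cong (at (sp-Const a f) 0)))) (x-x≈0 fₐ)))
      sp-w (suc n) (s≤s ())

      sp-fᵠ^ : ∀ k → sp a (fᵠ Qₗ.^ k) ≋ Const (fₐ ^ k)
      sp-fᵠ^ k = P.trans (Hom.^-homo (spHom a) fᵠ k) (P.trans (Pₗ.^-congˡ k (sp-Const a f)) (P.sym (Hom.^-homo constHom fₐ k)))

      -- Here the level set enters: at x = a the factor f(x)^N of the expansion is the constant σ,
      -- which removes the degree N d from the conditions.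
      sp-G : Const (fₐ ^ M) ⊗ shift a (f Pₗ.^ N) ≋ Const σ ⊗ sp a G [modX^ M ]
      sp-G =
        let r , e = B.binom-expansion N M
            e₁ : sp a (fᵠ Qₗ.^ M Q.⊗ ψ f Qₗ.^ N) ≋ sp a (fᵠ Qₗ.^ N Q.⊗ G Q.⊕ w Qₗ.^ M Q.⊗ r)
            e₁ = Hom.⟦⟧-cong (spHom a) (QR.trans (QR.*-congˡ {x = fᵠ Qₗ.^ M} (Qₗ.^-congˡ N
                   (QR.sym (QR.trans (QR.+-comm fᵠ w) (Qₗ.[x-y]+y≈x (ψ f) fᵠ))))) e)
            lhs : sp a (fᵠ Qₗ.^ M Q.⊗ ψ f Qₗ.^ N) ≋ Const (fₐ ^ M) ⊗ shift a (f Pₗ.^ N)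
            lhs = P.trans (Hom.*-homo (spHom a) (fᵠ Qₗ.^ M) (ψ f Qₗ.^ N))
                    (P.*-cong (sp-fᵠ^ M) (P.trans (Hom.⟦⟧-cong (spHom a) (QR.sym (Hom.^-homo ψHom f N))) (sp-ψ a (f Pₗ.^ N))))
            fₐ^N : fₐ ^ N ≈ σ
            fₐ^N = trans (^-congˡ N (ev-rootPoly T a)) fa
            rhs : sp a (fᵠ Qₗ.^ N Q.⊗ G Q.⊕ w Qₗ.^ M Q.⊗ r) ≋ Const σ ⊗ sp a G ⊕ sp a w Pₗ.^ M ⊗ sp a r
            rhs = P.trans (Hom.+-homo (spHom a) (fᵠ Qₗ.^ N Q.⊗ G) (w Qₗ.^ M Q.⊗ r)) (P.+-cong
                    (P.trans (Hom.*-homo (spHom a) (fᵠ Qₗ.^ N) G) (P.*-congʳ {x = sp a G} (P.trans (sp-fᵠ^ N) (Const-cong fₐ^N))))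
                    (P.trans (Hom.*-homo (spHom a) (w Qₗ.^ M) r) (P.*-congʳ {x = sp a r} (Hom.^-homo (spHom a) w M))))
            small : Ord≥ M (sp a w Pₗ.^ M ⊗ sp a r)
            small = Ord≥-⊗ˡ {M} {sp a w Pₗ.^ M} (sp a r) (Ord≥-mono {p = sp a w Pₗ.^ M} (ℕ.≤-reflexive (≡.sym (ℕ.*-identityʳ M)))
                      (Ord≥-^ {p = sp a w} M sp-w))
        in mod-trans (mod-≋ (P.trans (P.sym lhs) (P.trans e₁ rhs)))
             (mod-trans (mod-⊕ mod-refl (mod-zero small)) (mod-≋ (P.+-identityʳ (Const σ ⊗ sp a G))))

      -- By `frobenius`, (a + ε)^size = a + ε^size, and M ≤ size discards the second term. This is
      -- why a block X^(size j) costs only x^j in `conditions`.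
      shift-X^size : shift a (X Pₗ.^ size) ≋ Const a [modX^ M ]
      shift-X^size = mod-trans
        (mod-≋ (P.trans (Hom.^-homo (shiftHom a) X size) (P.trans (Pₗ.^-congˡ size (Sh.shift-X a)) (frobenius a))))
        (mod-trans (mod-⊕ (mod-zero (Ord≥-mono {p = X Pₗ.^ size} M≤size (Ord≥-X^ size))) mod-refl) (mod-≋ (P.+-identityˡ (Const a))))

      shift-auxPoly : ∀ cs → Const (fₐ ^ M) ⊗ shift a (auxPoly cs) ≋ sp a (conditions cs) [modX^ M ]
      shift-auxPoly [] = mod-≋ (P.zeroʳ (Const (fₐ ^ M)))
      shift-auxPoly ((p , s) ∷ cs) = mod-trans (mod-≋ expand) (mod-trans (mod-⊕ (mod-⊕ mod-refl middle) rest) (mod-≋ collapse))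
        where
        u pₐ sₐ gₐ xₐ rₐ : Poly
        u  = Const (fₐ ^ M)
        pₐ = shift a p
        sₐ = shift a s
        gₐ = shift a (f Pₗ.^ N)
        xₐ = shift a (X Pₗ.^ size)
        rₐ = shift a (auxPoly cs)
        expand : u ⊗ shift a (auxPoly ((p , s) ∷ cs)) ≋ (u ⊗ pₐ ⊕ (u ⊗ gₐ) ⊗ sₐ) ⊕ xₐ ⊗ (u ⊗ rₐ)
        expand = P.trans (P.*-congˡ {x = u} (P.trans (Hom.+-homo (shiftHom a) (p ⊕ f Pₗ.^ N ⊗ s) (X Pₗ.^ size ⊗ auxPoly cs))
          (P.+-cong (P.trans (Hom.+-homo (shiftHom a) p (f Pₗ.^ N ⊗ s)) (P.+-congˡ {x = pₐ} (Hom.*-homo (shiftHom a) (f Pₗ.^ N) s)))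
            (Hom.*-homo (shiftHom a) (X Pₗ.^ size) (auxPoly cs)))))
          (Pₗ.u[p+gs+xr] u pₐ gₐ sₐ xₐ rₐ)
        middle : (u ⊗ gₐ) ⊗ sₐ ≋ (Const σ ⊗ sp a G) ⊗ sₐ [modX^ M ]
        middle = mod-⊗ sp-G mod-refl
        rest : xₐ ⊗ (u ⊗ rₐ) ≋ Const a ⊗ sp a (conditions cs) [modX^ M ]
        rest = mod-⊗ shift-X^size (shift-auxPoly cs)
        collapse : (u ⊗ pₐ ⊕ (Const σ ⊗ sp a G) ⊗ sₐ) ⊕ Const a ⊗ sp a (conditions cs) ≋ sp a (conditions ((p , s) ∷ cs))
        collapse = P.sym (P.trans
          (Hom.+-homo (spHom a) (fᵠ Qₗ.^ M Q.⊗ ψ p Q.⊕ Q.Const (Const σ) Q.⊗ (G Q.⊗ ψ s)) (Q.Const X Q.⊗ conditions cs))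
          (P.+-cong
            (P.trans (Hom.+-homo (spHom a) (fᵠ Qₗ.^ M Q.⊗ ψ p) (Q.Const (Const σ) Q.⊗ (G Q.⊗ ψ s)))
              (P.+-cong
                (P.trans (Hom.*-homo (spHom a) (fᵠ Qₗ.^ M) (ψ p)) (P.*-cong (sp-fᵠ^ M) (sp-ψ a p)))
                (P.trans (Hom.*-homo (spHom a) (Q.Const (Const σ)) (G Q.⊗ ψ s))
                  (P.trans (P.*-cong (P.trans (sp-Const a (Const σ)) (Const-cong (At.ev-Const a σ)))
                    (P.trans (Hom.*-homo (spHom a) G (ψ s)) (P.*-congˡ {x = sp a G} (sp-ψ a s))))
                    (P.sym (P.*-assoc (Const σ) (sp a G) sₐ))))))
            (P.trans (Hom.*-homo (spHom a) (Q.Const X) (conditions cs))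
              (P.*-congʳ {x = sp a (conditions cs)} (P.trans (sp-Const a X) (Const-cong (At.ev-X a)))))))

      fₐ^M≉0 : fₐ ^ M ≉ 0#
      fₐ^M≉0 = ^-nonzero M (λ e → σ≉0 (trans (sym fa) (trans (^-congˡ N (trans (sym (ev-rootPoly T a)) e)) (0^suc≈0 n))))

      -- The form fits the pigeonhole: tuples with equal conditions give equal Taylor coefficients
      -- of f(a)^M times the auxiliary polynomials below order M, and f(a)^M ≠ 0 can be cancelled.
      Ord≥-shift-difference : ∀ cs cs′ → (∀ m → m < M → Q.coef (conditions cs) m ≋ Q.coef (conditions cs′) m) →
                              Ord≥ M (shift a (auxPoly cs P.- auxPoly cs′))
      Ord≥-shift-difference cs cs′ e m lt = trans (at (Hom.sub-homo (shiftHom a) (auxPoly cs) (auxPoly cs′)) m)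
        (trans (coef-⊕ A (⊖ A′) m) (trans (+-congˡ (coef-⊖ A′ m)) (x≈y⇒x-y≈0 (*-cancelˡ-nonzero fₐ^M≉0 (begin
          fₐ ^ M * coef A m               ≈⟨ coef-Const-⊗ (fₐ ^ M) A m ⟨
          coef (Const (fₐ ^ M) ⊗ A) m     ≈⟨ atₘ (shift-auxPoly cs) m lt ⟩
          coef (sp a (conditions cs)) m   ≈⟨ coef-sp a (conditions cs) m ⟩
          ev a (Q.coef (conditions cs) m) ≈⟨ Hom.⟦⟧-cong (evHom a) (e m lt) ⟩
          ev a (Q.coef (conditions cs′) m) ≈⟨ coef-sp a (conditions cs′) m ⟨
          coef (sp a (conditions cs′)) m  ≈⟨ atₘ (shift-auxPoly cs′) m lt ⟨
          coef (Const (fₐ ^ M) ⊗ A′) m    ≈⟨ coef-Const-⊗ (fₐ ^ M) A′ m ⟩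
          fₐ ^ M * coef A′ m              ∎)))))
        where
        A A′ : Poly
        A  = shift a (auxPoly cs)
        A′ = shift a (auxPoly cs′)

    module _ (2D+d<size : D ℕ.+ D ℕ.+ d < size) where
      f[f^N]² : f ⊗ (f Pₗ.^ N ⊗ f Pₗ.^ N) ≋ Const (rootVal T 0#) [modX^ size ]
      f[f^N]² = mod-trans (mod-≋ (P.sym (P.trans (Pₗ.^-congʳ f size≡) (P.*-congˡ {x = f} (Pₗ.^-homo-* f N N))))) (rootPoly^size T)

      -- Squaring p = fᴺ s and multiplying by f gives f p² = f^size s² = f(0) s² modulo X^size.
      independent : ∀ p s → Deg≤ D p → Deg≤ D s → p ≋ f Pₗ.^ N ⊗ s [modX^ size ] → p ≋ [] × s ≋ []
      independent p s dp ds e = simple-root-descent t (rootPoly ts) (rootVal T 0#)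
          (λ z → rootVal-nonzero ts (AllPairs-head distinct) (trans (sym (ev-rootPoly ts t)) z)) 0∉ D p s dp ds
          (mod-Deg≤ 2D+d<size deg₁ deg₂ (mod-trans (mod-⊗ {p = f} mod-refl (mod-⊗ e e))
            (mod-trans (mod-≋ (Pₗ.f[gs]²≈[fg²]s² f (f Pₗ.^ N) s)) (mod-⊗ f[f^N]² mod-refl))))
        where
        AllPairs-head : ∀ {x xs} → Distinct (x ∷ xs) → All (x ≉_) xs
        AllPairs-head (h ∷ _) = h
        deg₁ : Deg≤ (D ℕ.+ D ℕ.+ d) (f ⊗ (p ⊗ p))
        deg₁ = Deg≤-mono {p = f ⊗ (p ⊗ p)} (ℕ.≤-reflexive (ℕ.+-comm d (D ℕ.+ D)))
          (Deg≤-⊗ {p = f} {p ⊗ p} (Deg≤-rootPoly T) (Deg≤-⊗ {p = p} {p} dp dp))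
        deg₂ : Deg≤ (D ℕ.+ D ℕ.+ d) (Const (rootVal T 0#) ⊗ (s ⊗ s))
        deg₂ = Deg≤-mono {p = Const (rootVal T 0#) ⊗ (s ⊗ s)} (ℕ.m≤m+n (D ℕ.+ D) d)
          (Deg≤-⊗ {0} {p = Const (rootVal T 0#)} {s ⊗ s} (Deg≤-Const _) (Deg≤-⊗ {p = s} {s} ds ds))

      _≈ʳ_ : Row → Row → Set
      (p , s) ≈ʳ (p′ , s′) = p ≋ p′ × s ≋ s′

      independent-pair : ∀ p p′ s s′ → Deg≤ D p → Deg≤ D p′ → Deg≤ D s → Deg≤ D s′ →
        p ⊕ f Pₗ.^ N ⊗ s ≋ p′ ⊕ f Pₗ.^ N ⊗ s′ [modX^ size ] → (p , s) ≈ʳ (p′ , s′)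
      independent-pair p p′ s s′ dp dp′ ds ds′ e =
        let a , b = independent (p P.- p′) (s′ P.- s) (Deg≤-⊕ {p = p} {⊖ p′} dp (Deg≤-⊖ {p = p′} dp′))
              (Deg≤-⊕ {p = s′} {⊖ s} ds′ (Deg≤-⊖ {p = s} ds))
              (mod-trans (mod-≋ (Pₗ.p-p′≈[p+x]-[p′+x] p p′ (g ⊗ s)))
                (mod-trans (mod-⊕ {q = ⊖ (p′ ⊕ g ⊗ s)} e mod-refl)
                  (mod-≋ (P.trans (Pₗ.[p+y]-[p+x]≈y-x p′ (g ⊗ s) (g ⊗ s′)) (P.sym (Pₗ.x[y-z]≈xy-xz g s′ s))))))
        in Pₗ.x-y≈0⇒x≈y {p} {p′} a , P.sym (Pₗ.x-y≈0⇒x≈y {s′} {s} b)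
        where
        g : Poly
        g = f Pₗ.^ N

      -- Reduction modulo X^size isolates the first block, which `independent-pair` determines.
      -- Cancelling it and dividing by X^size leaves the other blocks. Distinct tuples thus have a
      -- nonzero difference of auxiliary polynomials.
      auxPoly-injective : ∀ cs cs′ → length cs ≡ length cs′ → All SmallRow cs → All SmallRow cs′ →
                          auxPoly cs ≋ auxPoly cs′ → Pointwise _≈ʳ_ cs cs′
      auxPoly-injective [] [] _ _ _ _ = []
      auxPoly-injective ((p , s) ∷ cs) ((p′ , s′) ∷ cs′) le ((dp , ds) ∷ sm) ((dp′ , ds′) ∷ sm′) e =
          h ∷ auxPoly-injective cs cs′ (ℕ.suc-injective le) sm sm′ tail-eq
        where
        A A′ : Poly
        A  = auxPoly cs
        A′ = auxPoly cs′
        low : ∀ c B → c ⊕ X Pₗ.^ size ⊗ B ≋ c [modX^ size ]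
        low c B = mod-trans (mod-⊕ {p = c} mod-refl (mod-zero (Ord≥-⊗ˡ {size} {X Pₗ.^ size} B (Ord≥-X^ size)))) (mod-≋ (P.+-identityʳ c))
        h : (p , s) ≈ʳ (p′ , s′)
        h = independent-pair p p′ s s′ dp dp′ ds ds′
          (mod-trans (mod-sym (low (p ⊕ f Pₗ.^ N ⊗ s) A)) (mod-trans (mod-≋ e) (low (p′ ⊕ f Pₗ.^ N ⊗ s′) A′)))
        heads : p ⊕ f Pₗ.^ N ⊗ s ≋ p′ ⊕ f Pₗ.^ N ⊗ s′
        heads = P.+-cong (proj₁ h) (P.*-congˡ {x = f Pₗ.^ N} (proj₂ h))
        tails : X Pₗ.^ size ⊗ A ≋ X Pₗ.^ size ⊗ A′
        tails = Pₗ.+-cancelˡ (P.trans e (P.+-congʳ {x = X Pₗ.^ size ⊗ A′} (P.sym heads)))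
        tail-eq : A ≋ A′
        tail-eq = ≋⟨ (λ k → trans (sym (coef-X^-⊗ size A k)) (trans (at tails (size ℕ.+ k)) (coef-X^-⊗ size A′ k))) ⟩

    -- In `more-unknowns` the left side counts scalar conditions, M coefficients in ε with M d + D +
    -- J + 1 coefficients in x each. The right side counts scalar unknowns, J rows of two
    -- polynomials with D + 1 coefficients.
    module _ (M≤size : M ≤ size) (2D+d<size : D ℕ.+ D ℕ.+ d < size)
             (more-unknowns : suc (M ℕ.* d ℕ.+ D ℕ.+ J) ℕ.* M < suc D ℕ.* 2 ℕ.* J) where
      private
        D₁ L₁ : ℕ
        D₁ = suc D
        L₁ = suc (M ℕ.* d ℕ.+ D ℕ.+ J)

        Unknowns Conditions : ℕ
        Unknowns = ((size ℕ.^ D₁) ℕ.^ 2) ℕ.^ J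
        Conditions = (size ℕ.^ L₁) ℕ.^ M

        coef-tabulate : ∀ {k} (g : Fin k → Carrier) i → coef (tabulate g) (toℕ i) ≈ g i
        coef-tabulate g zero    = refl
        coef-tabulate g (suc i) = coef-tabulate (g ∘ suc) i

        coef-tabulate-≥ : ∀ {k} (g : Fin k → Carrier) i → k ≤ i → coef (tabulate g) i ≈ 0#
        coef-tabulate-≥ {zero}  g i       _           = refl
        coef-tabulate-≥ {suc k} g (suc i) (s≤s le) = coef-tabulate-≥ (g ∘ suc) i le

        polyOf : Fin (size ℕ.^ D₁) → Poly
        polyOf k = tabulate (λ i → enum (finToFun {size} {D₁} k i))

        Deg≤-polyOf : ∀ k → Deg≤ D (polyOf k)
        Deg≤-polyOf k i lt = coef-tabulate-≥ (λ j → enum (finToFun {size} {D₁} k j)) i lt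

        polyOf-injective : ∀ k l → polyOf k ≋ polyOf l → k ≡ l
        polyOf-injective k l e = finToFun-injective {size} {D₁} k l (λ i → enum-inj _ _
          (trans (sym (coef-tabulate (λ j → enum (finToFun {size} {D₁} k j)) i))
            (trans (at e (toℕ i)) (coef-tabulate (λ j → enum (finToFun {size} {D₁} l j)) i))))

        rowOf : Fin ((size ℕ.^ D₁) ℕ.^ 2) → Row
        rowOf k = polyOf (finToFun {size ℕ.^ D₁} {2} k zero) , polyOf (finToFun {size ℕ.^ D₁} {2} k (suc zero))

        rowOf-injective : ∀ k l → polyOf (finToFun {size ℕ.^ D₁} {2} k zero) ≋ polyOf (finToFun {size ℕ.^ D₁} {2} l zero) →
          polyOf (finToFun {size ℕ.^ D₁} {2} k (suc zero)) ≋ polyOf (finToFun {size ℕ.^ D₁} {2} l (suc zero)) → k ≡ l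
        rowOf-injective k l e₀ e₁ = finToFun-injective {size ℕ.^ D₁} {2} k l
          (λ { zero → polyOf-injective _ _ e₀ ; (suc zero) → polyOf-injective _ _ e₁ })

        rows : Fin Unknowns → List Row
        rows k = tabulate (λ j → rowOf (finToFun {(size ℕ.^ D₁) ℕ.^ 2} {J} k j))

        length-rows : ∀ k → length (rows k) ≡ J
        length-rows k = length-tabulate (λ j → rowOf (finToFun {(size ℕ.^ D₁) ℕ.^ 2} {J} k j))

        small-rows : ∀ k → All SmallRow (rows k)
        small-rows k = All.tabulate⁺ (λ j → Deg≤-polyOf _ , Deg≤-polyOf _)

        rows-injective : ∀ k l → Pointwise (_≈ʳ_ 2D+d<size) (rows k) (rows l) → k ≡ l
        rows-injective k l e = finToFun-injective {(size ℕ.^ D₁) ℕ.^ 2} {J} k l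
          (λ j → let e₀ , e₁ = Pointwise.tabulate⁻ e j in rowOf-injective _ _ e₀ e₁)

        conditionsᶠ : Fin Unknowns → Fin M → Fin L₁ → Fin size
        conditionsᶠ k m l = index (coef (Q.coef (conditions (rows k)) (toℕ m)) (toℕ l))

        code : Fin Unknowns → Fin Conditions
        code k = funToFin (λ m → funToFin (conditionsᶠ k m))

        XDeg≤-rows : ∀ k → XDeg≤ (M ℕ.* d ℕ.+ D ℕ.+ J) (conditions (rows k))
        XDeg≤-rows k = ≡.subst (λ j → XDeg≤ (M ℕ.* d ℕ.+ D ℕ.+ j) (conditions (rows k))) (length-rows k)
          (XDeg≤-conditions (rows k) (small-rows k))

        code-injective : ∀ k l → code k ≡ code l → ∀ m → m < M →
                         Q.coef (conditions (rows k)) m ≋ Q.coef (conditions (rows l)) m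
        code-injective k l e m m<M = ≋⟨ go ⟩
          where
          a b : Poly
          a = Q.coef (conditions (rows k)) m
          b = Q.coef (conditions (rows l)) m
          go : ∀ i → coef a i ≈ coef b i
          go i with i ℕ.<? L₁
          ... | no ¬lt = trans (XDeg≤-rows k m i (ℕ.≮⇒≥ ¬lt)) (sym (XDeg≤-rows l m i (ℕ.≮⇒≥ ¬lt)))
          ... | yes lt = trans (sym (enum-index _)) (trans (reflexive (≡.cong enum eq)) (enum-index _))
            where
            eq₀ : conditionsᶠ k (fromℕ< m<M) (fromℕ< lt) ≡ conditionsᶠ l (fromℕ< m<M) (fromℕ< lt)
            eq₀ = funToFin-injective (conditionsᶠ k (fromℕ< m<M)) (conditionsᶠ l (fromℕ< m<M)) (funToFin-injective (λ m → funToFin (conditionsᶠ k m)) (λ m → funToFin (conditionsᶠ l m))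
              e (fromℕ< m<M)) (fromℕ< lt)
            eq : index (coef a i) ≡ index (coef b i)
            eq = ≡.subst₂ (λ m i → index (coef (Q.coef (conditions (rows k)) m) i) ≡ index (coef (Q.coef (conditions (rows l)) m) i))
                   (Fin.toℕ-fromℕ< m<M) (Fin.toℕ-fromℕ< lt) eq₀

        Conditions<Unknowns : Conditions < Unknowns
        Conditions<Unknowns = ≡.subst₂ _<_ (≡.sym (ℕ.^-*-assoc size L₁ M))
          (≡.sym (≡.trans (≡.cong (ℕ._^ J) (ℕ.^-*-assoc size D₁ 2)) (ℕ.^-*-assoc size (D₁ ℕ.* 2) J)))
          (ℕ.^-monoʳ-< size (≡.subst (1 <_) (≡.sym size≡) (s≤s (s≤s z≤n))) more-unknowns)

      -- Two distinct tuples share all conditions by the pigeonhole principle. The difference of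
      -- their auxiliary polynomials is nonzero and vanishes to order M on the whole level set, so
      -- comparing with its degree bounds the size of that set.
      stepanov-bound : ∀ as → Distinct as → All (λ a → rootVal T a ^ N ≈ σ) as →
                       length as ℕ.* M ≤ D ℕ.+ N ℕ.* d ℕ.+ J ℕ.* size
      stepanov-bound as distinct-as vals =
        let k , l , k<l , e = Fin.pigeonhole Conditions<Unknowns code
            A = auxPoly (rows k)
            B = auxPoly (rows l)
            deg : ∀ k → Deg≤ (D ℕ.+ N ℕ.* d ℕ.+ J ℕ.* size) (auxPoly (rows k))
            deg k = ≡.subst (λ j → Deg≤ (D ℕ.+ N ℕ.* d ℕ.+ j ℕ.* size) (auxPoly (rows k))) (length-rows k)
              (Deg≤-auxPoly (rows k) (small-rows k))
        in roots-bound M (A P.- B) (Deg≤-⊕ {p = A} {⊖ B} (deg k) (Deg≤-⊖ {p = B} (deg l)))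
             (λ z → Fin.<⇒≢ k<l (rows-injective k l (auxPoly-injective 2D+d<size (rows k) (rows l)
               (≡.trans (length-rows k) (≡.sym (length-rows l))) (small-rows k) (small-rows l)
               (Pₗ.x-y≈0⇒x≈y {A} {B} z))))
             as distinct-as (All.map (λ {a} fa → Ord≥-shift-difference M≤size a fa (rows k) (rows l) (code-injective k l e)) vals)

-- The order of a finite field

module PrimePower (F : FiniteField) where
  open FiniteField F hiding (zero)
  open RingLemmas commRing
  open Solver commRing
  open Polynomial commRing
  open FieldPoly F
  open import Algebra.Properties.Semiring.Mult semiring using (×1-homo-*; ×-homo-+) renaming (_×_ to _×′_)
  open import Relation.Binary.Reasoning.Setoid setoid

  nat : ℕ → Carrier
  nat m = m ×′ 1#

  1+X : Poly
  1+X = X ⊕ Const 1#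

  binomial : ℕ → ℕ → Carrier
  binomial m k = coef (1+X Pₗ.^ m) k

  binomial-0 : ∀ m → binomial m 0 ≈ 1#
  binomial-0 zero    = refl
  binomial-0 (suc m) = trans (coef-linear-⊗-zero 1# (1+X Pₗ.^ m)) (trans (*-identityˡ _) (binomial-0 m))

  pascal : ∀ m k → binomial (suc m) (suc k) ≈ binomial m k + binomial m (suc k)
  pascal m k = trans (coef-linear-⊗-suc 1# (1+X Pₗ.^ m) k) (+-congˡ (*-identityˡ _))

  binomial-1 : ∀ m → binomial m 1 ≈ nat m
  binomial-1 zero    = refl
  binomial-1 (suc m) = trans (pascal m 0) (+-cong (binomial-0 m) (binomial-1 m))

  -- Used with m + 1 = p: the right side is then zero, while k + 1 < p is a nonzero scalar, so the
  -- inner binomial coefficients of p vanish in the field.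
  absorption : ∀ m k → nat (suc k) * binomial (suc m) (suc k) ≈ nat (suc m) * binomial m k
  absorption zero zero = *-congˡ (trans (pascal 0 0) (+-identityʳ _))
  absorption zero (suc k) = trans (*-congˡ (trans (pascal 0 (suc k)) (+-identityʳ _))) (trans (zeroʳ _) (sym (zeroʳ _)))
  absorption (suc m) zero = begin
    (1# + 0#) * binomial (suc (suc m)) 1 ≈⟨ *-congʳ (+-identityʳ 1#) ⟩
    1# * binomial (suc (suc m)) 1        ≈⟨ *-identityˡ _ ⟩
    binomial (suc (suc m)) 1             ≈⟨ binomial-1 (suc (suc m)) ⟩
    nat (suc (suc m))                    ≈⟨ *-identityʳ _ ⟨
    nat (suc (suc m)) * 1#               ≈⟨ *-congˡ (binomial-0 (suc m)) ⟨
    nat (suc (suc m)) * binomial (suc m) 0 ∎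
  absorption (suc m) (suc k) = begin
    (1# + nat (suc k)) * binomial (suc (suc m)) (suc (suc k)) ≈⟨ *-congˡ (pascal (suc m) (suc k)) ⟩
    (1# + nat (suc k)) * (b + binomial (suc m) (suc (suc k)))
      ≈⟨ solve 3 (λ n b c → (con 1 :+ n) :* (b :+ c) := (b :+ n :* b) :+ (con 1 :+ n) :* c) refl (nat (suc k)) b _ ⟩
    (b + nat (suc k) * b) + nat (suc (suc k)) * binomial (suc m) (suc (suc k))
      ≈⟨ +-cong (+-congˡ (absorption m k)) (absorption m (suc k)) ⟩
    (b + nat (suc m) * binomial m k) + nat (suc m) * binomial m (suc k)
      ≈⟨ solve 4 (λ b n x y → (b :+ n :* x) :+ n :* y := b :+ n :* (x :+ y)) refl b (nat (suc m)) _ _ ⟩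
    b + nat (suc m) * (binomial m k + binomial m (suc k)) ≈⟨ +-congˡ (*-congˡ (pascal m k)) ⟨
    b + nat (suc m) * b  ≈⟨ solve 2 (λ b n → b :+ n :* b := (con 1 :+ n) :* b) refl b (nat (suc m)) ⟩
    (1# + nat (suc m)) * b ∎
    where
    b : Carrier
    b = binomial (suc m) (suc k)

  size≥2 : 2 ≤ size
  size≥2 = go (index 0#) (index 1#) (λ e → 0≉1 (trans (sym (enum-index 0#)) (trans (reflexive (≡.cong enum e)) (enum-index 1#))))
    where
    go : ∀ {k} (i j : Fin k) → ¬ (i ≡ j) → 2 ≤ k
    go {suc zero}    zero zero ne = ⊥-elim (ne ≡.refl)
    go {suc (suc k)} _    _    _  = s≤s (s≤s z≤n)

  coef-X^ : ∀ m k → ¬ (k ≡ m) → coef (X Pₗ.^ m) k ≈ 0#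
  coef-X^ m k ne with k ℕ.<? m
  ... | yes lt = Ord≥-X^ m k lt
  ... | no ¬lt = Deg≤-^ {p = X} m Deg≤-X k (≡.subst (_< k) (≡.sym (ℕ.*-identityʳ m)) (ℕ.≤∧≢⇒< (ℕ.≮⇒≥ ¬lt) (ne ∘ ≡.sym)))

  coef-X^+1 : ∀ m k → ¬ (k ≡ 0) → ¬ (k ≡ m) → coef (X Pₗ.^ m ⊕ Const 1#) k ≈ 0#
  coef-X^+1 m zero    n0 nm = ⊥-elim (n0 ≡.refl)
  coef-X^+1 m (suc k) n0 nm = trans (coef-⊕ (X Pₗ.^ m) (Const 1#) (suc k)) (trans (+-identityʳ _) (coef-X^ m (suc k) nm))

  -- Compare the coefficients of X in (X + 1)^size = X^size + 1; since size ≥ 2, the right side has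
  -- none.
  nat-size : nat size ≈ 0#
  nat-size = trans (sym (binomial-1 size)) (trans (at (frobenius 1#) 1)
    (coef-X^+1 size 1 (λ ()) (λ e → ℕ.<⇒≢ size≥2 e)))

  characteristic : ∃[ p ] (Prime p × nat p ≈ 0#)
  characteristic = find (PrimeFactorisation.factors fs) (PrimeFactorisation.factorsPrime fs)
    (≡.subst (λ m → nat m ≈ 0#) (PrimeFactorisation.isFactorisation fs) nat-size)
    where
    fs : PrimeFactorisation size
    fs = factorise size {{ℕ.>-nonZero size>0}}
    find : ∀ ps → All Prime ps → nat (product ps) ≈ 0# → ∃[ p ] (Prime p × nat p ≈ 0#)
    find []       _          e = ⊥-elim (0≉1 (sym (trans (sym (+-identityʳ 1#)) e)))
    find (p ∷ ps) (pp ∷ pps) e = [ (λ z → p , pp , z) , find ps pps ]′ (*-zero-product (trans (sym (×1-homo-* p (product ps))) e))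

  module _ (p : ℕ) (pp : Prime p) (char : nat p ≈ 0#) where
    private instance
      p≢0 : NonZero p
      p≢0 = prime⇒nonZero pp

    nat-mult : ∀ m → nat (m ℕ.* p) ≈ 0#
    nat-mult m = trans (×1-homo-* m p) (trans (*-congˡ char) (zeroʳ _))

    -- A Bézout relation between m and p, read in the field where p is zero, would turn m = 0 into 0
    -- = 1.
    nat-small : ∀ m → .{{NonZero m}} → m < p → nat m ≉ 0#
    nat-small m lt z with coprime-Bézout (prime⇒coprime pp lt)
    ... | Bézout.+- x y eq = 0≉1 (begin
      0#                      ≈⟨ nat-mult x ⟨
      nat (x ℕ.* p)           ≡⟨ ≡.cong nat eq ⟨
      1# + nat (y ℕ.* m)      ≈⟨ +-congˡ (trans (×1-homo-* y m) (trans (*-congˡ z) (zeroʳ _))) ⟩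
      1# + 0#                 ≈⟨ +-identityʳ _ ⟩
      1#                      ∎)
    ... | Bézout.-+ x y eq = 0≉1 (begin
      0#                      ≈⟨ trans (×1-homo-* y m) (trans (*-congˡ z) (zeroʳ _)) ⟨
      nat (y ℕ.* m)           ≡⟨ ≡.cong nat eq ⟨
      1# + nat (x ℕ.* p)      ≈⟨ +-congˡ (nat-mult x) ⟩
      1# + 0#                 ≈⟨ +-identityʳ _ ⟩
      1#                      ∎)

    nat≈0⇒p∣ : ∀ m → nat m ≈ 0# → p ∣ m
    nat≈0⇒p∣ m z = m%n≡0⇒n∣m m p (go (m ℕ.% p) ≡.refl)
      where
      rem : nat (m ℕ.% p) ≈ 0#
      rem = begin
        nat (m ℕ.% p)                               ≈⟨ +-identityʳ _ ⟨
        nat (m ℕ.% p) + 0#                          ≈⟨ +-congˡ (nat-mult (m ℕ./ p)) ⟨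
        nat (m ℕ.% p) + nat (m ℕ./ p ℕ.* p)         ≈⟨ ×-homo-+ 1# (m ℕ.% p) _ ⟨
        nat (m ℕ.% p ℕ.+ m ℕ./ p ℕ.* p)             ≡⟨ ≡.cong nat (m≡m%n+[m/n]*n m p) ⟨
        nat m                                       ≈⟨ z ⟩
        0#                                          ∎
      go : ∀ k → m ℕ.% p ≡ k → m ℕ.% p ≡ 0
      go zero    e = e
      go (suc k) e = ⊥-elim (nat-small (suc k) (≡.subst (_< p) e (m%n<n m p)) (≡.subst (λ i → nat i ≈ 0#) e rem))

    freshman : 1+X Pₗ.^ p ≋ X Pₗ.^ p ⊕ Const 1#
    freshman = ≋⟨ go p ≡.refl ⟩
      where
      go : ∀ q → q ≡ p → ∀ k → binomial p k ≈ coef (X Pₗ.^ p ⊕ Const 1#) k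
      go zero    e k = ⊥-elim (ℕ.≢-nonZero⁻¹ p (≡.sym e))
      go (suc q) e zero = trans (binomial-0 p) (sym (trans (coef-⊕ (X Pₗ.^ p) (Const 1#) 0)
        (trans (+-congʳ (coef-X^ p 0 (λ z → ℕ.≢-nonZero⁻¹ p (≡.sym z)))) (+-identityˡ _))))
      go (suc q) e (suc k) with ℕ.<-cmp (suc k) p
      ... | tri< lt _ _ = trans ([ ⊥-elim ∘ nat-small (suc k) lt , (λ z → z) ]′ (*-zero-product
                (trans (≡.subst (λ r → nat (suc k) * binomial r (suc k) ≈ nat r * binomial q k) e (absorption q k))
                  (trans (*-congʳ char) (zeroˡ _)))))
              (sym (coef-X^+1 p (suc k) (λ ()) (ℕ.<⇒≢ lt)))

      ... | tri≈ _ ≡.refl _ = trans (lead-linear^ 1# (suc k)) (sym (trans (coef-⊕ (X Pₗ.^ suc k) (Const 1#) (suc k))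
              (trans (+-identityʳ _) (trans (at (Pₗ.^-congˡ (suc k) X≋X⊕0) (suc k)) (lead-linear^ 0# (suc k))))))
      ... | tri> _ _ gt = trans (Deg≤-linear^ 1# p (suc k) gt) (sym (coef-X^+1 p (suc k) (λ ()) (ℕ.<⇒≢ gt ∘ ≡.sym)))

    module Subst (Y : Poly) where
      open Evaluation constHom Y public

      1+Y : Poly
      1+Y = Y ⊕ Const 1#

      eval-1+X : eval 1+X ≋ 1+Y
      eval-1+X = P.trans (Hom.+-homo evalHom X (Const 1#)) (P.+-cong eval-X (eval-Const 1#))

      eval-1+X^ : ∀ m → eval (1+X Pₗ.^ m) ≋ 1+Y Pₗ.^ m
      eval-1+X^ m = P.trans (Hom.^-homo evalHom 1+X m) (Pₗ.^-congˡ m eval-1+X)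

      freshman-subst : 1+Y Pₗ.^ p ≋ Y Pₗ.^ p ⊕ Const 1#
      freshman-subst = P.trans (P.sym (eval-1+X^ p)) (P.trans (Hom.⟦⟧-cong evalHom freshman)
        (P.trans (Hom.+-homo evalHom (X Pₗ.^ p) (Const 1#))
          (P.+-cong (P.trans (Hom.^-homo evalHom X p) (Pₗ.^-congˡ p eval-X)) (eval-Const 1#))))

    freshman^ : ∀ k → 1+X Pₗ.^ (p ℕ.^ k) ≋ X Pₗ.^ (p ℕ.^ k) ⊕ Const 1#
    freshman^ zero = P.trans (P.*-identityʳ 1+X) (P.+-congʳ {x = Const 1#} (P.sym (P.*-identityʳ X)))
    freshman^ (suc k) = P.trans (Pₗ.^-congʳ 1+X (ℕ.*-comm p (p ℕ.^ k))) (P.trans (P.sym (Pₗ.^-assocʳ 1+X (p ℕ.^ k) p))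
      (P.trans (Pₗ.^-congˡ p (freshman^ k)) (P.trans (Subst.freshman-subst (X Pₗ.^ (p ℕ.^ k)))
        (P.+-congʳ {x = Const 1#} (P.trans (Pₗ.^-assocʳ X (p ℕ.^ k) p) (Pₗ.^-congʳ X (ℕ.*-comm (p ℕ.^ k) p)))))))

    coef-subst-X^ : ∀ m → 0 < m → ∀ f → coef (Subst.eval (X Pₗ.^ m) f) m ≈ coef f 1
    coef-subst-X^ m m>0 [] = refl
    coef-subst-X^ m m>0 (c ∷ f) = trans (coef-⊕ (Const c) (X Pₗ.^ m ⊗ eval f) m)
        (trans (+-cong (const-zero m m>0) (trans (reflexive (≡.cong (coef (X Pₗ.^ m ⊗ eval f)) (≡.sym (ℕ.+-identityʳ m)))) (coef-X^-⊗ m (eval f) 0)))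
          (trans (+-identityˡ _) (coef₀ f)))
      where
      open Subst (X Pₗ.^ m) using (eval)
      const-zero : ∀ m → 0 < m → coef (Const c) m ≈ 0#
      const-zero (suc m) _ = refl
      coef₀ : ∀ f → coef (eval f) 0 ≈ coef f 0
      coef₀ []      = refl
      coef₀ (c ∷ f) = trans (coef-⊕ (Const c) (X Pₗ.^ m ⊗ eval f) 0)
        (trans (+-congˡ (Ord≥-⊗ˡ {m} {X Pₗ.^ m} (eval f) (Ord≥-X^ m) 0 m>0)) (+-identityʳ _))

    -- Compare the coefficients of X^(pᵏ) in (1+X)^size = 1 + X^size and in ((1+X)^(pᵏ))ᵐ = (1 + X^(pᵏ))ᵐ.
    cofactor≈0 : ∀ k m → size ≡ p ℕ.^ k ℕ.* m → 1 < m → nat m ≈ 0#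
    cofactor≈0 k m e m>1 = begin
      nat m                                            ≈⟨ binomial-1 m ⟨
      coef (1+X Pₗ.^ m) 1                              ≈⟨ coef-subst-X^ p^k p^k>0 (1+X Pₗ.^ m) ⟨
      coef (Subst.eval (X Pₗ.^ p^k) (1+X Pₗ.^ m)) p^k  ≈⟨ at (Subst.eval-1+X^ (X Pₗ.^ p^k) m) p^k ⟩
      coef ((X Pₗ.^ p^k ⊕ Const 1#) Pₗ.^ m) p^k        ≈⟨ at (Pₗ.^-congˡ m (freshman^ k)) p^k ⟨
      coef ((1+X Pₗ.^ p^k) Pₗ.^ m) p^k                 ≈⟨ at (Pₗ.^-assocʳ 1+X p^k m) p^k ⟩
      coef (1+X Pₗ.^ (p^k ℕ.* m)) p^k                  ≈⟨ at (Pₗ.^-congʳ 1+X e) p^k ⟨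
      coef (1+X Pₗ.^ size) p^k                         ≈⟨ at (frobenius 1#) p^k ⟩
      coef (X Pₗ.^ size ⊕ Const 1#) p^k                ≈⟨ coef-X^+1 size p^k (ℕ.>⇒≢ p^k>0) (ℕ.<⇒≢ p^k<size) ⟩
      0#                                               ∎
      where
      p^k : ℕ
      p^k = p ℕ.^ k
      p^k>0 : 0 < p^k
      p^k>0 = ℕ.m^n>0 p k
      p^k<size : p^k < size
      p^k<size = ≡.subst (p^k <_) (≡.sym e) (ℕ.m<m*n p^k m {{ℕ.>-nonZero p^k>0}} m>1)

    -- The invariant is size = p^k m. While m > 1, `cofactor≈0` makes p divide m, and the quotient
    -- is smaller than m, so the fuel never runs out.
    extract : ∀ fuel k m → m ≤ fuel → size ≡ p ℕ.^ k ℕ.* m → ∃[ k ] size ≡ p ℕ.^ k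
    extract fuel k zero le e = ⊥-elim (ℕ.<⇒≢ size>0 (≡.sym (≡.trans e (ℕ.*-zeroʳ (p ℕ.^ k)))))
    extract fuel k (suc zero) le e = k , ≡.trans e (ℕ.*-identityʳ _)
    extract (suc fuel) k m@(suc (suc m′)) le e with nat≈0⇒p∣ m (cofactor≈0 k m e (s≤s (s≤s z≤n)))
    ... | divides c eq = extract fuel (suc k) c (ℕ.≤-pred (ℕ.<-≤-trans c<m le))
            (≡.trans e (≡.trans (≡.cong (p ℕ.^ k ℕ.*_) (≡.trans eq (ℕ.*-comm c p)))
              (≡.trans (≡.sym (ℕ.*-assoc (p ℕ.^ k) p c)) (≡.cong (ℕ._* c) (ℕ.*-comm (p ℕ.^ k) p)))))
      where
      c≢0 : NonZero c
      c≢0 = ℕ.≢-nonZero (λ { ≡.refl → ℕ.0≢1+n (≡.sym eq) })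
      c<m : c < m
      c<m = ≡.subst (c <_) (≡.sym eq) (ℕ.m<m*n c p {{c≢0}} (ℕ.nonTrivial⇒n>1 p {{prime⇒nonTrivial pp}}))

  size-prime-power : IsPrimePower size
  size-prime-power with characteristic
  ... | p , pp , char with extract p pp char size 0 size ℕ.≤-refl (≡.sym (ℕ.*-identityˡ size))
  ...   | zero  , e = ⊥-elim (ℕ.<⇒≢ size≥2 (≡.sym e))
  ...   | suc k , e = p , suc k , pp , s≤s z≤n , e

-- The quadratic character

∑ : {A : Set} → (A → ℤ) → List A → ℤ
∑ v []       = 0ℤ
∑ v (x ∷ xs) = v x ℤ.+ ∑ v xs

data Ternary : ℤ → Set where
  zero : Ternary 0ℤ
  pos  : Ternary 1ℤ
  neg  : Ternary -1ℤ

#_of_ : {A : Set} → ℤ → (A → ℤ) → List A → ℕ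
# c of v = λ xs → length (filter (λ x → v x ℤ.≟ c) xs)

module _ {A : Set} (v : A → ℤ) (ternary : ∀ x → Ternary (v x)) where
  ternary-count : ∀ xs → (# 1ℤ of v) xs ℕ.+ (# -1ℤ of v) xs ℕ.+ (# 0ℤ of v) xs ≡ length xs
  ternary-count [] = ≡.refl
  ternary-count (x ∷ xs) with v x in e | ternary x
  ... | .0ℤ | zero = ≡.trans (ℕ.+-suc _ _) (≡.cong suc (ternary-count xs))
  ... | .1ℤ | pos = ≡.cong suc (ternary-count xs)
  ... | .-1ℤ | neg = ≡.trans (≡.cong (ℕ._+ (# 0ℤ of v) xs) (ℕ.+-suc ((# 1ℤ of v) xs) _)) (≡.cong suc (ternary-count xs))

  ternary-sum : ∀ xs → ∑ v xs ≡ + (# 1ℤ of v) xs ℤ.- + (# -1ℤ of v) xs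
  ternary-sum [] = ≡.refl
  ternary-sum (x ∷ xs) with v x | ternary x
  ... | .0ℤ | zero = ≡.trans (ℤ.+-identityˡ _) (ternary-sum xs)
  ... | .1ℤ | pos = ≡.trans (≡.cong (λ z → 1ℤ ℤ.+ z) (ternary-sum xs)) (≡.sym (ℤ.+-assoc 1ℤ (+ (# 1ℤ of v) xs) (ℤ.- + (# -1ℤ of v) xs)))
  ... | .-1ℤ | neg = ≡.trans (≡.cong (λ z → -1ℤ ℤ.+ z) (ternary-sum xs))
          (solve 2 (λ a b → con -1ℤ :+ (a :- b) := a :- (con 1ℤ :+ b)) ≡.refl (+ (# 1ℤ of v) xs) (+ (# -1ℤ of v) xs))
    where open ℤSolver.+-*-Solver

∣⊖∣≡∣-∣ : ∀ a b → ∣ + a ℤ.- + b ∣ ≡ ℕ.∣ a - b ∣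
∣⊖∣≡∣-∣ a b = ≡.trans (≡.cong ∣_∣ (ℤ.[+m]-[+n]≡m⊖n a b)) (go (ℕ.≤-total a b))
  where
  go : a ≤ b ⊎ b ≤ a → ∣ a ℤ.⊖ b ∣ ≡ ℕ.∣ a - b ∣
  go (inj₁ a≤b) = ≡.trans (ℤ.∣⊖∣-≤ a≤b) (≡.sym (ℕ.m≤n⇒∣m-n∣≡n∸m a≤b))
  go (inj₂ b≤a) = ≡.trans (ℤ.∣m⊖n∣≡∣n⊖m∣ a b) (≡.trans (ℤ.∣⊖∣-≤ b≤a)
    (≡.sym (≡.trans (ℕ.∣-∣-comm a b) (ℕ.m≤n⇒∣m-n∣≡n∸m b≤a))))

∣-∣-bound : ∀ {a b c} → a ≤ b ℕ.+ c → b ≤ a ℕ.+ c → ℕ.∣ a - b ∣ ≤ c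
∣-∣-bound {a} {b} {c} h₁ h₂ with ℕ.∣m-n∣≡[m∸n]∨[n∸m] a b
... | inj₁ e = ≡.subst (_≤ c) (≡.sym e) (ℕ.m≤n+o⇒m∸n≤o a b h₁)
... | inj₂ e = ≡.subst (_≤ c) (≡.sym e) (ℕ.m≤n+o⇒m∸n≤o b a h₂)

module _ where
  open import Data.Nat using (_+_; _*_; _≤_)

  -- In the term m q of the hypothesis substitute q = a + b + z: one of the two copies of m a
  -- cancels, and m a ≤ m b + m z + (N + N d + q) remains. The bracket is at most 2 d q, so with m =
  -- 4 k d division by 4 d gives a - b ≤ q/k.
  level-set-arithmetic : ∀ k d a b z N q → .{{NonZero d}} → let m = 4 * k * d in
    a + b + z ≡ q → z ≤ d → N + N ≤ q → m ≤ N →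
    a * (2 * m) ≤ N + N * d + suc m * q → k * a ≤ k * b + q
  level-set-arithmetic k d a b z N q e z≤d 2N≤q m≤N le = ℕ.*-cancelˡ-≤ 4 (begin
      4 * (k * a)                     ≡⟨ ℕ.*-assoc 4 k a ⟨
      4 * k * a                       ≤⟨ ℕ.*-cancelˡ-≤ d divided ⟩
      2 * q + 4 * k * b + m           ≤⟨ ℕ.+-monoʳ-≤ (2 * q + 4 * k * b) m≤2q ⟩
      2 * q + 4 * k * b + 2 * q       ≡⟨ solve 3 (λ q k b → con 2 :* q :+ con 4 :* k :* b :+ con 2 :* q := con 4 :* (k :* b :+ q)) ≡.refl q k b ⟩
      4 * (k * b + q)                 ∎)
    where
    open ℕSolver.+-*-Solver
    open ℕ.≤-Reasoning
    m : ℕ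
    m = 4 * k * d
    m≤2q : m ≤ 2 * q
    m≤2q = ℕ.≤-trans m≤N (ℕ.≤-trans (ℕ.m≤m+n N N) (ℕ.≤-trans 2N≤q (ℕ.m≤m+n q _)))
    absorbed : m * a ≤ N + N * d + q + m * b + m * z
    absorbed = ℕ.+-cancelʳ-≤ (m * a) _ _ (begin
      m * a + m * a                                ≡⟨ solve 2 (λ m a → m :* a :+ m :* a := a :* (con 2 :* m)) ≡.refl m a ⟩
      a * (2 * m)                                  ≤⟨ le ⟩
      N + N * d + (q + m * q)                      ≡⟨ ≡.cong (λ x → N + N * d + (q + m * x)) e ⟨
      N + N * d + (q + m * (a + b + z))
        ≡⟨ solve 7 (λ N Nd q m a b z → N :+ Nd :+ (q :+ m :* (a :+ b :+ z)) := N :+ Nd :+ q :+ m :* b :+ m :* z :+ m :* a) ≡.refl N (N * d) q m a b z ⟩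
      N + N * d + q + m * b + m * z + m * a        ∎)
    small : N + N * d + q ≤ d * (2 * q)
    small = begin
      N + N * d + q          ≤⟨ ℕ.+-mono-≤ (ℕ.+-monoˡ-≤ (N * d) (ℕ.m≤m*n N d)) (ℕ.m≤m*n q d) ⟩
      N * d + N * d + q * d  ≡⟨ ≡.cong (_+ q * d) (ℕ.*-distribʳ-+ d N N) ⟨
      (N + N) * d + q * d    ≤⟨ ℕ.+-monoˡ-≤ (q * d) (ℕ.*-monoˡ-≤ d 2N≤q) ⟩
      q * d + q * d          ≡⟨ solve 2 (λ q d → q :* d :+ q :* d := d :* (con 2 :* q)) ≡.refl q d ⟩
      d * (2 * q)            ∎
    divided : d * (4 * k * a) ≤ d * (2 * q + 4 * k * b + m)
    divided = begin
      d * (4 * k * a)                 ≡⟨ solve 3 (λ d k a → d :* (con 4 :* k :* a) := con 4 :* k :* d :* a) ≡.refl d k a ⟩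
      m * a                           ≤⟨ absorbed ⟩
      N + N * d + q + m * b + m * z   ≤⟨ ℕ.+-mono-≤ (ℕ.+-monoˡ-≤ (m * b) small) (ℕ.*-monoʳ-≤ m z≤d) ⟩
      d * (2 * q) + m * b + m * d
        ≡⟨ solve 4 (λ d q k b → d :* (con 2 :* q) :+ con 4 :* k :* d :* b :+ con 4 :* k :* d :* d :=
                                d :* (con 2 :* q :+ con 4 :* k :* b :+ con 4 :* k :* d)) ≡.refl d q k b ⟩
      d * (2 * q + 4 * k * b + m)     ∎

-- The hypothesis writes size as 4 l + 3. Then N = (size - 1)/2 = 2 l + 1 is odd, which yields χ(-1)
-- = -1.
module Character (F : FiniteField) (l : ℕ)
                 (size≡ : FiniteField.size F ≡ suc (suc (l ℕ.+ l) ℕ.+ suc (l ℕ.+ l))) where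
  open FiniteField F hiding (zero)
  open RingLemmas commRing
  open Solver commRing
  open FieldPoly F
  open RootPolynomial F
  open PrimePower F using (nat; nat-size)
  open import Algebra.Properties.Semiring.Mult semiring using (×-homo-+)
  open import Relation.Binary.Reasoning.Setoid setoid

  N : ℕ
  N = suc (l ℕ.+ l)

  1≉-1 : 1# ≉ - 1#
  1≉-1 e = 0≉1 (begin
    0#                          ≈⟨ nat-size ⟨
    nat size                    ≡⟨ ≡.cong nat size≡ ⟩
    1# + nat (N ℕ.+ N)          ≈⟨ +-congˡ (×-homo-+ 1# N N) ⟩
    1# + (nat N + nat N)        ≈⟨ +-congˡ (solve 1 (λ x → x :+ x := x :* (con 1 :+ con 1)) refl (nat N)) ⟩
    1# + nat N * (1# + 1#)      ≈⟨ +-congˡ (trans (*-congˡ (trans (+-congˡ e) (-‿inverseʳ 1#))) (zeroʳ _)) ⟩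
    1# + 0#                     ≈⟨ +-identityʳ 1# ⟩
    1#                          ∎)

  x^N²≈1 : ∀ {x} → x ≉ 0# → x ^ N * x ^ N ≈ 1#
  x^N²≈1 {x} nx = *-cancelˡ-nonzero nx (begin
    x * (x ^ N * x ^ N)   ≈⟨ *-congˡ (^-homo-* x N N) ⟨
    x ^ suc (N ℕ.+ N)     ≈⟨ ^-congʳ x size≡ ⟨
    x ^ size              ≈⟨ fermat x ⟩
    x                     ≈⟨ *-identityʳ x ⟨
    x * 1#                ∎)

  euler : ∀ {x} → x ≉ 0# → x ^ N ≈ 1# ⊎ x ^ N ≈ - 1#
  euler {x} nx with (x ^ N) ≟ 1#
  ... | yes e = inj₁ e
  ... | no ne = inj₂ (+-cancelʳ 1# (trans ([ ⊥-elim ∘ ne ∘ x-y≈0⇒x≈y , (λ z → z) ]′ (*-zero-product (begin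
    (y - 1#) * (y + 1#)            ≈⟨ solve 3 (λ y m o → (y :+ m) :* (y :+ o) := y :* y :+ (m :* o :+ y :* (m :+ o))) refl y (- 1#) 1# ⟩
    y * y + (- 1# * 1# + y * (- 1# + 1#))
      ≈⟨ +-cong (x^N²≈1 nx) (+-cong (*-identityʳ _) (trans (*-congˡ (-‿inverseˡ 1#)) (zeroʳ y))) ⟩
    1# + (- 1# + 0#)               ≈⟨ +-congˡ (+-identityʳ _) ⟩
    1# - 1#                        ≈⟨ -‿inverseʳ 1# ⟩
    0#                             ∎))) (sym (-‿inverseˡ 1#))))
    where
    y : Carrier
    y = x ^ N

  [-1][-1]≈1 : - 1# * - 1# ≈ 1#
  [-1][-1]≈1 = trans (sym (-‿distribˡ-* 1# (- 1#))) (trans (-‿cong (*-identityˡ _)) (-‿involutive 1#))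

  [-1]^N≈-1 : (- 1#) ^ N ≈ - 1#
  [-1]^N≈-1 = trans (*-congˡ (trans (^-homo-* (- 1#) l l) (trans (sym (^-distrib-* (- 1#) (- 1#) l))
    (trans (^-congˡ l [-1][-1]≈1) (1^n≈1 l))))) (*-identityʳ _)

  -1≉0 : - 1# ≉ 0#
  -1≉0 e = 0≉1 (trans (sym -0#≈0#) (trans (-‿cong (sym e)) (-‿involutive 1#)))

  -- χ is defined through Euler's criterion, by the value of x^N. Multiplicativity and the link to
  -- the level sets of f^N are then immediate, and squares enter only through `square⇒χ≡1` and
  -- `χ≡1⇒square`.
  data χ-Spec (x : Carrier) : ℤ → Set where
    zero : x ≈ 0# → χ-Spec x 0ℤ
    pos  : x ≉ 0# → x ^ N ≈ 1# → χ-Spec x 1ℤ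
    neg  : x ≉ 0# → x ^ N ≈ - 1# → χ-Spec x -1ℤ

  χ-value : ∀ x → ∃[ c ] χ-Spec x c
  χ-value x with x ≟ 0#
  ... | yes e = 0ℤ , zero e
  ... | no nx = [ (λ e → 1ℤ , pos nx e) , (λ e → -1ℤ , neg nx e) ]′ (euler nx)

  χ : Carrier → ℤ
  χ x = proj₁ (χ-value x)

  χ-spec : ∀ x → χ-Spec x (χ x)
  χ-spec x = proj₂ (χ-value x)

  χ-Spec-unique : ∀ {x y a b} → x ≈ y → χ-Spec x a → χ-Spec y b → a ≡ b
  χ-Spec-unique e (zero _)   (zero _)   = ≡.refl
  χ-Spec-unique e (zero z)   (pos nz _) = ⊥-elim (nz (trans (sym e) z))
  χ-Spec-unique e (zero z)   (neg nz _) = ⊥-elim (nz (trans (sym e) z))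
  χ-Spec-unique e (pos nz _) (zero z)   = ⊥-elim (nz (trans e z))
  χ-Spec-unique e (pos _ _)  (pos _ _)  = ≡.refl
  χ-Spec-unique e (pos _ p)  (neg _ q)  = ⊥-elim (1≉-1 (trans (sym p) (trans (^-congˡ N e) q)))
  χ-Spec-unique e (neg nz _) (zero z)   = ⊥-elim (nz (trans e z))
  χ-Spec-unique e (neg _ p)  (pos _ q)  = ⊥-elim (1≉-1 (sym (trans (sym p) (trans (^-congˡ N e) q))))
  χ-Spec-unique e (neg _ _)  (neg _ _)  = ≡.refl

  χ-≡ : ∀ {x c} → χ-Spec x c → χ x ≡ c
  χ-≡ {x} = χ-Spec-unique refl (χ-spec x)

  χ-cong : ∀ {x y} → x ≈ y → χ x ≡ χ y
  χ-cong {x} {y} e = χ-Spec-unique e (χ-spec x) (χ-spec y)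

  χ-ternary : ∀ x → Ternary (χ x)
  χ-ternary x with χ x | χ-spec x
  ... | .0ℤ  | zero _  = zero
  ... | .1ℤ  | pos _ _ = pos
  ... | .-1ℤ | neg _ _ = neg

  χ-* : ∀ x y → χ (x * y) ≡ χ x ℤ.* χ y
  χ-* x y = χ-≡ (go (χ-spec x) (χ-spec y))
    where
    power : ∀ {a b c} → x ^ N ≈ a → y ^ N ≈ b → a * b ≈ c → (x * y) ^ N ≈ c
    power p q r = trans (^-distrib-* x y N) (trans (*-cong p q) r)
    go : ∀ {a b} → χ-Spec x a → χ-Spec y b → χ-Spec (x * y) (a ℤ.* b)
    go (zero z)  _        = zero (trans (*-congʳ z) (zeroˡ y))
    go {a} (pos _ _) (zero z) = zero (trans (*-congˡ z) (zeroʳ x))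
    go {a} (neg _ _) (zero z) = zero (trans (*-congˡ z) (zeroʳ x))
    go (pos n p) (pos m q) = pos (*-nonzero n m) (power p q (*-identityˡ _))
    go (pos n p) (neg m q) = neg (*-nonzero n m) (power p q (*-identityˡ _))
    go (neg n p) (pos m q) = neg (*-nonzero n m) (power p q (*-identityʳ _))
    go (neg n p) (neg m q) = pos (*-nonzero n m) (power p q [-1][-1]≈1)

  χ-1 : χ 1# ≡ 1ℤ
  χ-1 = χ-≡ (pos (λ e → 0≉1 (sym e)) (1^n≈1 N))

  χ-neg : ∀ x → χ (- x) ≡ ℤ.- χ x
  χ-neg x = ≡.trans (χ-cong (trans (-‿cong (sym (*-identityˡ x))) (-‿distribˡ-* 1# x)))
    (≡.trans (χ-* (- 1#) x) (≡.trans (≡.cong (ℤ._* χ x) (χ-≡ (neg -1≉0 [-1]^N≈-1))) (ℤ.-1*i≡-i (χ x))))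

  χ-0 : ∀ {x} → x ≈ 0# → χ x ≡ 0ℤ
  χ-0 z = χ-≡ (zero z)

  square⇒χ≡1 : ∀ {x} → IsNonzeroSquare F x → χ x ≡ 1ℤ
  square⇒χ≡1 {x} (nx , y , e) = χ-≡ (pos nx (begin
    x ^ N            ≈⟨ ^-congˡ N e ⟨
    (y * y) ^ N      ≈⟨ ^-distrib-* y y N ⟩
    y ^ N * y ^ N    ≈⟨ x^N²≈1 (λ z → nx (trans (sym e) (trans (*-congˡ z) (zeroʳ y)))) ⟩
    1#               ∎))

  -- As size ≡ 3 mod 4, N + 1 is even and x = x^(N+1) exhibits a square root.
  χ≡1⇒square : ∀ {x} → χ x ≡ 1ℤ → IsNonzeroSquare F x
  χ≡1⇒square {x} e with χ x | χ-spec x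
  ... | .1ℤ | pos nx p = nx , x ^ suc l , (begin
    x ^ suc l * x ^ suc l   ≈⟨ ^-homo-* x (suc l) (suc l) ⟨
    x ^ (suc l ℕ.+ suc l)   ≈⟨ ^-congʳ x (≡.cong suc (ℕ.+-suc l l)) ⟩
    x * x ^ N               ≈⟨ *-congˡ p ⟩
    x * 1#                  ≈⟨ *-identityʳ x ⟩
    x                       ∎)

  χ≡1⇒^N : ∀ {x} → χ x ≡ 1ℤ → x ^ N ≈ 1#
  χ≡1⇒^N {x} e with χ x | χ-spec x
  ... | .1ℤ | pos _ p = p

  χ≡-1⇒^N : ∀ {x} → χ x ≡ -1ℤ → x ^ N ≈ - 1#
  χ≡-1⇒^N {x} e with χ x | χ-spec x
  ... | .-1ℤ | neg _ p = p

  χ≡0⇒≈0 : ∀ {x} → χ x ≡ 0ℤ → x ≈ 0#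
  χ≡0⇒≈0 {x} e with χ x | χ-spec x
  ... | .0ℤ | zero p = p

  charSum : List Carrier → ℤ
  charSum T = ∑ (λ x → χ (rootVal T x)) elements

  lead-rootPoly : ∀ T → Polynomial.coef commRing (rootPoly T) (length T) ≈ 1#
  lead-rootPoly []      = refl
  lead-rootPoly (t ∷ T) = trans (lead-⊗ {1} {length T} (linear t) (rootPoly T) (Deg≤-linear (- t)) (Deg≤-rootPoly T))
    (trans (*-cong (coef-linear-1 (- t)) (lead-rootPoly T)) (*-identityˡ _))
    where open Polynomial commRing

  module _ where
    open Polynomial commRing

    rootPoly-nonzero : ∀ T → ¬ (rootPoly T ≋ [])
    rootPoly-nonzero T e = 0≉1 (trans (sym (at e (length T))) (lead-rootPoly T))

    roots≤length : ∀ T as → Distinct as → All (λ a → rootVal T a ≈ 0#) as → length as ≤ length T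
    roots≤length T as d zs = ≡.subst (_≤ length T) (ℕ.*-identityʳ _)
      (roots-bound 1 (rootPoly T) (Deg≤-rootPoly T) (rootPoly-nonzero T) as d
        (All.map (λ { {a} z zero _ → trans (coef₀-shift a (rootPoly T)) (trans (ev-rootPoly T a) z) ; z (suc n) (s≤s ()) }) zs))

  -- Provides the translation by e that moves the roots of f away from 0, as Stepanov's method above
  -- requires. If every element were a root, there would be more roots than the degree allows.
  non-root : ∀ T → length T < size → ∃[ e ] rootVal T e ≉ 0#
  non-root T lt with Fin.any? (λ i → ¬? (rootVal T (enum i) ≟ 0#))
  ... | yes (i , nz) = enum i , nz
  ... | no none = ⊥-elim (ℕ.<⇒≱ lt (≡.subst (_≤ length T) (length-tabulate enum)
          (roots≤length T elements elements-distinct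
            (All.tabulate⁺ (λ i → decidable-stable (rootVal T (enum i) ≟ 0#) (λ nz → none (i , nz)))))))

  rootVal-translate : ∀ e T a → rootVal (map (_- e) T) (a - e) ≈ rootVal T a
  rootVal-translate e []      a = refl
  rootVal-translate e (t ∷ T) a = *-cong (sym (p-p′≈[p+x]-[p′+x] a t (- e))) (rootVal-translate e T a)

  rootVal-cong : ∀ T {a b} → a ≈ b → rootVal T a ≈ rootVal T b
  rootVal-cong []      e = refl
  rootVal-cong (t ∷ T) e = *-cong (+-congʳ e) (rootVal-cong T e)

  translate-distinct : ∀ e as → Distinct as → Distinct (map (_- e) as)
  translate-distinct e as d = AllPairs.map⁺ (AllPairs.map (λ {x} {y} ne eq → ne (+-cancelʳ (- e) eq)) d)

  -- Stepanov's method with multiplicity 2m and m + 1 blocks of unknowns.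
  level-set-bound : ∀ t ts σ → Distinct (t ∷ ts) → σ ≉ 0# → ∀ m → let d = length (t ∷ ts) in
    m ℕ.* (2 ℕ.* m ℕ.* d ℕ.+ m ℕ.+ 1) ℕ.+ d ≤ N → m ≤ N →
    ∀ as → Distinct as → All (λ a → rootVal (t ∷ ts) a ^ N ≈ σ) as →
    length as ℕ.* (2 ℕ.* m) ≤ N ℕ.+ N ℕ.* d ℕ.+ suc m ℕ.* size
  level-set-bound t ts σ distinct nσ m h m≤N as das vals = ≡.subst₂ (λ x y → x ℕ.* (2 ℕ.* m) ≤ N ℕ.+ N ℕ.* y ℕ.+ suc m ℕ.* size)
      (length-map (_- e) as) (length-map (_- e) T)
      (ℕ.≤-trans (stepanov-bound M≤size 2D+d<size more-unknowns (map (_- e) as) (translate-distinct e as das)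
        (All.map⁺ (All.map (λ {a} v → trans (^-congˡ N (rootVal-translate e T a)) v) vals)))
        (ℕ.+-monoˡ-≤ (suc m ℕ.* size) (ℕ.+-monoˡ-≤ (N ℕ.* length T′) (ℕ.≤-trans (ℕ.m≤m+n D d) (ℕ.≤-reflexive D+d≡N)))))
    where
    T T′ : List Carrier
    T = t ∷ ts
    d D : ℕ
    d = length T
    d≤N : d ≤ N
    d≤N = ℕ.≤-trans (ℕ.m≤n+m d _) h
    -- With D + d = N both 2 D + d < size = 2 N + 1 and D ≤ N hold, the latter simplifying the final
    -- degree.
    D = N ℕ.∸ d
    D+d≡N : D ℕ.+ d ≡ N
    D+d≡N = ℕ.m∸n+n≡m d≤N
    N<size : N < size
    N<size = ≡.subst (N <_) (≡.sym size≡) (s≤s (ℕ.m≤m+n N N))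
    e : Carrier
    e = proj₁ (non-root T (ℕ.≤-<-trans d≤N N<size))
    ne : rootVal T e ≉ 0#
    ne = proj₂ (non-root T (ℕ.≤-<-trans d≤N N<size))
    T′ = map (_- e) T
    d≡ : length T′ ≡ d
    d≡ = length-map (_- e) T
    0∉ : rootVal T′ 0# ≉ 0#
    0∉ z = ne (trans (sym (rootVal-translate e T e)) (trans (rootVal-cong T′ (x-x≈0 e)) z))
    stepanov-bound = Stepanov.stepanov-bound F (l ℕ.+ l) size≡ (2 ℕ.* m) (suc m) D
      (t - e) (map (_- e) ts) (translate-distinct e T distinct) 0∉ σ nσ
    M≤size : 2 ℕ.* m ≤ size
    M≤size = ≡.subst (2 ℕ.* m ≤_) (≡.sym size≡) (ℕ.m≤n⇒m≤1+n (ℕ.+-mono-≤ m≤N (≡.subst (_≤ N) (≡.sym (ℕ.+-identityʳ m)) m≤N)))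
    2D+d<size : D ℕ.+ D ℕ.+ length T′ < size
    2D+d<size = ≡.subst₂ (λ x y → D ℕ.+ D ℕ.+ x < y) (≡.sym d≡) (≡.sym size≡) (s≤s
      (≡.subst (_≤ N ℕ.+ N) (≡.sym (ℕ.+-assoc D D d)) (ℕ.+-mono-≤ (ℕ.≤-trans (ℕ.m≤m+n D d) (ℕ.≤-reflexive D+d≡N)) (ℕ.≤-reflexive D+d≡N))))
    -- Both sides contain 2 m (D + 1). What remains is m (2 m d + m + 1) < D + 1, which is `h` after
    -- replacing N by D + d.
    more-unknowns : suc (2 ℕ.* m ℕ.* length T′ ℕ.+ D ℕ.+ suc m) ℕ.* (2 ℕ.* m) < suc D ℕ.* 2 ℕ.* suc m
    more-unknowns = ≡.subst (λ x → suc (2 ℕ.* m ℕ.* x ℕ.+ D ℕ.+ suc m) ℕ.* (2 ℕ.* m) < suc D ℕ.* 2 ℕ.* suc m) (≡.sym d≡)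
      (ℕ.≤-trans (s≤s (ℕ.≤-trans (ℕ.≤-reflexive lhs) (ℕ.+-monoʳ-≤ (2 ℕ.* m ℕ.* suc D) (ℕ.*-monoʳ-≤ 2 key))))
        (ℕ.≤-trans (ℕ.+-monoʳ-≤ 1 (ℕ.n≤1+n _)) (ℕ.≤-reflexive rhs)))
      where
      open ℕSolver.+-*-Solver renaming (solve to solveℕ; _:=_ to _:≡_; _:+_ to _:⊕_; _:*_ to _:⊛_; con to :con)
      lhs : suc (2 ℕ.* m ℕ.* d ℕ.+ D ℕ.+ suc m) ℕ.* (2 ℕ.* m) ≡ 2 ℕ.* m ℕ.* suc D ℕ.+ 2 ℕ.* (m ℕ.* (2 ℕ.* m ℕ.* d ℕ.+ m ℕ.+ 1))
      lhs = solveℕ 3 (λ m d D → (:con 1 :⊕ (:con 2 :⊛ m :⊛ d :⊕ D :⊕ (:con 1 :⊕ m))) :⊛ (:con 2 :⊛ m) :≡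
        :con 2 :⊛ m :⊛ (:con 1 :⊕ D) :⊕ :con 2 :⊛ (m :⊛ (:con 2 :⊛ m :⊛ d :⊕ m :⊕ :con 1))) ≡.refl m d D
      key : m ℕ.* (2 ℕ.* m ℕ.* d ℕ.+ m ℕ.+ 1) ≤ D
      key = ℕ.+-cancelʳ-≤ d _ D (≡.subst (m ℕ.* (2 ℕ.* m ℕ.* d ℕ.+ m ℕ.+ 1) ℕ.+ d ≤_) (≡.sym D+d≡N) h)
      rhs : 1 ℕ.+ suc (2 ℕ.* m ℕ.* suc D ℕ.+ 2 ℕ.* D) ≡ suc D ℕ.* 2 ℕ.* suc m
      rhs = solveℕ 2 (λ m D → :con 1 :⊕ (:con 1 :⊕ (:con 2 :⊛ m :⊛ (:con 1 :⊕ D) :⊕ :con 2 :⊛ D)) :≡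
        (:con 1 :⊕ D) :⊛ :con 2 :⊛ (:con 1 :⊕ m)) ≡.refl m D

  -- The sum is the difference of the sizes of the level sets 1 and -1. These fill the field up to
  -- at most d roots, so an upper bound for either one also bounds the other from below; applying
  -- this to both signs bounds the absolute value by size/k.
  character-sum-bound : ∀ k t ts → Distinct (t ∷ ts) → let d = length (t ∷ ts); m = 4 ℕ.* k ℕ.* d in
    m ℕ.* (2 ℕ.* m ℕ.* d ℕ.+ m ℕ.+ 1) ℕ.+ d ≤ N → ∣ charSum (t ∷ ts) ∣ ℕ.* k ≤ size
  character-sum-bound k t ts distinct h = ≡.subst (λ z → ∣ z ∣ ℕ.* k ≤ size) (≡.sym (ternary-sum v (λ x → χ-ternary _) elements))
      (≡.subst (λ z → z ℕ.* k ≤ size) (≡.sym (∣⊖∣≡∣-∣ p₊ p₋)) (≡.subst (_≤ size)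
        (≡.sym (≡.trans (ℕ.*-comm ℕ.∣ p₊ - p₋ ∣ k) (ℕ.*-distribˡ-∣-∣ k p₊ p₋)))
        (∣-∣-bound (one-sided p₊ p₋ sum₊ (level 1ℤ 1# (λ e → 0≉1 (sym e)) χ≡1⇒^N))
                   (one-sided p₋ p₊ sum₋ (level -1ℤ (- 1#) -1≉0 χ≡-1⇒^N)))))
    where
    T : List Carrier
    T = t ∷ ts
    d m : ℕ
    d = length T
    m = 4 ℕ.* k ℕ.* d
    v : Carrier → ℤ
    v x = χ (rootVal T x)
    p₊ p₋ z : ℕ
    p₊ = (# 1ℤ of v) elements
    p₋ = (# -1ℤ of v) elements
    z  = (# 0ℤ of v) elements
    sum₊ : p₊ ℕ.+ p₋ ℕ.+ z ≡ size
    sum₊ = ≡.trans (ternary-count v (λ x → χ-ternary _) elements) (length-tabulate enum)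
    sum₋ : p₋ ℕ.+ p₊ ℕ.+ z ≡ size
    sum₋ = ≡.trans (≡.cong (ℕ._+ z) (ℕ.+-comm p₋ p₊)) sum₊
    m≤N : m ≤ N
    m≤N = ℕ.≤-trans (ℕ.m≤m*n m (2 ℕ.* m ℕ.* d ℕ.+ m ℕ.+ 1) {{ℕ.>-nonZero (ℕ.m≤n+m 1 (2 ℕ.* m ℕ.* d ℕ.+ m))}}) (ℕ.≤-trans (ℕ.m≤m+n _ d) h)
    N+N≤size : N ℕ.+ N ≤ size
    N+N≤size = ≡.subst (N ℕ.+ N ≤_) (≡.sym size≡) (ℕ.n≤1+n _)
    z≤d : z ≤ d
    z≤d = roots≤length T _ (AllPairs.filter⁺ (λ x → v x ℤ.≟ 0ℤ) elements-distinct)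
      (All.map χ≡0⇒≈0 (All.all-filter (λ x → v x ℤ.≟ 0ℤ) elements))
    level : ∀ c σ → σ ≉ 0# → (∀ {x} → χ x ≡ c → x ^ N ≈ σ) → (# c of v) elements ℕ.* (2 ℕ.* m) ≤ N ℕ.+ N ℕ.* d ℕ.+ suc m ℕ.* size
    level c σ nσ to = level-set-bound t ts σ distinct nσ m h m≤N _ (AllPairs.filter⁺ (λ x → v x ℤ.≟ c) elements-distinct)
      (All.map to (All.all-filter (λ x → v x ℤ.≟ c) elements))
    one-sided : ∀ a b → a ℕ.+ b ℕ.+ z ≡ size → a ℕ.* (2 ℕ.* m) ≤ N ℕ.+ N ℕ.* d ℕ.+ suc m ℕ.* size →
                k ℕ.* a ≤ k ℕ.* b ℕ.+ size
    one-sided a b e le = level-set-arithmetic k d a b z N size e z≤d N+N≤size m≤N le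

open ≡ using (refl; sym; trans; cong; cong₂; subst)

module Zs = ℤSolver.+-*-Solver

private variable
  A : Set

-- Sums over sublists

module _ where
  open import Data.Integer using (_+_; _*_; -_; _-_)
  open Zs

  ∏ : (A → ℤ) → List A → ℤ
  ∏ v []       = 1ℤ
  ∏ v (x ∷ xs) = v x * ∏ v xs

  ∏-cong : ∀ {v w : A → ℤ} xs → All (λ x → v x ≡ w x) xs → ∏ v xs ≡ ∏ w xs
  ∏-cong []       []       = refl
  ∏-cong (x ∷ xs) (e ∷ es) = cong₂ _*_ e (∏-cong xs es)

  ∏-* : ∀ (v w : A → ℤ) xs → ∏ (λ x → v x * w x) xs ≡ ∏ v xs * ∏ w xs
  ∏-* v w []       = refl
  ∏-* v w (x ∷ xs) = trans (cong (v x * w x *_) (∏-* v w xs))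
    (solve 4 (λ a b c d → a :* b :* (c :* d) := a :* c :* (b :* d)) refl (v x) (w x) (∏ v xs) (∏ w xs))

  ∏-1 : ∀ {v : A → ℤ} → (∀ x → v x ≡ 1ℤ) → ∀ xs → ∏ v xs ≡ 1ℤ
  ∏-1 e []       = refl
  ∏-1 e (x ∷ xs) = trans (cong₂ _*_ (e x) (∏-1 e xs)) refl

  ∏-swap : ∀ {B : Set} (f : A → B → ℤ) xs ys → ∏ (λ x → ∏ (f x) ys) xs ≡ ∏ (λ y → ∏ (λ x → f x y) xs) ys
  ∏-swap f []       ys = sym (∏-1 (λ _ → refl) ys)
  ∏-swap f (x ∷ xs) ys = trans (cong (∏ (f x) ys *_) (∏-swap f xs ys)) (sym (∏-* (f x) (λ y → ∏ (λ x → f x y) xs) ys))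

  ∏-zero : ∀ (v : A → ℤ) {x} xs → x ∈ xs → v x ≡ 0ℤ → ∏ v xs ≡ 0ℤ
  ∏-zero v (x ∷ xs) (here refl) e = trans (cong (_* ∏ v xs) e) (ℤ.*-zeroˡ (∏ v xs))
  ∏-zero v (x ∷ xs) (there i)   e = trans (cong (v x *_) (∏-zero v xs i e)) (ℤ.*-zeroʳ (v x))

  ∏-interleaving : ∀ (v : A → ℤ) {T U L} → Interleaving T U L → ∏ v L ≡ ∏ v T * ∏ v U
  ∏-interleaving v [] = refl
  ∏-interleaving v {x ∷ T} {U} (consˡ i) = trans (cong (v x *_) (∏-interleaving v i)) (sym (ℤ.*-assoc (v x) (∏ v T) (∏ v U)))
  ∏-interleaving v {T} {x ∷ U} (consʳ i) = trans (cong (v x *_) (∏-interleaving v i))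
    (solve 3 (λ a b c → a :* (b :* c) := b :* (a :* c)) refl (v x) (∏ v T) (∏ v U))

  ∑⊆ : (List A → ℤ) → List A → ℤ
  ∑⊆ φ []       = φ []
  ∑⊆ φ (x ∷ xs) = ∑⊆ (φ ∘ (x ∷_)) xs + ∑⊆ φ xs

  ∑⊆-cong : ∀ {φ ψ : List A → ℤ} xs → (∀ S → S ⊆ xs → φ S ≡ ψ S) → ∑⊆ φ xs ≡ ∑⊆ ψ xs
  ∑⊆-cong []       e = e [] []
  ∑⊆-cong (x ∷ xs) e = cong₂ _+_ (∑⊆-cong xs (λ S i → e (x ∷ S) (refl ∷ i))) (∑⊆-cong xs (λ S i → e S (x ∷ʳ i)))

  ∑⊆-ext : ∀ {φ ψ : List A → ℤ} → (∀ S → φ S ≡ ψ S) → ∀ xs → ∑⊆ φ xs ≡ ∑⊆ ψ xs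
  ∑⊆-ext e xs = ∑⊆-cong xs (λ S _ → e S)

  ∑⊆-0 : ∀ {φ : List A → ℤ} → (∀ S → φ S ≡ 0ℤ) → ∀ xs → ∑⊆ φ xs ≡ 0ℤ
  ∑⊆-0 e []       = e []
  ∑⊆-0 e (x ∷ xs) = trans (cong₂ _+_ (∑⊆-0 (λ S → e (x ∷ S)) xs) (∑⊆-0 e xs)) refl

  ∑⊆-+ : ∀ (φ ψ : List A → ℤ) xs → ∑⊆ (λ S → φ S + ψ S) xs ≡ ∑⊆ φ xs + ∑⊆ ψ xs
  ∑⊆-+ φ ψ []       = refl
  ∑⊆-+ φ ψ (x ∷ xs) = trans (cong₂ _+_ (∑⊆-+ (φ ∘ (x ∷_)) (ψ ∘ (x ∷_)) xs) (∑⊆-+ φ ψ xs))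
    (solve 4 (λ a b c d → a :+ b :+ (c :+ d) := a :+ c :+ (b :+ d)) refl (∑⊆ (φ ∘ (x ∷_)) xs) (∑⊆ (ψ ∘ (x ∷_)) xs) (∑⊆ φ xs) (∑⊆ ψ xs))

  ∑⊆-* : ∀ c (φ : List A → ℤ) xs → ∑⊆ (λ S → c * φ S) xs ≡ c * ∑⊆ φ xs
  ∑⊆-* c φ []       = refl
  ∑⊆-* c φ (x ∷ xs) = trans (cong₂ _+_ (∑⊆-* c (φ ∘ (x ∷_)) xs) (∑⊆-* c φ xs)) (sym (ℤ.*-distribˡ-+ c (∑⊆ (φ ∘ (x ∷_)) xs) (∑⊆ φ xs)))

  ∑⊆-swap : ∀ {B : Set} (f : List A → List B → ℤ) xs ys → ∑⊆ (λ S → ∑⊆ (f S) ys) xs ≡ ∑⊆ (λ T → ∑⊆ (λ S → f S T) xs) ys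
  ∑⊆-swap f []       ys = refl
  ∑⊆-swap f (x ∷ xs) ys = trans (cong₂ _+_ (∑⊆-swap (f ∘ (x ∷_)) xs ys) (∑⊆-swap f xs ys))
    (sym (∑⊆-+ (λ T → ∑⊆ (λ S → f (x ∷ S) T) xs) (λ T → ∑⊆ (λ S → f S T) xs) ys))

  nonempty : (List A → ℤ) → List A → ℤ
  nonempty φ []      = 0ℤ
  nonempty φ (x ∷ S) = φ (x ∷ S)

  ∑⊆-nonempty : ∀ (φ : List A → ℤ) xs → ∑⊆ φ xs ≡ φ [] + ∑⊆ (nonempty φ) xs
  ∑⊆-nonempty φ []       = sym (ℤ.+-identityʳ (φ []))
  ∑⊆-nonempty φ (x ∷ xs) = trans (cong (λ z → ∑⊆ (φ ∘ (x ∷_)) xs + z) (∑⊆-nonempty φ xs))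
    (solve 3 (λ a b c → a :+ (b :+ c) := b :+ (a :+ c)) refl (∑⊆ (φ ∘ (x ∷_)) xs) (φ []) (∑⊆ (nonempty φ) xs))

  ∑ℕ⊆ : (List A → ℕ) → List A → ℕ
  ∑ℕ⊆ φ []       = φ []
  ∑ℕ⊆ φ (x ∷ xs) = ∑ℕ⊆ (φ ∘ (x ∷_)) xs ℕ.+ ∑ℕ⊆ φ xs

  ∣∑⊆∣≤ : ∀ (φ : List A → ℤ) (ψ : List A → ℕ) c xs → (∀ S → S ⊆ xs → c ℕ.* ∣ φ S ∣ ≤ ψ S) → c ℕ.* ∣ ∑⊆ φ xs ∣ ≤ ∑ℕ⊆ ψ xs
  ∣∑⊆∣≤ φ ψ c []       h = h [] []
  ∣∑⊆∣≤ φ ψ c (x ∷ xs) h = ℕ.≤-trans (ℕ.*-monoʳ-≤ c (ℤ.∣i+j∣≤∣i∣+∣j∣ (∑⊆ (φ ∘ (x ∷_)) xs) (∑⊆ φ xs)))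
    (ℕ.≤-trans (ℕ.≤-reflexive (ℕ.*-distribˡ-+ c ∣ ∑⊆ (φ ∘ (x ∷_)) xs ∣ ∣ ∑⊆ φ xs ∣))
      (ℕ.+-mono-≤ (∣∑⊆∣≤ (φ ∘ (x ∷_)) (ψ ∘ (x ∷_)) c xs (λ S i → h (x ∷ S) (refl ∷ i)))
                  (∣∑⊆∣≤ φ ψ c xs (λ S i → h S (x ∷ʳ i)))))

  ∑ℕ⊆-+ : ∀ (φ ψ : List A → ℕ) xs → ∑ℕ⊆ (λ S → φ S ℕ.+ ψ S) xs ≡ ∑ℕ⊆ φ xs ℕ.+ ∑ℕ⊆ ψ xs
  ∑ℕ⊆-+ φ ψ []       = refl
  ∑ℕ⊆-+ φ ψ (x ∷ xs) = trans (cong₂ ℕ._+_ (∑ℕ⊆-+ (φ ∘ (x ∷_)) (ψ ∘ (x ∷_)) xs) (∑ℕ⊆-+ φ ψ xs))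
    (ℕS.solve 4 (λ a b c d → a ℕS.:+ b ℕS.:+ (c ℕS.:+ d) ℕS.:= a ℕS.:+ c ℕS.:+ (b ℕS.:+ d)) refl
      (∑ℕ⊆ (φ ∘ (x ∷_)) xs) (∑ℕ⊆ (ψ ∘ (x ∷_)) xs) (∑ℕ⊆ φ xs) (∑ℕ⊆ ψ xs))
    where module ℕS = ℕSolver.+-*-Solver

  ∑ℕ⊆-* : ∀ c (φ : List A → ℕ) xs → ∑ℕ⊆ (λ S → c ℕ.* φ S) xs ≡ c ℕ.* ∑ℕ⊆ φ xs
  ∑ℕ⊆-* c φ []       = refl
  ∑ℕ⊆-* c φ (x ∷ xs) = trans (cong₂ ℕ._+_ (∑ℕ⊆-* c (φ ∘ (x ∷_)) xs) (∑ℕ⊆-* c φ xs)) (sym (ℕ.*-distribˡ-+ c (∑ℕ⊆ (φ ∘ (x ∷_)) xs) (∑ℕ⊆ φ xs)))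

  -- Kronecker's delta. Conditions on cardinalities become numerical factors, so that every sum
  -- ranges over all sublists and sums can be exchanged freely.
  δ : ℕ → ℕ → ℕ
  δ zero    zero    = 1
  δ zero    (suc n) = 0
  δ (suc m) zero    = 0
  δ (suc m) (suc n) = δ m n

  δ-refl : ∀ n → δ n n ≡ 1
  δ-refl zero    = refl
  δ-refl (suc n) = δ-refl n

  δ-≢ : ∀ m n → ¬ (m ≡ n) → δ m n ≡ 0
  δ-≢ zero    zero    ne = ⊥-elim (ne refl)
  δ-≢ zero    (suc n) ne = refl
  δ-≢ (suc m) zero    ne = refl
  δ-≢ (suc m) (suc n) ne = δ-≢ m n (ne ∘ cong suc)

  δ-+ : ∀ t u n → δ (t ℕ.+ u) (t ℕ.+ n) ≡ δ u n
  δ-+ zero    u n = refl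
  δ-+ (suc t) u n = δ-+ t u n

  ∑ℕ⊆-δ : ∀ k (xs : List A) → ∑ℕ⊆ (λ S → δ (length S) k) xs ≡ length xs C k
  ∑ℕ⊆-δ zero    []       = refl
  ∑ℕ⊆-δ (suc k) []       = refl
  ∑ℕ⊆-δ {A} zero    (x ∷ xs) = trans (cong₂ ℕ._+_ (none xs) (∑ℕ⊆-δ zero xs)) refl
    where
    none : ∀ (xs : List A) → ∑ℕ⊆ (λ S → 0) xs ≡ 0
    none []       = refl
    none (x ∷ xs) = cong₂ ℕ._+_ (none xs) (none xs)
  ∑ℕ⊆-δ (suc k) (x ∷ xs) = trans (cong₂ ℕ._+_ (∑ℕ⊆-δ k xs) (∑ℕ⊆-δ (suc k) xs)) (nCk+nC[k+1]≡[n+1]C[k+1] (length xs) k)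

  ∑⊎ : (List A → List A → ℤ) → List A → ℤ
  ∑⊎ K []       = K [] []
  ∑⊎ K (x ∷ xs) = ∑⊎ (λ T U → K (x ∷ T) U) xs + ∑⊎ (λ T U → K T (x ∷ U)) xs

  ∑⊎-cong : ∀ {K K′ : List A → List A → ℤ} xs → (∀ T U → Interleaving T U xs → K T U ≡ K′ T U) → ∑⊎ K xs ≡ ∑⊎ K′ xs
  ∑⊎-cong []       e = e [] [] []
  ∑⊎-cong (x ∷ xs) e = cong₂ _+_ (∑⊎-cong xs (λ T U i → e (x ∷ T) U (consˡ i))) (∑⊎-cong xs (λ T U i → e T (x ∷ U) (consʳ i)))

  ∑⊎-* : ∀ c (K : List A → List A → ℤ) xs → ∑⊎ (λ T U → c * K T U) xs ≡ c * ∑⊎ K xs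
  ∑⊎-* c K []       = refl
  ∑⊎-* c K (x ∷ xs) = trans (cong₂ _+_ (∑⊎-* c _ xs) (∑⊎-* c _ xs)) (sym (ℤ.*-distribˡ-+ c (∑⊎ (λ T U → K (x ∷ T) U) xs) (∑⊎ (λ T U → K T (x ∷ U)) xs)))

  ∏-1+ : ∀ (h : A → ℤ) xs → ∏ (λ x → 1ℤ + h x) xs ≡ ∑⊎ (λ T U → ∏ h T) xs
  ∏-1+ h []       = refl
  ∏-1+ h (x ∷ xs) = trans (cong ((1ℤ + h x) *_) (∏-1+ h xs)) (trans
    (solve 2 (λ a b → (con 1ℤ :+ a) :* b := a :* b :+ b) refl (h x) (∑⊎ (λ T U → ∏ h T) xs))
    (cong (λ z → z + ∑⊎ (λ T U → ∏ h T) xs) (sym (∑⊎-* (h x) (λ T U → ∏ h T) xs))))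

  -- Choosing a set and splitting it amounts to choosing two disjoint sets. As K vanishes on
  -- overlapping pairs, T and U may then range independently, which makes the sum over U for fixed T
  -- an elementary symmetric function on the whole field.
  ∑⊆-∑⊎ : ∀ (K : List A → List A → ℤ) → (∀ {z} T U → z ∈ T → z ∈ U → K T U ≡ 0ℤ) → ∀ xs →
          ∑⊆ (∑⊎ K) xs ≡ ∑⊆ (λ T → ∑⊆ (K T) xs) xs
  ∑⊆-∑⊎ K disjoint []       = refl
  ∑⊆-∑⊎ K disjoint (x ∷ xs) = begin
    ∑⊆ (λ L → ∑⊎ Kˡ L + ∑⊎ Kʳ L) xs + ∑⊆ (∑⊎ K) xs
      ≡⟨ cong₂ _+_ (trans (∑⊆-+ (∑⊎ Kˡ) (∑⊎ Kʳ) xs) (cong₂ _+_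
           (∑⊆-∑⊎ Kˡ (λ T U i j → disjoint (x ∷ T) U (there i) j) xs) (∑⊆-∑⊎ Kʳ (λ T U i j → disjoint T (x ∷ U) i (there j)) xs)))
         (∑⊆-∑⊎ K disjoint xs) ⟩
    l + r + b
      ≡⟨ solve 3 (λ l r b → l :+ r :+ b := con 0ℤ :+ l :+ (r :+ b)) refl l r b ⟩
    0ℤ + l + (r + b)
      ≡⟨ cong (λ z → z + l + (r + b)) (sym (∑⊆-0 (λ T → ∑⊆-0 (λ U → disjoint (x ∷ T) (x ∷ U) (here refl) (here refl)) xs) xs)) ⟩
    ∑⊆ (λ T → ∑⊆ (λ U → K (x ∷ T) (x ∷ U)) xs) xs + l + (r + b)
      ≡⟨ cong₂ _+_ (sym (∑⊆-+ (λ T → ∑⊆ (λ U → K (x ∷ T) (x ∷ U)) xs) (λ T → ∑⊆ (Kˡ T) xs) xs))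
                   (sym (∑⊆-+ (λ T → ∑⊆ (Kʳ T) xs) (λ T → ∑⊆ (K T) xs) xs)) ⟩
    ∑⊆ (λ T → ∑⊆ (K T) (x ∷ xs)) (x ∷ xs) ∎
    where
    open ≡.≡-Reasoning
    Kˡ Kʳ : List _ → List _ → ℤ
    Kˡ T U = K (x ∷ T) U
    Kʳ T U = K T (x ∷ U)
    l r b : ℤ
    l = ∑⊆ (λ T → ∑⊆ (Kˡ T) xs) xs
    r = ∑⊆ (λ T → ∑⊆ (Kʳ T) xs) xs
    b = ∑⊆ (λ T → ∑⊆ (K T) xs) xs

  esym : ℕ → List ℤ → ℤ
  esym zero    vs       = 1ℤ
  esym (suc u) []       = 0ℤ
  esym (suc u) (v ∷ vs) = v * esym u vs + esym (suc u) vs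

  ∑⊆-esym : ∀ (v : A → ℤ) u xs → ∑⊆ (λ U → + δ (length U) u * ∏ v U) xs ≡ esym u (map v xs)
  ∑⊆-esym v zero    []       = refl
  ∑⊆-esym v (suc u) []       = refl
  ∑⊆-esym v zero    (x ∷ xs) = trans (cong₂ _+_ (∑⊆-0 (λ S → refl) xs) (∑⊆-esym v zero xs)) refl
  ∑⊆-esym v (suc u) (x ∷ xs) = cong₂ _+_
    (trans (∑⊆-ext (λ U → solve 3 (λ d a b → d :* (a :* b) := a :* (d :* b)) refl (+ δ (length U) u) (v x) (∏ v U)) xs)
      (trans (∑⊆-* (v x) (λ U → + δ (length U) u * ∏ v U) xs) (cong (v x *_) (∑⊆-esym v u xs))))
    (∑⊆-esym v (suc u) xs)

  sumℤ sum² : List ℤ → ℤ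
  sumℤ []       = 0ℤ
  sumℤ (v ∷ vs) = v + sumℤ vs
  sum² []       = 0ℤ
  sum² (v ∷ vs) = v * v + sum² vs

  -- Newton's identities for values v with v³ = v, read off from (1 - x²) E′(x) = (∑ v - (∑ v²) x) E(x), E = ∏ (1 + v x).
  newton₁ : ∀ vs → esym 1 vs ≡ sumℤ vs
  newton₁ []       = refl
  newton₁ (v ∷ vs) = cong₂ _+_ (ℤ.*-identityʳ v) (newton₁ vs)

  newton : ∀ u vs → All Ternary vs → + (2 ℕ.+ u) * esym (2 ℕ.+ u) vs + sum² vs * esym u vs ≡ sumℤ vs * esym (suc u) vs + + u * esym u vs
  newton zero    [] [] = refl
  newton (suc u) [] [] = trans (cong₂ _+_ (ℤ.*-zeroʳ (+ (3 ℕ.+ u))) refl) (sym (trans (cong (λ z → 0ℤ + z) (ℤ.*-zeroʳ (+ suc u))) refl))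
  newton zero (v ∷ vs) (tv ∷ tvs) = begin
    + 2 * (v * e₁ + e₂) + (v * v + Z) * 1ℤ
      ≡⟨ solve 4 (λ v e₁ e₂ Z → con (+ 2) :* (v :* e₁ :+ e₂) :+ (v :* v :+ Z) :* con 1ℤ :=
           (con (+ 2) :* e₂ :+ Z :* con 1ℤ) :+ (v :* e₁ :+ v :* e₁ :+ v :* v)) refl v e₁ e₂ Z ⟩
    (+ 2 * e₂ + Z * 1ℤ) + (v * e₁ + v * e₁ + v * v)
      ≡⟨ cong₂ (λ x y → x + (v * e₁ + v * y + v * v)) (newton zero vs tvs) (newton₁ vs) ⟩
    (S * e₁ + 0ℤ) + (v * e₁ + v * S + v * v)
      ≡⟨ solve 3 (λ v S e₁ → (S :* e₁ :+ con 0ℤ) :+ (v :* e₁ :+ v :* S :+ v :* v) := (v :+ S) :* (v :* con 1ℤ :+ e₁) :+ con 0ℤ) refl v S e₁ ⟩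
    (v + S) * (v * 1ℤ + e₁) + 0ℤ ∎
    where
    open ≡.≡-Reasoning
    S Z e₁ e₂ : ℤ
    S = sumℤ vs
    Z = sum² vs
    e₁ = esym 1 vs
    e₂ = esym 2 vs
  newton (suc u) (v ∷ vs) (tv ∷ tvs) = begin
    + (3 ℕ.+ u) * (v * e₂ + e₃) + (v * v + Z) * (v * e₀ + e₁)
      ≡⟨ solve 7 (λ c v e₀ e₁ e₂ e₃ Z → (con 1ℤ :+ c) :* (v :* e₂ :+ e₃) :+ (v :* v :+ Z) :* (v :* e₀ :+ e₁) :=
           ((con 1ℤ :+ c) :* e₃ :+ Z :* e₁) :+ v :* (c :* e₂ :+ Z :* e₀) :+ (v :* e₂ :+ v :* v :* e₁ :+ v :* v :* v :* e₀))
           refl (+ (2 ℕ.+ u)) v e₀ e₁ e₂ e₃ Z ⟩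
    (+ (3 ℕ.+ u) * e₃ + Z * e₁) + v * (+ (2 ℕ.+ u) * e₂ + Z * e₀) + (v * e₂ + v * v * e₁ + v * v * v * e₀)
      ≡⟨ cong₂ _+_ (cong₂ (λ x y → x + v * y) (newton (suc u) vs tvs) (newton u vs tvs))
           (cong (λ w → v * e₂ + v * v * e₁ + w * e₀) (cube tv)) ⟩
    (S * e₂ + + suc u * e₁) + v * (S * e₁ + + u * e₀) + (v * e₂ + v * v * e₁ + v * e₀)
      ≡⟨ solve 6 (λ c v S e₀ e₁ e₂ → (S :* e₂ :+ (con 1ℤ :+ c) :* e₁) :+ v :* (S :* e₁ :+ c :* e₀) :+ (v :* e₂ :+ v :* v :* e₁ :+ v :* e₀) :=
           (v :+ S) :* (v :* e₁ :+ e₂) :+ (con 1ℤ :+ c) :* (v :* e₀ :+ e₁)) refl (+ u) v S e₀ e₁ e₂ ⟩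
    (v + S) * (v * e₁ + e₂) + + suc u * (v * e₀ + e₁) ∎
    where
    open ≡.≡-Reasoning
    S Z e₀ e₁ e₂ e₃ : ℤ
    S = sumℤ vs
    Z = sum² vs
    e₀ = esym u vs
    e₁ = esym (1 ℕ.+ u) vs
    e₂ = esym (2 ℕ.+ u) vs
    e₃ = esym (3 ℕ.+ u) vs
    cube : ∀ {v} → Ternary v → v * v * v ≡ v
    cube zero = refl
    cube pos  = refl
    cube neg  = refl

-- Elementary symmetric functions and binomial estimates

module _ where
  open import Data.Nat using (_+_; _*_; _^_; _∸_; _≤_; _<_; z≤n; s≤s)
  open ℕSolver.+-*-Solver

  sum²-bound : ∀ vs → All Ternary vs → ∃[ z ] (sum² vs ≡ + z × z ≤ length vs)
  sum²-bound []       []       = 0 , refl , z≤n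
  sum²-bound (v ∷ vs) (t ∷ ts) with sum²-bound vs ts
  sum²-bound (.0ℤ  ∷ vs) (zero ∷ ts) | z , e , le = z , trans (ℤ.+-identityˡ _) e , ℕ.m≤n⇒m≤1+n le
  sum²-bound (.1ℤ  ∷ vs) (pos ∷ ts)  | z , e , le = suc z , cong (λ x → 1ℤ ℤ.+ x) e , s≤s le
  sum²-bound (.-1ℤ ∷ vs) (neg ∷ ts)  | z , e , le = suc z , cong (λ x → 1ℤ ℤ.+ x) e , s≤s le

  module _ (c q : ℕ) .{{_ : NonZero c}} (vs : List ℤ) (ternary : All Ternary vs) (length≡ : length vs ≡ q)
           (small-sum : ∣ sumℤ vs ∣ * (2 * c) ≤ q) where
    private
      e : ℕ → ℕ
      e u = ∣ esym u vs ∣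

      S : ℕ
      S = ∣ sumℤ vs ∣

      newton-abs : ∀ u → u ≤ q → (2 + u) * e (2 + u) ≤ S * e (suc u) + q * e u
      newton-abs u u≤q with sum²-bound vs ternary
      ... | z , z≡ , z≤ = begin
        (2 + u) * e (2 + u)                                         ≡⟨ ℤ.abs-* (+ (2 + u)) (esym (2 + u) vs) ⟨
        ∣ + (2 + u) ℤ.* esym (2 + u) vs ∣                           ≡⟨ cong ∣_∣ isolate ⟩
        ∣ sumℤ vs ℤ.* esym (suc u) vs ℤ.+ (+ u ℤ.- + z) ℤ.* esym u vs ∣
          ≤⟨ ℤ.∣i+j∣≤∣i∣+∣j∣ (sumℤ vs ℤ.* esym (suc u) vs) ((+ u ℤ.- + z) ℤ.* esym u vs) ⟩
        ∣ sumℤ vs ℤ.* esym (suc u) vs ∣ + ∣ (+ u ℤ.- + z) ℤ.* esym u vs ∣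
          ≡⟨ cong₂ _+_ (ℤ.abs-* (sumℤ vs) (esym (suc u) vs)) (ℤ.abs-* (+ u ℤ.- + z) (esym u vs)) ⟩
        S * e (suc u) + ∣ + u ℤ.- + z ∣ * e u
          ≤⟨ ℕ.+-monoʳ-≤ (S * e (suc u)) (ℕ.*-monoˡ-≤ (e u) (subst (_≤ q) (sym (∣⊖∣≡∣-∣ u z))
               (∣-∣-bound (ℕ.≤-trans u≤q (ℕ.m≤n+m q z)) (ℕ.≤-trans (subst (z ≤_) length≡ z≤) (ℕ.m≤n+m q u))))) ⟩
        S * e (suc u) + q * e u ∎
        where
        open ℕ.≤-Reasoning
        isolate : + (2 + u) ℤ.* esym (2 + u) vs ≡ sumℤ vs ℤ.* esym (suc u) vs ℤ.+ (+ u ℤ.- + z) ℤ.* esym u vs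
        isolate = trans (Zs.solve 2 (λ a b → a Zs.:= (a Zs.:+ b) Zs.:- b) refl (+ (2 + u) ℤ.* esym (2 + u) vs) (+ z ℤ.* esym u vs))
          (trans (cong (λ x → x ℤ.- + z ℤ.* esym u vs) (trans (cong (λ x → + (2 + u) ℤ.* esym (2 + u) vs ℤ.+ x ℤ.* esym u vs) (sym z≡)) (newton u vs ternary)))
            (Zs.solve 4 (λ s u z e → (s Zs.:+ u Zs.:* e) Zs.:- z Zs.:* e Zs.:= s Zs.:+ (u Zs.:- z) Zs.:* e) refl (sumℤ vs ℤ.* esym (suc u) vs) (+ u) (+ z) (esym u vs)))

    -- The claim is |esym u| ≤ (q/c)^u / u!. After doubling, Newton's recursion has two terms: the
    -- bound on the sum of values controls the first, and 2 c² (u + 1) ≤ q the second. Each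
    -- contributes at most q^(u + 2).
    esym-bound : ∀ u → 2 * (c * c) * u ≤ q → c ^ u * u ! * e u ≤ q ^ u
    esym-bound zero _ = s≤s z≤n
    esym-bound (suc zero) _ = begin
      c ^ 1 * 1 * e 1     ≡⟨ cong₂ _*_ (trans (ℕ.*-identityʳ (c ^ 1)) (ℕ.*-identityʳ c)) (cong ∣_∣ (newton₁ vs)) ⟩
      c * S               ≡⟨ ℕ.*-comm c S ⟩
      S * c               ≤⟨ ℕ.*-monoʳ-≤ S (ℕ.m≤m+n c _) ⟩
      S * (2 * c)         ≤⟨ small-sum ⟩
      q                   ≡⟨ ℕ.*-identityʳ q ⟨
      q ^ 1               ∎
      where open ℕ.≤-Reasoning
    esym-bound (suc (suc u)) h = ℕ.*-cancelˡ-≤ 2 (begin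
      2 * (c * (c * c ^ u) * (f₂ * f₁) * e (2 + u))
        ≡⟨ solve 5 (λ c p n f x → con 2 :* (c :* (c :* p) :* (n :* f) :* x) := con 2 :* (c :* (c :* p) :* f) :* (n :* x)) refl c (c ^ u) f₂ f₁ (e (2 + u)) ⟩
      2 * (c * (c * c ^ u) * f₁) * (f₂ * e (2 + u))
        ≤⟨ ℕ.*-monoʳ-≤ (2 * (c * (c * c ^ u) * f₁)) (newton-abs u u≤q) ⟩
      2 * (c * (c * c ^ u) * (suc u * u !)) * (S * e (suc u) + q * e u)
        ≡⟨ solve 8 (λ c p n f S x q y → con 2 :* (c :* (c :* p) :* (n :* f)) :* (S :* x :+ q :* y) :=
             S :* (con 2 :* c) :* (c :* p :* (n :* f) :* x) :+ con 2 :* (c :* c) :* n :* (q :* (p :* f :* y)))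
             refl c (c ^ u) (suc u) (u !) S (e (suc u)) q (e u) ⟩
      S * (2 * c) * (c ^ suc u * (suc u) ! * e (suc u)) + 2 * (c * c) * suc u * (q * (c ^ u * u ! * e u))
        ≤⟨ ℕ.+-mono-≤ (ℕ.*-mono-≤ small-sum (esym-bound (suc u) h₁)) (ℕ.*-mono-≤ h₁ (ℕ.*-monoʳ-≤ q (esym-bound u h₀))) ⟩
      q * q ^ suc u + q * (q * q ^ u)
        ≡⟨ cong (λ x → q * q ^ suc u + x) (sym (ℕ.+-identityʳ _)) ⟩
      2 * q ^ suc (suc u) ∎)
      where
      open ℕ.≤-Reasoning
      f₁ f₂ : ℕ
      f₁ = (suc u) !
      f₂ = suc (suc u)
      h₁ : 2 * (c * c) * suc u ≤ q
      h₁ = ℕ.≤-trans (ℕ.*-monoʳ-≤ (2 * (c * c)) (ℕ.n≤1+n (suc u))) h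
      h₀ : 2 * (c * c) * u ≤ q
      h₀ = ℕ.≤-trans (ℕ.*-monoʳ-≤ (2 * (c * c)) (ℕ.n≤1+n u)) h₁
      u≤q : u ≤ q
      u≤q = ℕ.≤-trans (ℕ.m≤n*m u (2 * (c * c)) {{ℕ.m*n≢0 2 (c * c) {{_}} {{ℕ.m*n≢0 c c}}}}) h₀

  choose-step : ∀ n k → suc k * (n C suc k) + k * (n C k) ≡ n * (n C k)
  choose-step zero    zero    = refl
  choose-step zero    (suc k) = cong₂ _+_ (ℕ.*-zeroʳ (suc (suc k))) (ℕ.*-zeroʳ (suc k))
  choose-step (suc n) zero    = trans (cong (λ x → 1 * x + 0) (nC1≡n (suc n)))
    (solve 1 (λ n → con 1 :* n :+ con 0 := n :* con 1) refl (suc n))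
  choose-step (suc n) (suc k) = begin
    suc (suc k) * (suc n C suc (suc k)) + suc k * (suc n C suc k)
      ≡⟨ cong₂ (λ x y → suc (suc k) * x + suc k * y) (sym (nCk+nC[k+1]≡[n+1]C[k+1] n (suc k))) (sym (nCk+nC[k+1]≡[n+1]C[k+1] n k)) ⟩
    suc (suc k) * (b + c) + suc k * (a + b)
      ≡⟨ solve 4 (λ k a b c → (con 2 :+ k) :* (b :+ c) :+ (con 1 :+ k) :* (a :+ b) :=
           ((con 2 :+ k) :* c :+ (con 1 :+ k) :* b) :+ ((con 1 :+ k) :* b :+ k :* a) :+ (a :+ b)) refl k a b c ⟩
    (suc (suc k) * c + suc k * b) + (suc k * b + k * a) + (a + b)
      ≡⟨ cong₂ (λ x y → x + y + (a + b)) (choose-step n (suc k)) (choose-step n k) ⟩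
    n * b + n * a + (a + b)
      ≡⟨ solve 3 (λ n a b → n :* b :+ n :* a :+ (a :+ b) := (con 1 :+ n) :* (a :+ b)) refl n a b ⟩
    suc n * (a + b)
      ≡⟨ cong (suc n *_) (nCk+nC[k+1]≡[n+1]C[k+1] n k) ⟩
    suc n * (suc n C suc k) ∎
    where
    open ≡.≡-Reasoning
    a b c : ℕ
    a = n C k
    b = n C suc k
    c = n C suc (suc k)

  -- The falling factorial n (n - 1) ... (n - k + 1).
  falling : ℕ → ℕ → ℕ
  falling n k = (n C k) * k !

  falling-step : ∀ n k → falling n (suc k) + k * falling n k ≡ n * falling n k
  falling-step n k = begin
    (n C suc k) * (suc k * k !) + k * ((n C k) * k !)
      ≡⟨ solve 4 (λ k f a b → b :* ((con 1 :+ k) :* f) :+ k :* (a :* f) := ((con 1 :+ k) :* b :+ k :* a) :* f) refl k (k !) (n C k) (n C suc k) ⟩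
    (suc k * (n C suc k) + k * (n C k)) * k !  ≡⟨ cong (_* k !) (choose-step n k) ⟩
    n * (n C k) * k !                          ≡⟨ ℕ.*-assoc n (n C k) (k !) ⟩
    n * falling n k                            ∎
    where open ≡.≡-Reasoning

  falling≤^ : ∀ n k → falling n k ≤ n ^ k
  falling≤^ n zero    = ℕ.≤-refl
  falling≤^ n (suc k) = ℕ.≤-trans (ℕ.m≤m+n _ (k * falling n k))
    (ℕ.≤-trans (ℕ.≤-reflexive (falling-step n k)) (ℕ.*-monoʳ-≤ n (falling≤^ n k)))

  -- The fraction of k-tuples with a repetition is at most k²/n. Multiplying by n avoids the
  -- division, and k² in place of k (k - 1)/2 keeps the induction simple.
  ^≤falling : ∀ n k → n * n ^ k ≤ n * falling n k + k * k * n ^ k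
  ^≤falling n zero    = ℕ.≤-reflexive (sym (ℕ.+-identityʳ _))
  ^≤falling n (suc k) = begin
    n * (n * n ^ k)                                        ≤⟨ ℕ.*-monoʳ-≤ n (^≤falling n k) ⟩
    n * (n * a + k * k * n ^ k)                            ≡⟨ cong (λ x → n * (x + k * k * n ^ k)) (sym (falling-step n k)) ⟩
    n * (b + k * a + k * k * n ^ k)
      ≤⟨ ℕ.*-monoʳ-≤ n (ℕ.+-monoˡ-≤ (k * k * n ^ k) (ℕ.+-monoʳ-≤ b (ℕ.*-monoʳ-≤ k (falling≤^ n k)))) ⟩
    n * (b + k * n ^ k + k * k * n ^ k)
      ≤⟨ ℕ.m≤m+n _ ((1 + k) * (n * n ^ k)) ⟩
    n * (b + k * n ^ k + k * k * n ^ k) + (1 + k) * (n * n ^ k)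
      ≡⟨ solve 4 (λ n b k p → n :* (b :+ k :* p :+ k :* k :* p) :+ (con 1 :+ k) :* (n :* p) :=
           n :* b :+ (con 1 :+ k) :* (con 1 :+ k) :* (n :* p)) refl n b k (n ^ k) ⟩
    n * b + suc k * suc k * (n * n ^ k)                    ∎
    where
    open ℕ.≤-Reasoning
    a b : ℕ
    a = falling n k
    b = falling n (suc k)

  ^≤2falling : ∀ n k → .{{NonZero n}} → 2 * (k * k) ≤ n → n ^ k ≤ 2 * falling n k
  ^≤2falling n k h = ℕ.*-cancelˡ-≤ n (ℕ.+-cancelʳ-≤ (n * n ^ k) _ _ (begin
    n * n ^ k + n * n ^ k                            ≤⟨ ℕ.+-mono-≤ (^≤falling n k) (^≤falling n k) ⟩
    (n * a + k * k * n ^ k) + (n * a + k * k * n ^ k)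
      ≡⟨ solve 4 (λ n a k p → (n :* a :+ k :* k :* p) :+ (n :* a :+ k :* k :* p) := n :* (con 2 :* a) :+ con 2 :* (k :* k) :* p) refl n a k (n ^ k) ⟩
    n * (2 * a) + 2 * (k * k) * n ^ k                ≤⟨ ℕ.+-monoʳ-≤ (n * (2 * a)) (ℕ.*-monoˡ-≤ (n ^ k) h) ⟩
    n * (2 * a) + n * n ^ k                          ∎))
    where
    open ℕ.≤-Reasoning
    a : ℕ
    a = falling n k

  -- The bound 2^(t + u) for the binomial coefficient, cleared of denominators. The induction step
  -- is Pascal's rule for factorials: (t + u)! is t + u copies of (t + u - 1)!.
  factorial-split : ∀ t u → (t + u) ! ≤ 2 ^ (t + u) * (t ! * u !)
  factorial-split zero    u = ℕ.≤-trans (ℕ.m≤n*m (u !) (2 ^ u) {{ℕ.m^n≢0 2 u}}) (ℕ.≤-reflexive (cong (2 ^ u *_) (sym (ℕ.+-identityʳ (u !)))))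
  factorial-split (suc t) zero = subst (λ r → r ! ≤ 2 ^ r * (suc t ! * 1)) (sym (ℕ.+-identityʳ (suc t)))
    (ℕ.≤-trans (ℕ.m≤n*m (suc t !) (2 ^ suc t) {{ℕ.m^n≢0 2 (suc t)}}) (ℕ.≤-reflexive (cong (2 ^ suc t *_) (sym (ℕ.*-identityʳ (suc t !))))))
  factorial-split (suc t) (suc u) = begin
    suc (t + suc u) * (t + suc u) !                            ≡⟨ ℕ.*-distribʳ-+ ((t + suc u) !) (suc t) (suc u) ⟩
    suc t * (t + suc u) ! + suc u * (t + suc u) !
      ≤⟨ ℕ.+-mono-≤ (ℕ.*-monoʳ-≤ (suc t) (factorial-split t (suc u)))
           (ℕ.*-monoʳ-≤ (suc u) (subst (λ r → r ! ≤ 2 ^ r * (suc t ! * u !)) (sym (ℕ.+-suc t u)) (factorial-split (suc t) u))) ⟩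
    suc t * (p * (t ! * (suc u * u !))) + suc u * (p * (suc t * t ! * u !))
      ≡⟨ solve 5 (λ t u p x y → t :* (p :* (x :* (u :* y))) :+ u :* (p :* (t :* x :* y)) := con 2 :* p :* (t :* x :* (u :* y)))
           refl (suc t) (suc u) p (t !) (u !) ⟩
    2 * p * (suc t * t ! * (suc u * u !)) ∎
    where
    open ℕ.≤-Reasoning
    p : ℕ
    p = 2 ^ (t + suc u)

  n<2^n : ∀ n → n < 2 ^ n
  n<2^n zero    = s≤s z≤n
  n<2^n (suc n) = ℕ.≤-trans (ℕ.+-mono-≤ (ℕ.m^n>0 2 n) (n<2^n n)) (ℕ.≤-reflexive (cong (λ x → 2 ^ n + x) (sym (ℕ.+-identityʳ _))))

  4^≡2^2^ : ∀ r → 4 ^ r ≡ 2 ^ r * 2 ^ r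
  4^≡2^2^ r = trans (ℕ.^-*-assoc 2 2 r) (trans (ℕ.^-distribˡ-+-* 2 r (r + 0)) (cong (λ x → 2 ^ r * 2 ^ x) (ℕ.+-identityʳ r)))

  module _ (q r : ℕ) where
    -- A majorant with value i! q^(r - i) on lists of length i < j. As a sum of deltas it can be
    -- summed over all sublists: length i contributes i! q^(r - i) (q choose i) ≤ q^r, the same
    -- bound for each i.
    weight : ℕ → List A → ℕ
    weight zero    T = 0
    weight (suc j) T = j ! * q ^ (r ∸ j) * δ (length T) j + weight j T

    weight-≥ : ∀ j (T : List A) → length T < j → (length T) ! * q ^ (r ∸ length T) ≤ weight j T
    weight-≥ (suc j) T lt with length T ℕ.≟ j
    ... | yes e = ℕ.≤-trans (ℕ.≤-reflexive (trans (sym (ℕ.*-identityʳ _)) (cong₂ (λ i d → i ! * q ^ (r ∸ i) * d) e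
                    (sym (trans (cong (λ i → δ i j) e) (δ-refl j)))))) (ℕ.m≤m+n _ (weight j T))
    ... | no ne = ℕ.≤-trans (weight-≥ j T (ℕ.≤∧≢⇒< (ℕ.≤-pred lt) ne)) (ℕ.m≤n+m _ _)

    ∑-weight : ∀ j → j ≤ suc r → (xs : List A) → length xs ≡ q → ∑ℕ⊆ (weight j) xs ≤ j * q ^ r
    ∑-weight zero    _  xs e = ℕ.≤-reflexive (∑-zero xs)
      where
      ∑-zero : ∀ (xs : List A) → ∑ℕ⊆ (λ T → 0) xs ≡ 0
      ∑-zero []       = refl
      ∑-zero (x ∷ xs) = cong₂ _+_ (∑-zero xs) (∑-zero xs)
    ∑-weight (suc j) (s≤s j≤r) xs e = begin
      ∑ℕ⊆ (weight (suc j)) xs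
        ≡⟨ ∑ℕ⊆-+ (λ T → j ! * q ^ (r ∸ j) * δ (length T) j) (weight j) xs ⟩
      ∑ℕ⊆ (λ T → j ! * q ^ (r ∸ j) * δ (length T) j) xs + ∑ℕ⊆ (weight j) xs
        ≡⟨ cong (_+ ∑ℕ⊆ (weight j) xs) (∑ℕ⊆-* (j ! * q ^ (r ∸ j)) (λ T → δ (length T) j) xs) ⟩
      j ! * q ^ (r ∸ j) * ∑ℕ⊆ (λ T → δ (length T) j) xs + ∑ℕ⊆ (weight j) xs
        ≡⟨ cong (λ x → j ! * q ^ (r ∸ j) * x + ∑ℕ⊆ (weight j) xs) (trans (∑ℕ⊆-δ j xs) (cong (_C j) e)) ⟩
      j ! * q ^ (r ∸ j) * (q C j) + ∑ℕ⊆ (weight j) xs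
        ≡⟨ cong (_+ ∑ℕ⊆ (weight j) xs) (solve 3 (λ f p c → f :* p :* c := c :* f :* p) refl (j !) (q ^ (r ∸ j)) (q C j)) ⟩
      falling q j * q ^ (r ∸ j) + ∑ℕ⊆ (weight j) xs
        ≤⟨ ℕ.+-mono-≤ (ℕ.*-monoˡ-≤ (q ^ (r ∸ j)) (falling≤^ q j)) (∑-weight j (ℕ.m≤n⇒m≤1+n j≤r) xs e) ⟩
      q ^ j * q ^ (r ∸ j) + j * q ^ r
        ≡⟨ cong (_+ j * q ^ r) (trans (sym (ℕ.^-distribˡ-+-* q j (r ∸ j))) (cong (q ^_) (ℕ.m+[n∸m]≡n j≤r))) ⟩
      q ^ r + j * q ^ r ∎
      where open ℕ.≤-Reasoning

  -- Both halves of the double sum are instances; they differ only in the sign s and in the test b,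
  -- which ensures that the fixed set is the smaller one.
  module _ (q r : ℕ) (xs : List A) (length≡ : length xs ≡ q) (w : List A → A → ℤ) (s : ℕ → ℤ) (∣s∣≤1 : ∀ t → ∣ s t ∣ ≤ 1)
           (b : ℕ → Bool) (b-sound : ∀ t → b t ≡ true → t + t ≤ r)
           (bound : ∀ x T → x ∷ T ⊆ xs → length (x ∷ T) ≤ r →
             64 ^ (r ∸ length (x ∷ T)) * (r ∸ length (x ∷ T)) ! * ∣ esym (r ∸ length (x ∷ T)) (map (w (x ∷ T)) xs) ∣ ≤
             q ^ (r ∸ length (x ∷ T))) where

    halfTerm : List A → ℤ
    halfTerm T = if b (length T) then s (length T) ℤ.* esym (r ∸ length T) (map (w T) xs) else 0ℤ

    private
      term-bound : ∀ x T → x ∷ T ⊆ xs → length (x ∷ T) + length (x ∷ T) ≤ r →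
        8 ^ r * r ! * ∣ s (length (x ∷ T)) ℤ.* esym (r ∸ length (x ∷ T)) (map (w (x ∷ T)) xs) ∣ ≤ 2 ^ r * weight q r (suc r) (x ∷ T)
      term-bound x T i 2t≤r = begin
        8 ^ r * r ! * ∣ s t ℤ.* esym u vs ∣
          ≤⟨ ℕ.*-monoʳ-≤ (8 ^ r * r !) (ℕ.≤-trans (ℕ.≤-reflexive (ℤ.abs-* (s t) (esym u vs)))
               (ℕ.≤-trans (ℕ.*-monoˡ-≤ E (∣s∣≤1 t)) (ℕ.≤-reflexive (ℕ.*-identityˡ E)))) ⟩
        8 ^ r * r ! * E
          ≤⟨ ℕ.*-monoˡ-≤ E (ℕ.*-mono-≤ 8^r≤64^u (subst (λ k → k ! ≤ 2 ^ k * (t ! * u !)) t+u≡r (factorial-split t u))) ⟩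
        64 ^ u * (2 ^ r * (t ! * u !)) * E
          ≡⟨ solve 5 (λ a p f g e → a :* (p :* (f :* g)) :* e := p :* (f :* (a :* g :* e))) refl (64 ^ u) (2 ^ r) (t !) (u !) E ⟩
        2 ^ r * (t ! * (64 ^ u * u ! * E))
          ≤⟨ ℕ.*-monoʳ-≤ (2 ^ r) (ℕ.*-monoʳ-≤ (t !) (bound x T i t≤r)) ⟩
        2 ^ r * (t ! * q ^ u)
          ≤⟨ ℕ.*-monoʳ-≤ (2 ^ r) (weight-≥ q r (suc r) (x ∷ T) (s≤s t≤r)) ⟩
        2 ^ r * weight q r (suc r) (x ∷ T) ∎
        where
        open ℕ.≤-Reasoning
        t u E : ℕ
        t = length (x ∷ T)
        u = r ∸ t
        vs : List ℤ
        vs = map (w (x ∷ T)) xs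
        E = ∣ esym u vs ∣
        t≤r : t ≤ r
        t≤r = ℕ.≤-trans (ℕ.m≤m+n t t) 2t≤r
        t+u≡r : t + u ≡ r
        t+u≡r = ℕ.m+[n∸m]≡n t≤r
        t≤u : t ≤ u
        t≤u = ℕ.+-cancelˡ-≤ t t u (subst (t + t ≤_) (sym t+u≡r) 2t≤r)
        8^r≤64^u : 8 ^ r ≤ 64 ^ u
        8^r≤64^u = ℕ.≤-trans (ℕ.^-monoʳ-≤ 8 (subst (_≤ 2 * u) t+u≡r
            (ℕ.+-mono-≤ t≤u (ℕ.≤-reflexive (sym (ℕ.+-identityʳ u))))))
          (ℕ.≤-reflexive (sym (ℕ.^-*-assoc 8 2 u)))

    -- As t ≤ u = r - t, the factor 64ᵘ ≥ 8ʳ pays for (r choose t) ≤ 2ʳ and for the r + 1 ≤ 2ʳ sizes t, with 2ʳ to spare.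
    half-bound : 8 ^ r * r ! * ∣ ∑⊆ (nonempty halfTerm) xs ∣ ≤ 4 ^ r * q ^ r
    half-bound = begin
      8 ^ r * r ! * ∣ ∑⊆ (nonempty halfTerm) xs ∣   ≤⟨ ∣∑⊆∣≤ (nonempty halfTerm) (λ T → 2 ^ r * weight q r (suc r) T) (8 ^ r * r !) xs each ⟩
      ∑ℕ⊆ (λ T → 2 ^ r * weight q r (suc r) T) xs   ≡⟨ ∑ℕ⊆-* (2 ^ r) (weight q r (suc r)) xs ⟩
      2 ^ r * ∑ℕ⊆ (weight q r (suc r)) xs           ≤⟨ ℕ.*-monoʳ-≤ (2 ^ r) (∑-weight q r (suc r) ℕ.≤-refl xs length≡) ⟩
      2 ^ r * (suc r * q ^ r)                       ≤⟨ ℕ.*-monoʳ-≤ (2 ^ r) (ℕ.*-monoˡ-≤ (q ^ r) (n<2^n r)) ⟩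
      2 ^ r * (2 ^ r * q ^ r)                       ≡⟨ ℕ.*-assoc (2 ^ r) (2 ^ r) (q ^ r) ⟨
      2 ^ r * 2 ^ r * q ^ r                         ≡⟨ cong (_* q ^ r) (4^≡2^2^ r) ⟨
      4 ^ r * q ^ r                                 ∎
      where
      open ℕ.≤-Reasoning
      each : ∀ T → T ⊆ xs → 8 ^ r * r ! * ∣ nonempty halfTerm T ∣ ≤ 2 ^ r * weight q r (suc r) T
      each [] _ = ℕ.≤-trans (ℕ.≤-reflexive (ℕ.*-zeroʳ (8 ^ r * r !))) z≤n
      each (x ∷ T) i with b (length (x ∷ T)) in eq
      ... | false = ℕ.≤-trans (ℕ.≤-reflexive (ℕ.*-zeroʳ (8 ^ r * r !))) z≤n
      ... | true  = term-bound x T i (b-sound _ eq)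

-- Signs, subsets as lists, and complementary sizes

module _ where
  open import Data.Integer using (_+_; _*_; -_; _-_; _^_)

  AllPairs-resp-⊆ : ∀ {R : A → A → Set} {xs ys} → xs ⊆ ys → AllPairs R ys → AllPairs R xs
  AllPairs-resp-⊆ []         []       = []
  AllPairs-resp-⊆ (y ∷ʳ i)   (_ ∷ rs) = AllPairs-resp-⊆ i rs
  AllPairs-resp-⊆ (refl ∷ i) (r ∷ rs) = All-resp-⊆ i r ∷ AllPairs-resp-⊆ i rs

  All-interleaving : ∀ {P : A → Set} {T U L} → Interleaving T U L → All P L → All P T × All P U
  All-interleaving []        []       = [] , []
  All-interleaving (consˡ i) (p ∷ ps) = let a , b = All-interleaving i ps in p ∷ a , b
  All-interleaving (consʳ i) (p ∷ ps) = let a , b = All-interleaving i ps in a , p ∷ b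

  AllPairs-interleaving : ∀ {R : A → A → Set} → (∀ {x y} → R x y → R y x) → ∀ {T U L} → Interleaving T U L → AllPairs R L →
    AllPairs R T × All (λ x → All (R x) U) T
  AllPairs-interleaving s []        []       = [] , []
  AllPairs-interleaving s (consˡ i) (r ∷ rs) =
    let a , b = All-interleaving i r
        c , d = AllPairs-interleaving s i rs
    in a ∷ c , b ∷ d
  AllPairs-interleaving s (consʳ i) (r ∷ rs) =
    let a , b = All-interleaving i r
        c , d = AllPairs-interleaving s i rs
    in c , All.map (λ (x , y) → s x ∷ y) (All.zip (a , d))

  length-interleaving : ∀ {T U L : List A} → Interleaving T U L → length L ≡ length T ℕ.+ length U
  length-interleaving []        = refl
  length-interleaving (consˡ i) = cong suc (length-interleaving i)
  length-interleaving {T = T} {x ∷ U} (consʳ i) = trans (cong suc (length-interleaving i)) (sym (ℕ.+-suc (length T) (length U)))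

  -- sgn m = (-1)ᵐ and ε t = (-1)^(t(t-1)/2).
  sgn ε : ℕ → ℤ
  sgn zero    = 1ℤ
  sgn (suc m) = - sgn m
  ε zero    = 1ℤ
  ε (suc t) = sgn t * ε t

  Unit : ℤ → Set
  Unit z = z ≡ 1ℤ ⊎ z ≡ -1ℤ

  Unit-* : ∀ {a b} → Unit a → Unit b → Unit (a * b)
  Unit-* (inj₁ refl) (inj₁ refl) = inj₁ refl
  Unit-* (inj₁ refl) (inj₂ refl) = inj₂ refl
  Unit-* (inj₂ refl) (inj₁ refl) = inj₂ refl
  Unit-* (inj₂ refl) (inj₂ refl) = inj₁ refl

  Unit-neg : ∀ {a} → Unit a → Unit (- a)
  Unit-neg (inj₁ refl) = inj₂ refl
  Unit-neg (inj₂ refl) = inj₁ refl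

  Unit-sgn : ∀ m → Unit (sgn m)
  Unit-sgn zero    = inj₁ refl
  Unit-sgn (suc m) = Unit-neg (Unit-sgn m)

  Unit-ε : ∀ t → Unit (ε t)
  Unit-ε zero    = inj₁ refl
  Unit-ε (suc t) = Unit-* (Unit-sgn t) (Unit-ε t)

  Unit-∏ : ∀ {v : A → ℤ} → (∀ x → Unit (v x)) → ∀ xs → Unit (∏ v xs)
  Unit-∏ u []       = inj₁ refl
  Unit-∏ u (x ∷ xs) = Unit-* (u x) (Unit-∏ u xs)

  ∣Unit∣≤1 : ∀ {z} → Unit z → ∣ z ∣ ≤ 1
  ∣Unit∣≤1 (inj₁ refl) = ℕ.≤-refl
  ∣Unit∣≤1 (inj₂ refl) = ℕ.≤-refl

  -- The four new signs are z, -z, z, -z for z = sgn t, with product z^4 = 1.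
  ε-4+ : ∀ t → ε (4 ℕ.+ t) ≡ ε t
  ε-4+ t = go (Unit-sgn t)
    where
    go : ∀ {z} → Unit z → - (- (- z)) * (- (- z) * (- z * (z * ε t))) ≡ ε t
    go (inj₁ refl) = Zs.solve 1 (λ e → Zs.con -1ℤ Zs.:* (Zs.con 1ℤ Zs.:* (Zs.con -1ℤ Zs.:* (Zs.con 1ℤ Zs.:* e))) Zs.:= e) refl (ε t)
    go (inj₂ refl) = Zs.solve 1 (λ e → Zs.con 1ℤ Zs.:* (Zs.con -1ℤ Zs.:* (Zs.con 1ℤ Zs.:* (Zs.con -1ℤ Zs.:* e))) Zs.:= e) refl (ε t)

  sgn≡1⇒2∣ : ∀ m → sgn m ≡ 1ℤ → 2 ∣ m
  sgn≡1⇒2∣ zero          e = divides 0 refl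
  sgn≡1⇒2∣ (suc (suc m)) e with sgn≡1⇒2∣ m (trans (sym (ℤ.neg-involutive (sgn m))) e)
  ... | divides k eq = divides (suc k) (cong (λ i → suc (suc i)) eq)

  2∣⇒sgn≡1 : ∀ m → 2 ∣ m → sgn m ≡ 1ℤ
  2∣⇒sgn≡1 .(k ℕ.* 2) (divides k refl) = go k
    where
    go : ∀ k → sgn (k ℕ.* 2) ≡ 1ℤ
    go zero    = refl
    go (suc k) = trans (ℤ.neg-involutive (sgn (k ℕ.* 2))) (go k)

  ∏-1+-dichotomy : ∀ (h : A → ℤ) → (∀ x → Unit (h x)) → ∀ xs →
    (All (λ x → h x ≡ 1ℤ) xs × ∏ (λ x → 1ℤ + h x) xs ≡ + (2 ℕ.^ length xs)) ⊎
    (¬ All (λ x → h x ≡ 1ℤ) xs × ∏ (λ x → 1ℤ + h x) xs ≡ 0ℤ)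
  ∏-1+-dichotomy h u [] = inj₁ ([] , refl)
  ∏-1+-dichotomy h u (x ∷ xs) with u x | ∏-1+-dichotomy h u xs
  ... | inj₁ e | inj₁ (a , p) = inj₁ (e ∷ a , trans (cong₂ (λ y z → (1ℤ + y) * z) e p) (sym (ℤ.pos-* 2 (2 ℕ.^ length xs))))
  ... | inj₁ e | inj₂ (n , p) = inj₂ ((λ { (_ ∷ a) → n a }) , trans (cong ((1ℤ + h x) *_) p) (ℤ.*-zeroʳ (1ℤ + h x)))
  ... | inj₂ e | _            = inj₂ ((λ { (e′ ∷ _) → neg≢pos (trans (sym e) e′) }) ,
          trans (cong (λ y → (1ℤ + y) * ∏ (λ x → 1ℤ + h x) xs) e) (ℤ.*-zeroˡ (∏ (λ x → 1ℤ + h x) xs)))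
    where
    neg≢pos : ¬ (-1ℤ ≡ 1ℤ)
    neg≢pos ()

  elems : ∀ {n} → (Fin n → A) → Subset n → List A
  elems en []          = []
  elems en (true  ∷ S) = en zero ∷ elems (en ∘ suc) S
  elems en (false ∷ S) = elems (en ∘ suc) S

  length-elems : ∀ {n} (en : Fin n → A) S → length (elems en S) ≡ card S
  length-elems en []          = refl
  length-elems en (true  ∷ S) = cong suc (length-elems (en ∘ suc) S)
  length-elems en (false ∷ S) = length-elems (en ∘ suc) S

  All-elems⁺ : ∀ {n} {P : A → Set} (en : Fin n → A) S → (∀ v → v ∈ˢ S → P (en v)) → All P (elems en S)
  All-elems⁺ en []          h = []
  All-elems⁺ en (true  ∷ S) h = h zero here ∷ All-elems⁺ (en ∘ suc) S (λ v i → h (suc v) (there i))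
  All-elems⁺ en (false ∷ S) h = All-elems⁺ (en ∘ suc) S (λ v i → h (suc v) (there i))

  All-elems⁻ : ∀ {n} {P : A → Set} (en : Fin n → A) S → All P (elems en S) → ∀ v → v ∈ˢ S → P (en v)
  All-elems⁻ en (true  ∷ S) (p ∷ ps) zero    here      = p
  All-elems⁻ en (true  ∷ S) (p ∷ ps) (suc v) (there i) = All-elems⁻ (en ∘ suc) S ps v i
  All-elems⁻ en (false ∷ S) ps       (suc v) (there i) = All-elems⁻ (en ∘ suc) S ps v i

  -- Turns parity of an out-degree into a product of signs: if b tests whether v - y is a nonzero
  -- square, the intersection on the right is the set of out-neighbours of v in S.
  ∏-elems : ∀ {n} (en : Fin n → A) (b : A → Bool) S →
            ∏ (λ y → if b y then -1ℤ else 1ℤ) (elems en S) ≡ sgn (card (S ∩ Vec.tabulate (b ∘ en)))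
  ∏-elems en b [] = refl
  ∏-elems en b (true ∷ S) with b (en zero)
  ... | true  = trans (ℤ.-1*i≡-i _) (cong -_ (∏-elems (en ∘ suc) b S))
  ... | false = trans (ℤ.*-identityˡ _) (∏-elems (en ∘ suc) b S)
  ∏-elems en b (false ∷ S) = ∏-elems (en ∘ suc) b S

  length-filter-map : ∀ {A B : Set} {P : B → Set} (P? : Decidable P) (f : A → B) xs →
                      length (filter P? (map f xs)) ≡ length (filter (P? ∘ f) xs)
  length-filter-map P? f []       = refl
  length-filter-map P? f (x ∷ xs) with does (P? (f x))
  ... | true  = cong suc (length-filter-map P? f xs)
  ... | false = length-filter-map P? f xs

  -- The bridge from the counting in `evenCount` to sums over sublists: `allSubsets` and `∑⊆` branch
  -- on the first element in the same order.
  ∑⊆-allSubsets : ∀ n (en : Fin n → A) {P : Subset n → Set} (P? : Decidable P) c (φ : List A → ℤ) →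
    (∀ S → (if does (P? S) then c else 0ℤ) ≡ φ (elems en S)) →
    + length (filter P? (allSubsets n)) * c ≡ ∑⊆ φ (tabulate en)
  ∑⊆-allSubsets zero en P? c φ h with does (P? []) | h []
  ... | true  | e = trans (ℤ.*-identityˡ c) e
  ... | false | e = trans (ℤ.*-zeroˡ c) e
  ∑⊆-allSubsets (suc n) en P? c φ h = begin
    + length (filter P? (map (true ∷_) As ++ map (false ∷_) As)) * c
      ≡⟨ cong (λ k → + k * c) (trans (cong length (filter-++ P? (map (true ∷_) As) (map (false ∷_) As)))
           (trans (length-++ (filter P? (map (true ∷_) As)))
             (cong₂ ℕ._+_ (length-filter-map P? (true ∷_) As) (length-filter-map P? (false ∷_) As)))) ⟩
    + (a ℕ.+ b) * c            ≡⟨ ℤ.*-distribʳ-+ c (+ a) (+ b) ⟩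
    + a * c + + b * c
      ≡⟨ cong₂ _+_ (∑⊆-allSubsets n (en ∘ suc) (P? ∘ (true ∷_)) c (φ ∘ (en zero ∷_)) (λ S → h (true ∷ S)))
                     (∑⊆-allSubsets n (en ∘ suc) (P? ∘ (false ∷_)) c φ (λ S → h (false ∷ S))) ⟩
    ∑⊆ φ (tabulate en) ∎
    where
    open ≡.≡-Reasoning
    As : List (Subset n)
    As = allSubsets n
    a b : ℕ
    a = length (filter (P? ∘ (true ∷_)) As)
    b = length (filter (P? ∘ (false ∷_)) As)

  esym-ones : ∀ (v : A → ℤ) → (∀ x → v x ≡ 1ℤ) → ∀ u xs → esym u (map v xs) ≡ + (length xs C u)
  esym-ones v e zero    xs       = refl
  esym-ones v e (suc u) []       = refl
  esym-ones v e (suc u) (x ∷ xs) = trans (cong₂ _+_ (trans (cong₂ _*_ (e x) (esym-ones v e u xs)) (ℤ.*-identityˡ _)) (esym-ones v e (suc u) xs))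
    (cong +_ (nCk+nC[k+1]≡[n+1]C[k+1] (length xs) u))

  sumℤ-map : ∀ (v : A → ℤ) xs → sumℤ (map v xs) ≡ ∑ v xs
  sumℤ-map v []       = refl
  sumℤ-map v (x ∷ xs) = cong (λ z → v x + z) (sumℤ-map v xs)

  ≤ᵇ-true : ∀ {m n} → m ≤ n → (m ℕ.≤ᵇ n) ≡ true
  ≤ᵇ-true {m} {n} le with m ℕ.≤ᵇ n | ℕ.≤⇒≤ᵇ le
  ... | true | _ = refl

  ≤ᵇ-false : ∀ {m n} → ¬ (m ≤ n) → (m ℕ.≤ᵇ n) ≡ false
  ≤ᵇ-false {m} {n} nle with m ℕ.≤ᵇ n in e
  ... | false = refl
  ... | true  = ⊥-elim (nle (ℕ.≤ᵇ⇒≤ m n (subst Bool.T (sym e) _)))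

  ≤ᵇ-sound : ∀ m n → (m ℕ.≤ᵇ n) ≡ true → m ≤ n
  ≤ᵇ-sound m n e = ℕ.≤ᵇ⇒≤ m n (subst Bool.T (sym e) _)

  δ-complement : ∀ t u r → t ≤ r → δ (t ℕ.+ u) r ≡ δ u (r ℕ.∸ t)
  δ-complement t u r t≤r = trans (cong (δ (t ℕ.+ u)) (sym (ℕ.m+[n∸m]≡n t≤r))) (δ-+ t u (r ℕ.∸ t))

  -- Given t + u = r, the comparison t ≤ u depends on t alone, as 2 t ≤ r. So for fixed T it can be
  -- pulled out of the sum over U. `δ-upper-half` does the same for u when t > u.
  δ-lower-half : ∀ t u r → (if t ℕ.≤ᵇ u then δ (t ℕ.+ u) r else 0) ≡ (if t ℕ.+ t ℕ.≤ᵇ r then δ u (r ℕ.∸ t) else 0)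
  δ-lower-half t u r with t ℕ.+ u ℕ.≟ r
  ... | yes refl = go (t ℕ.≤? u)
    where
    go : Dec (t ≤ u) → (if t ℕ.≤ᵇ u then δ (t ℕ.+ u) (t ℕ.+ u) else 0) ≡ (if t ℕ.+ t ℕ.≤ᵇ t ℕ.+ u then δ u (t ℕ.+ u ℕ.∸ t) else 0)
    go (yes le) rewrite ≤ᵇ-true le | ≤ᵇ-true (ℕ.+-monoʳ-≤ t le) = δ-complement t u (t ℕ.+ u) (ℕ.m≤m+n t u)
    go (no nle) rewrite ≤ᵇ-false nle | ≤ᵇ-false (nle ∘ ℕ.+-cancelˡ-≤ t t u) = refl
  ... | no ne = trans lhs (sym rhs)
    where
    lhs : (if t ℕ.≤ᵇ u then δ (t ℕ.+ u) r else 0) ≡ 0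
    lhs with t ℕ.≤ᵇ u
    ... | true  = δ-≢ (t ℕ.+ u) r ne
    ... | false = refl
    rhs : (if t ℕ.+ t ℕ.≤ᵇ r then δ u (r ℕ.∸ t) else 0) ≡ 0
    rhs with t ℕ.+ t ℕ.≤ᵇ r in e
    ... | true  = trans (sym (δ-complement t u r (ℕ.≤-trans (ℕ.m≤m+n t t) (≤ᵇ-sound (t ℕ.+ t) r e)))) (δ-≢ (t ℕ.+ u) r ne)
    ... | false = refl

  δ-upper-half : ∀ t u r → (if t ℕ.≤ᵇ u then 0 else δ (t ℕ.+ u) r) ≡ (if suc (u ℕ.+ u) ℕ.≤ᵇ r then δ t (r ℕ.∸ u) else 0)
  δ-upper-half t u r with t ℕ.+ u ℕ.≟ r
  ... | yes refl = go (t ℕ.≤? u)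
    where
    go : Dec (t ≤ u) → (if t ℕ.≤ᵇ u then 0 else δ (t ℕ.+ u) (t ℕ.+ u)) ≡ (if suc (u ℕ.+ u) ℕ.≤ᵇ t ℕ.+ u then δ t (t ℕ.+ u ℕ.∸ u) else 0)
    go (yes le) rewrite ≤ᵇ-true le | ≤ᵇ-false {suc (u ℕ.+ u)} {t ℕ.+ u} (ℕ.<⇒≱ (s≤s (ℕ.+-monoˡ-≤ u le))) = refl
    go (no nle) rewrite ≤ᵇ-false nle | ≤ᵇ-true {suc (u ℕ.+ u)} {t ℕ.+ u} (ℕ.+-monoˡ-≤ u (ℕ.≰⇒> nle)) =
      trans (cong (λ k → δ k (t ℕ.+ u)) (ℕ.+-comm t u)) (δ-complement u t (t ℕ.+ u) (ℕ.m≤n+m u t))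
  ... | no ne = trans lhs (sym rhs)
    where
    lhs : (if t ℕ.≤ᵇ u then 0 else δ (t ℕ.+ u) r) ≡ 0
    lhs with t ℕ.≤ᵇ u
    ... | true  = refl
    ... | false = δ-≢ (t ℕ.+ u) r ne
    rhs : (if suc (u ℕ.+ u) ℕ.≤ᵇ r then δ t (r ℕ.∸ u) else 0) ≡ 0
    rhs with suc (u ℕ.+ u) ℕ.≤ᵇ r in e
    ... | true  = trans (sym (trans (cong (λ k → δ k r) (ℕ.+-comm t u))
                    (δ-complement u t r (ℕ.≤-trans (ℕ.m≤m+n u u) (ℕ.≤-trans (ℕ.n≤1+n _) (≤ᵇ-sound (suc (u ℕ.+ u)) r e)))))) (δ-≢ (t ℕ.+ u) r ne)
    ... | false = refl

  Unit-^ : ∀ {z} → Unit z → ∀ n → Unit (z ^ n)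
  Unit-^ u zero    = inj₁ refl
  Unit-^ u (suc n) = Unit-* u (Unit-^ u n)

  -- Even subsets of the Paley tournament

  module Paley (F : FiniteField) (l : ℕ)
               (size≡ : FiniteField.size F ≡ suc (suc (l ℕ.+ l) ℕ.+ suc (l ℕ.+ l))) where
    open FiniteField F using (Carrier; _≈_; _≉_; 0#; enum; size) renaming (_-_ to _−_; sym to ≈-sym; trans to ≈-trans)
    open FieldPoly F using (Distinct; elements; elements-distinct)
    open RootPolynomial F using (rootVal)
    open Character F l size≡ using (χ; χ-*; χ-1; χ-0; χ-cong; χ-neg; χ-ternary; χ≡0⇒≈0; square⇒χ≡1; χ≡1⇒square; charSum)
    private
      module Fₗ = RingLemmas (FiniteField.commRing F)
      module F = FiniteField F

    s : Carrier → ℤ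
    s z = if does (isNonzeroSquare? F z) then -1ℤ else 1ℤ

    Unit-s : ∀ z → Unit (s z)
    Unit-s z = go (does (isNonzeroSquare? F z))
      where
      go : ∀ b → Unit (if b then -1ℤ else 1ℤ)
      go true  = inj₂ refl
      go false = inj₁ refl

    s-square : ∀ {z} → IsNonzeroSquare F z → s z ≡ -1ℤ
    s-square {z} sq = cong (if_then -1ℤ else 1ℤ) (dec-true (isNonzeroSquare? F z) sq)

    s-nonsquare : ∀ {z} → ¬ IsNonzeroSquare F z → s z ≡ 1ℤ
    s-nonsquare {z} nsq = cong (if_then -1ℤ else 1ℤ) (dec-false (isNonzeroSquare? F z) nsq)

    s-zero : ∀ {z} → z ≈ 0# → s z ≡ 1ℤ
    s-zero e = s-nonsquare (λ (nz , _) → nz e)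

    χ-nonzero : ∀ {z} → z ≉ 0# → χ z ≡ 1ℤ ⊎ χ z ≡ -1ℤ
    χ-nonzero {z} nz with χ z | χ-ternary z | χ≡0⇒≈0 {z}
    ... | .0ℤ  | zero | h = ⊥-elim (nz (h refl))
    ... | .1ℤ  | pos  | _ = inj₁ refl
    ... | .-1ℤ | neg  | _ = inj₂ refl

    s-nonzero : ∀ {z} → z ≉ 0# → s z ≡ - χ z
    s-nonzero {z} nz = [ (λ e → trans (s-square (χ≡1⇒square e)) (cong -_ (sym e))) ,
      (λ e → trans (s-nonsquare (λ sq → 1≢-1 (trans (sym (square⇒χ≡1 sq)) e))) (cong -_ (sym e))) ]′ (χ-nonzero nz)
      where
      1≢-1 : ¬ (1ℤ ≡ -1ℤ)
      1≢-1 ()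

    -[x−y]≈y−x : ∀ x y → F.- (x − y) ≈ y − x
    -[x−y]≈y−x x y = ≈-trans (≈-sym (Fₗ.-‿+-comm x (F.- y))) (≈-trans (F.+-congˡ (Fₗ.-‿involutive y)) (F.+-comm (F.- x) y))

    -- Off zero s is -χ, and the minus sign is absorbed by χ(-1) = -1 when the argument is reversed.
    s≡χ : ∀ {x y} → x ≉ y → s (x − y) ≡ χ (y − x)
    s≡χ {x} {y} ne = trans (s-nonzero (ne ∘ Fₗ.x-y≈0⇒x≈y)) (trans (sym (χ-neg (x − y))) (χ-cong (-[x−y]≈y−x x y)))

    χ-swap : ∀ x y → χ (x − y) ≡ - χ (y − x)
    χ-swap x y = trans (χ-cong (≈-sym (-[x−y]≈y−x y x))) (χ-neg (y − x))

    s-antisymmetric : ∀ {x y} → x ≉ y → s (x − y) * s (y − x) ≡ -1ℤ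
    s-antisymmetric {x} {y} ne = trans (cong₂ _*_ (s≡χ ne) (trans (s≡χ (ne ∘ ≈-sym)) (χ-swap x y)))
      ([ (λ e → cong (λ z → z * - z) e) , (λ e → cong (λ z → z * - z) e) ]′ (χ-nonzero {y − x} (ne ∘ ≈-sym ∘ Fₗ.x-y≈0⇒x≈y)))

    ∏-sgn : ∀ {v : Carrier → ℤ} xs → All (λ x → v x ≡ -1ℤ) xs → ∏ v xs ≡ sgn (length xs)
    ∏-sgn []       []       = refl
    ∏-sgn (x ∷ xs) (e ∷ es) = trans (cong₂ _*_ e (∏-sgn xs es)) (ℤ.-1*i≡-i (sgn (length xs)))

    -- Each unordered pair contributes s(z) s(-z) = -1, as -1 is not a square.
    ∏∏s-self : ∀ T → Distinct T → ∏ (λ v → ∏ (λ y → s (v − y)) T) T ≡ ε (length T)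
    ∏∏s-self []      []       = refl
    ∏∏s-self (x ∷ T) (r ∷ rs) = begin
      (s (x − x) * row) * ∏ (λ v → s (v − x) * ∏ (λ y → s (v − y)) T) T
        ≡⟨ cong₂ (λ a b → (a * row) * b) (s-zero (F.-‿inverseʳ x)) (trans (∏-* (λ v → s (v − x)) (λ v → ∏ (λ y → s (v − y)) T) T)
             (cong (col *_) (∏∏s-self T rs))) ⟩
      (1ℤ * row) * (col * ε (length T))
        ≡⟨ Zs.solve 3 (λ a b e → (Zs.con 1ℤ Zs.:* a) Zs.:* (b Zs.:* e) Zs.:= (a Zs.:* b) Zs.:* e) refl row col (ε (length T)) ⟩
      (row * col) * ε (length T)
        ≡⟨ cong (_* ε (length T)) (trans (sym (∏-* (λ y → s (x − y)) (λ v → s (v − x)) T))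
             (∏-sgn T (All.map s-antisymmetric r))) ⟩
      sgn (length T) * ε (length T) ∎
      where
      open ≡.≡-Reasoning
      row col : ℤ
      row = ∏ (λ y → s (x − y)) T
      col = ∏ (λ v → s (v − x)) T

    w : List Carrier → Carrier → ℤ
    w T y = χ (rootVal T y)

    w-∏ : ∀ T y → w T y ≡ ∏ (λ v → χ (y − v)) T
    w-∏ []      y = χ-1
    w-∏ (t ∷ T) y = trans (χ-* (y − t) (rootVal T y)) (cong (χ (y − t) *_) (w-∏ T y))

    ∏∏-cong : ∀ {f g : Carrier → Carrier → ℤ} xs ys → All (λ x → All (λ y → f x y ≡ g x y) ys) xs →
              ∏ (λ x → ∏ (f x) ys) xs ≡ ∏ (λ x → ∏ (g x) ys) xs
    ∏∏-cong xs ys h = ∏-cong xs (All.map (∏-cong ys) h)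

    ∏-ext : ∀ {v v′ : Carrier → ℤ} → (∀ x → v x ≡ v′ x) → ∀ xs → ∏ v xs ≡ ∏ v′ xs
    ∏-ext e xs = ∏-cong xs (All.universal e xs)

    -- ∏_{v ∈ T} ∏_{y ∈ T ∪ U} s (v − y), for disjoint T and U.
    K : List Carrier → List Carrier → ℤ
    K T U = ε (length T) * ∏ (w T) U

    evenProd : List Carrier → ℤ
    evenProd L = ∏ (λ v → 1ℤ + ∏ (λ y → s (v − y)) L) L

    -- The signs s(v - y) with v in T and y in L split into those inside T, which multiply to ε, and
    -- those between T and U. Multiplying the latter over v first turns them into χ(f_T(y)) for y in
    -- U.
    evenProd-expansion : ∀ L → Distinct L → evenProd L ≡ ∑⊎ K L
    evenProd-expansion L dL = trans (∏-1+ (λ v → ∏ (λ y → s (v − y)) L) L) (∑⊎-cong L term)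
      where
      open ≡.≡-Reasoning
      term : ∀ T U → Interleaving T U L → ∏ (λ v → ∏ (λ y → s (v − y)) L) T ≡ K T U
      term T U i with AllPairs-interleaving (λ ne → ne ∘ ≈-sym) i dL
      ... | dT , cross = begin
        ∏ (λ v → ∏ (λ y → s (v − y)) L) T
          ≡⟨ ∏-ext (λ v → ∏-interleaving (λ y → s (v − y)) i) T ⟩
        ∏ (λ v → ∏ (λ y → s (v − y)) T * ∏ (λ y → s (v − y)) U) T
          ≡⟨ ∏-* (λ v → ∏ (λ y → s (v − y)) T) (λ v → ∏ (λ y → s (v − y)) U) T ⟩
        ∏ (λ v → ∏ (λ y → s (v − y)) T) T * ∏ (λ v → ∏ (λ y → s (v − y)) U) T
          ≡⟨ cong₂ _*_ (∏∏s-self T dT) (trans (∏∏-cong T U (All.map (All.map s≡χ) cross))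
               (trans (∏-swap (λ v y → χ (y − v)) T U) (∏-ext (λ y → sym (w-∏ T y)) U))) ⟩
        K T U ∎

    rootVal-∈ : ∀ {z} T → z ∈ T → rootVal T z ≈ 0#
    rootVal-∈ {z} (t ∷ T) (here refl) = ≈-trans (F.*-congʳ (F.-‿inverseʳ z)) (F.zeroˡ _)
    rootVal-∈ {z} (t ∷ T) (there i)   = ≈-trans (F.*-congˡ (rootVal-∈ T i)) (F.zeroʳ _)

    module _ (r : ℕ) where
      Kᵣ : List Carrier → List Carrier → ℤ
      Kᵣ T U = + δ (length T ℕ.+ length U) r * K T U

      -- A common element is a root of f_T, so one factor χ(f_T(z)) is zero. This is the hypothesis
      -- of `∑⊆-∑⊎`.
      Kᵣ-disjoint : ∀ {z} T U → z ∈ T → z ∈ U → Kᵣ T U ≡ 0ℤ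
      Kᵣ-disjoint T U i j = trans (cong (λ p → + δ (length T ℕ.+ length U) r * (ε (length T) * p))
          (∏-zero (w T) U j (χ-0 (rootVal-∈ T i))))
        (Zs.solve 2 (λ a b → a Zs.:* (b Zs.:* Zs.con 0ℤ) Zs.:= Zs.con 0ℤ) refl (+ δ (length T ℕ.+ length U) r) (ε (length T)))

      ∑-evenProd : ∑⊆ (λ L → + δ (length L) r * evenProd L) elements ≡ ∑⊆ (λ T → ∑⊆ (Kᵣ T) elements) elements
      ∑-evenProd = trans (∑⊆-cong elements (λ L i → trans
          (cong (+ δ (length L) r *_) (evenProd-expansion L (AllPairs-resp-⊆ i elements-distinct)))
          (trans (sym (∑⊎-* (+ δ (length L) r) K L))
            (∑⊎-cong L (λ T U j → cong (λ k → + δ k r * K T U) (length-interleaving j))))))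
        (∑⊆-∑⊎ Kᵣ Kᵣ-disjoint elements)

      h : Carrier → List Carrier → ℤ
      h v L = ∏ (λ y → s (v − y)) L

      even⇔ : ∀ S → (IsEvenInduced F S → All (λ v → h v (elems enum S) ≡ 1ℤ) (elems enum S)) ×
                    (All (λ v → h v (elems enum S) ≡ 1ℤ) (elems enum S) → IsEvenInduced F S)
      even⇔ S = (λ ev → All-elems⁺ enum S (λ v i → trans (h≡ v) (2∣⇒sgn≡1 _ (ev v i)))) ,
                (λ a v i → sgn≡1⇒2∣ _ (trans (sym (h≡ v)) (All-elems⁻ enum S a v i)))
        where
        h≡ : ∀ v → h (enum v) (elems enum S) ≡ sgn (outDeg F S v)
        h≡ v = ∏-elems enum (λ y → does (isNonzeroSquare? F (enum v − y))) S

      Counted : Subset size → Set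
      Counted S = card S ≡ r × IsEvenInduced F S

      indicator : ∀ (S : Subset size) (c? : Dec (Counted S)) → (if does c? then + (2 ℕ.^ r) else 0ℤ) ≡
        + δ (length (elems enum S)) r * evenProd (elems enum S)
      indicator S c? with ∏-1+-dichotomy (λ v → h v (elems enum S)) (λ v → Unit-∏ (λ y → Unit-s (v − y)) (elems enum S)) (elems enum S)
      indicator S (yes (e , ev)) | inj₁ (_ , p) = sym (trans (cong₂ (λ a b → + a * b)
          (trans (cong (λ k → δ k r) len) (δ-refl r)) (trans p (cong (λ k → + (2 ℕ.^ k)) len))) (ℤ.*-identityˡ _))
        where
        len : length (elems enum S) ≡ r
        len = trans (length-elems enum S) e
      indicator S (yes (e , ev)) | inj₂ (n , _) = ⊥-elim (n (proj₁ (even⇔ S) ev))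
      indicator S (no ¬c)        | inj₁ (a , _) = sym (trans (cong (λ k → + k * evenProd (elems enum S))
          (δ-≢ (length (elems enum S)) r (λ e → ¬c (trans (sym (length-elems enum S)) e , proj₂ (even⇔ S) a)))) (ℤ.*-zeroˡ (evenProd (elems enum S))))
      indicator S (no ¬c)        | inj₂ (_ , p) = sym (trans (cong (+ δ (length (elems enum S)) r *_) p) (ℤ.*-zeroʳ (+ δ (length (elems enum S)) r)))

      evenCount-∑ : + evenCount F r * + (2 ℕ.^ r) ≡ ∑⊆ (λ T → ∑⊆ (Kᵣ T) elements) elements
      evenCount-∑ = trans (∑⊆-allSubsets size enum _ (+ (2 ℕ.^ r)) (λ L → + δ (length L) r * evenProd L) (λ S → indicator S ((card S ℕ.≟ r) ×-dec isEvenInduced? F S))) ∑-evenProd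

      lower upper : List Carrier → List Carrier → ℤ
      lower T U = if length T ℕ.≤ᵇ length U then Kᵣ T U else 0ℤ
      upper T U = if length T ℕ.≤ᵇ length U then 0ℤ else Kᵣ T U

      Kᵣ-split : ∀ T U → Kᵣ T U ≡ lower T U + upper T U
      Kᵣ-split T U with length T ℕ.≤ᵇ length U
      ... | true  = sym (ℤ.+-identityʳ (Kᵣ T U))
      ... | false = sym (ℤ.+-identityˡ (Kᵣ T U))

      -- In upper, exchanging T and U costs χ(-1)^(tu) = (-1)^(tu); the sum then runs over the larger set T for fixed U.
      s₁ s₂ : ℕ → ℤ
      s₁ t = ε t
      s₂ u = ε (r ℕ.∸ u) * sgn u ^ (r ℕ.∸ u)

      half₁ half₂ : List Carrier → ℤ
      half₁ T = if length T ℕ.+ length T ℕ.≤ᵇ r then s₁ (length T) * esym (r ℕ.∸ length T) (map (w T) elements) else 0ℤ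
      half₂ U = if suc (length U ℕ.+ length U) ℕ.≤ᵇ r then s₂ (length U) * esym (r ℕ.∸ length U) (map (w U) elements) else 0ℤ

      if-δ : ∀ b n (z : ℤ) → (if b then + n * z else 0ℤ) ≡ + (if b then n else 0) * z
      if-δ true  n z = refl
      if-δ false n z = sym (ℤ.*-zeroˡ z)

      if-δ′ : ∀ b n (z : ℤ) → (if b then 0ℤ else + n * z) ≡ + (if b then 0 else n) * z
      if-δ′ false n z = refl
      if-δ′ true  n z = sym (ℤ.*-zeroˡ z)

      ∑-if : ∀ b (c : ℤ) k (v : Carrier → ℤ) →
        ∑⊆ (λ U → + (if b then δ (length U) k else 0) * (c * ∏ v U)) elements ≡ (if b then c * esym k (map v elements) else 0ℤ)
      ∑-if true  c k v = trans (∑⊆-ext (λ U → Zs.solve 3 (λ d c p → d Zs.:* (c Zs.:* p) Zs.:= c Zs.:* (d Zs.:* p)) refl (+ δ (length U) k) c (∏ v U)) elements)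
        (trans (∑⊆-* c (λ U → + δ (length U) k * ∏ v U) elements) (cong (c *_) (∑⊆-esym v k elements)))
      ∑-if false c k v = ∑⊆-0 (λ U → ℤ.*-zeroˡ (c * ∏ v U)) elements

      ∑-lower : ∀ T → ∑⊆ (lower T) elements ≡ half₁ T
      ∑-lower T = trans (∑⊆-ext (λ U → trans (if-δ (t ℕ.≤ᵇ length U) (δ (t ℕ.+ length U) r) (K T U))
          (cong (λ k → + k * K T U) (δ-lower-half t (length U) r))) elements)
        (∑-if (t ℕ.+ t ℕ.≤ᵇ r) (ε t) (r ℕ.∸ t) (w T))
        where
        t : ℕ
        t = length T

      ∏-const : ∀ c (T : List Carrier) → ∏ (λ _ → c) T ≡ c ^ length T
      ∏-const c []      = refl
      ∏-const c (x ∷ T) = cong (c *_) (∏-const c T)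

      K-swap : ∀ T U → K T U ≡ (ε (length T) * ∏ (λ _ → sgn (length U)) T) * ∏ (w U) T
      K-swap T U = trans (cong (ε (length T) *_) (begin
        ∏ (w T) U                                           ≡⟨ ∏-ext (w-∏ T) U ⟩
        ∏ (λ y → ∏ (λ v → χ (y − v)) T) U                   ≡⟨ ∏-swap (λ y v → χ (y − v)) U T ⟩
        ∏ (λ v → ∏ (λ y → χ (y − v)) U) T
          ≡⟨ ∏-ext (λ v → trans (∏-ext (λ y → trans (χ-swap y v) (sym (ℤ.-1*i≡-i (χ (v − y))))) U)
               (trans (∏-* (λ _ → -1ℤ) (λ y → χ (v − y)) U) (cong₂ _*_ (∏-sgn U (All.universal (λ _ → refl) U)) (sym (w-∏ U v))))) T ⟩
        ∏ (λ v → sgn (length U) * w U v) T                ≡⟨ ∏-* (λ _ → sgn (length U)) (w U) T ⟩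
        ∏ (λ _ → sgn (length U)) T * ∏ (w U) T            ∎))
        (sym (ℤ.*-assoc (ε (length T)) (∏ (λ _ → sgn (length U)) T) (∏ (w U) T)))
        where open ≡.≡-Reasoning

      ∑-upper : ∀ U → ∑⊆ (λ T → upper T U) elements ≡ half₂ U
      ∑-upper U = trans (∑⊆-ext (λ T → trans (if-δ′ (length T ℕ.≤ᵇ u) (δ (length T ℕ.+ u) r) (K T U))
          (trans (cong (λ k → + k * K T U) (δ-upper-half (length T) u r)) (normalise T (suc (u ℕ.+ u) ℕ.≤ᵇ r)))) elements)
        (∑-if (suc (u ℕ.+ u) ℕ.≤ᵇ r) (s₂ u) (r ℕ.∸ u) (w U))
        where
        u : ℕ
        u = length U
        -- The sign from `K-swap` depends on the length of T, which is r - u only where the delta is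
        -- nonzero; elsewhere both sides are zero.
        normalise : ∀ T b → + (if b then δ (length T) (r ℕ.∸ u) else 0) * K T U ≡
                            + (if b then δ (length T) (r ℕ.∸ u) else 0) * (s₂ u * ∏ (w U) T)
        normalise T false = trans (ℤ.*-zeroˡ (K T U)) (sym (ℤ.*-zeroˡ (s₂ u * ∏ (w U) T)))
        normalise T true with length T ℕ.≟ r ℕ.∸ u
        ... | yes e = cong (+ δ (length T) (r ℕ.∸ u) *_) (trans (K-swap T U)
                (cong (_* ∏ (w U) T) (cong₂ _*_ (cong ε e) (trans (∏-const (sgn u) T) (cong (sgn u ^_) e)))))
        ... | no ne rewrite δ-≢ (length T) (r ℕ.∸ u) ne = trans (ℤ.*-zeroˡ (K T U)) (sym (ℤ.*-zeroˡ (s₂ u * ∏ (w U) T)))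

      E₁ E₂ : ℤ
      E₁ = ∑⊆ (nonempty half₁) elements
      E₂ = ∑⊆ (nonempty half₂) elements

      length-elements : length elements ≡ size
      length-elements = length-tabulate enum

      esym-empty : esym r (map (w []) elements) ≡ + (size C r)
      esym-empty = trans (esym-ones (w []) (λ _ → χ-1) r elements) (cong (λ n → + (n C r)) length-elements)

      half₁-[] : half₁ [] ≡ + (size C r)
      half₁-[] = trans (ℤ.*-identityˡ (esym r (map (w []) elements))) esym-empty

      -- For U empty, T has size r and the sign is ε r = (-1)^(r(r-1)/2); the residue of r modulo 4
      -- is used to make it 1. Positivity of r puts this term in the upper half, where t > u.
      half₂-[] : 1 ≤ r → ε r ≡ 1ℤ → half₂ [] ≡ + (size C r)
      half₂-[] 1≤r e rewrite ≤ᵇ-true 1≤r = trans (cong₂ _*_ (trans (cong₂ _*_ e (ℤ.^-zeroˡ r)) refl) esym-empty)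
        (ℤ.*-identityˡ (+ (size C r)))

      main-term : 1 ≤ r → ε r ≡ 1ℤ → + evenCount F r * + (2 ℕ.^ r) ≡ (+ (size C r) + E₁) + (+ (size C r) + E₂)
      main-term 1≤r e = begin
        + evenCount F r * + (2 ℕ.^ r)                                          ≡⟨ evenCount-∑ ⟩
        ∑⊆ (λ T → ∑⊆ (Kᵣ T) elements) elements
          ≡⟨ ∑⊆-ext (λ T → trans (∑⊆-ext (Kᵣ-split T) elements) (∑⊆-+ (lower T) (upper T) elements)) elements ⟩
        ∑⊆ (λ T → ∑⊆ (lower T) elements + ∑⊆ (upper T) elements) elements
          ≡⟨ ∑⊆-+ (λ T → ∑⊆ (lower T) elements) (λ T → ∑⊆ (upper T) elements) elements ⟩
        ∑⊆ (λ T → ∑⊆ (lower T) elements) elements + ∑⊆ (λ T → ∑⊆ (upper T) elements) elements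
          ≡⟨ cong₂ _+_ (∑⊆-ext ∑-lower elements) (trans (∑⊆-swap upper elements elements) (∑⊆-ext ∑-upper elements)) ⟩
        ∑⊆ half₁ elements + ∑⊆ half₂ elements
          ≡⟨ cong₂ _+_ (trans (∑⊆-nonempty half₁ elements) (cong (λ z → z + E₁) half₁-[]))
                         (trans (∑⊆-nonempty half₂ elements) (cong (λ z → z + E₂) (half₂-[] 1≤r e))) ⟩
        (+ (size C r) + E₁) + (+ (size C r) + E₂) ∎
        where open ≡.≡-Reasoning

      -- The constants 128 = 2 · 64 and 2 · 64² are those that `esym-bound` requires for c = 64.
      module _ (small : ∀ x T → Distinct (x ∷ T) → length (x ∷ T) ≤ r → ∣ charSum (x ∷ T) ∣ ℕ.* 128 ≤ size)
               (r-small : 2 ℕ.* (64 ℕ.* 64) ℕ.* r ≤ size) where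

        esym-w-bound : ∀ x T → x ∷ T ⊆ elements → let u = r ℕ.∸ length (x ∷ T) in length (x ∷ T) ≤ r →
                       64 ℕ.^ u ℕ.* u ! ℕ.* ∣ esym u (map (w (x ∷ T)) elements) ∣ ≤ size ℕ.^ u
        esym-w-bound x T i le = esym-bound 64 size (map (w (x ∷ T)) elements)
          (All.map⁺ (All.universal (λ y → χ-ternary (rootVal (x ∷ T) y)) elements))
          (trans (length-map (w (x ∷ T)) elements) length-elements)
          (subst (λ z → ∣ z ∣ ℕ.* 128 ≤ size) (sym (sumℤ-map (w (x ∷ T)) elements))
            (small x T (AllPairs-resp-⊆ i elements-distinct) le))
          (r ℕ.∸ length (x ∷ T)) (ℕ.≤-trans (ℕ.*-monoʳ-≤ (2 ℕ.* (64 ℕ.* 64)) (ℕ.m∸n≤m r (length (x ∷ T)))) r-small)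

        E₁-bound : 8 ℕ.^ r ℕ.* r ! ℕ.* ∣ E₁ ∣ ≤ 4 ℕ.^ r ℕ.* size ℕ.^ r
        E₁-bound = half-bound size r elements length-elements w s₁ (λ t → ∣Unit∣≤1 (Unit-ε t))
          (λ t → t ℕ.+ t ℕ.≤ᵇ r) (λ t → ≤ᵇ-sound (t ℕ.+ t) r) esym-w-bound

        E₂-bound : 8 ℕ.^ r ℕ.* r ! ℕ.* ∣ E₂ ∣ ≤ 4 ℕ.^ r ℕ.* size ℕ.^ r
        E₂-bound = half-bound size r elements length-elements w s₂
          (λ t → ∣Unit∣≤1 (Unit-* (Unit-ε (r ℕ.∸ t)) (Unit-^ (Unit-sgn t) (r ℕ.∸ t))))
          (λ t → suc (t ℕ.+ t) ℕ.≤ᵇ r) (λ t e → ℕ.≤-trans (ℕ.n≤1+n _) (≤ᵇ-sound (suc (t ℕ.+ t)) r e)) esym-w-bound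

-- Numerical estimates and conclusion

open import Data.Nat using (_+_; _*_; _∸_; _^_; _≤_; _%_; _/_; _⊔_; ∣_-_∣; z≤n; s≤s)
open ℕSolver.+-*-Solver

ε-mod-4 : ∀ r → r % 4 ≡ 0 ⊎ r % 4 ≡ 1 → ε r ≡ 1ℤ
ε-mod-4 r h = trans (cong ε (trans (m≡m%n+[m/n]*n r 4) (ℕ.+-comm (r % 4) _))) (trans (periodic (r / 4)) (base h))
  where
  periodic : ∀ k → ε (k * 4 + r % 4) ≡ ε (r % 4)
  periodic zero    = refl
  periodic (suc k) = trans (ε-4+ (k * 4 + r % 4)) (periodic k)
  base : r % 4 ≡ 0 ⊎ r % 4 ≡ 1 → ε (r % 4) ≡ 1ℤ
  base (inj₁ e) = cong ε e
  base (inj₂ e) = cong ε e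

double-≤⇒≤ : ∀ x n → x + x ≤ suc (n + n) → x ≤ n
double-≤⇒≤ x n h with x ℕ.≤? n
... | yes le = le
... | no nle = contradiction (ℕ.≤-trans (ℕ.+-mono-≤ (ℕ.≰⇒> nle) (ℕ.≰⇒> nle)) h)
  (λ le → ℕ.<-irrefl refl (subst (_≤ n + n) (ℕ.+-suc n n) (ℕ.≤-pred le)))

module _ (r q : ℕ) (1≤r : 1 ≤ r) (h : (64 * r) ^ 4 ≤ q) where
  private
    r⁴ : ℕ
    r⁴ = r * r * r * r

    ≤r⁴ : ∀ {a b c d} → a ≤ r → b ≤ r → c ≤ r → d ≤ r → a * b * c * d ≤ r⁴
    ≤r⁴ a b c d = ℕ.*-mono-≤ (ℕ.*-mono-≤ (ℕ.*-mono-≤ a b) c) d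

  -- The common pattern of the size requirements: since r ≥ 1, each monomial of degree at most 4 is
  -- at most r⁴, and the sum of the coefficients stays below 64⁴.
  below-q : ∀ {x} k → k ≤ 64 * 64 * 64 * 64 → x ≤ k * r⁴ → x ≤ q
  below-q {x} k k≤ x≤ = ℕ.≤-trans x≤ (ℕ.≤-trans (ℕ.*-monoˡ-≤ r⁴ k≤) (ℕ.≤-trans (ℕ.≤-reflexive (expand 64 r)) h))
    where
    expand : ∀ c r → c * c * c * c * (r * r * r * r) ≡ (c * r) ^ 4
    expand = solve 2 (λ c r → c :* c :* c :* c :* (r :* r :* r :* r) := (c :* r) :* ((c :* r) :* ((c :* r) :* ((c :* r) :* con 1)))) refl

  2c²r≤q : 2 * (64 * 64) * r ≤ q
  2c²r≤q = below-q (2 * (64 * 64)) (ℕ.≤ᵇ⇒≤ _ _ tt) (ℕ.*-monoʳ-≤ (2 * (64 * 64))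
    (ℕ.≤-trans (ℕ.≤-reflexive (one r)) (≤r⁴ 1≤r 1≤r 1≤r (ℕ.≤-refl {r}))))
    where
    one : ∀ r → r ≡ 1 * 1 * 1 * r
    one r = sym (ℕ.*-identityˡ r)

  2r²≤q : 2 * (r * r) ≤ q
  2r²≤q = below-q 2 (ℕ.≤ᵇ⇒≤ _ _ tt) (ℕ.*-monoʳ-≤ 2
    (ℕ.≤-trans (ℕ.≤-reflexive (solve 1 (λ r → r :* r := con 1 :* con 1 :* r :* r) refl r)) (≤r⁴ 1≤r 1≤r (ℕ.≤-refl {r}) (ℕ.≤-refl {r}))))

  -- With k = 512 and m = k d the left side is 2 k² d³ + k² d² + k d + d, so at most (3 k² + k + 1)
  -- r⁴. Twice this constant is below 64⁴; the doubling comes from n being about q/2.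
  stepanov-parameters : ∀ n d → q ≡ suc (n + n) → 1 ≤ d → d ≤ r → let m = 4 * 128 * d in m * (2 * m * d + m + 1) + d ≤ n
  stepanov-parameters n d q≡ 1≤d d≤r = double-≤⇒≤ _ n (subst (x + x ≤_) q≡ (below-q (2 * c) (ℕ.≤ᵇ⇒≤ _ _ tt)
      (ℕ.≤-trans (ℕ.+-mono-≤ x≤ x≤) (ℕ.≤-reflexive (two c r⁴)))))
    where
    two : ∀ c p → c * p + c * p ≡ 2 * c * p
    two = solve 2 (λ c p → c :* p :+ c :* p := con 2 :* c :* p) refl
    k c x : ℕ
    k = 4 * 128
    c = 2 * k * k + k * k + k + 1
    x = k * d * (2 * (k * d) * d + k * d + 1) + d
    expand : ∀ k d → k * d * (2 * (k * d) * d + k * d + 1) + d ≡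
      2 * k * k * (1 * d * d * d) + k * k * (1 * 1 * d * d) + k * (1 * 1 * 1 * d) + (1 * 1 * 1 * d)
    expand = solve 2 (λ k d → k :* d :* (con 2 :* (k :* d) :* d :+ k :* d :+ con 1) :+ d :=
      con 2 :* k :* k :* (con 1 :* d :* d :* d) :+ k :* k :* (con 1 :* con 1 :* d :* d) :+ k :* (con 1 :* con 1 :* con 1 :* d) :+ con 1 :* con 1 :* con 1 :* d) refl
    collect : ∀ k p → 2 * k * k * p + k * k * p + k * p + p ≡ (2 * k * k + k * k + k + 1) * p
    collect = solve 2 (λ k p → con 2 :* k :* k :* p :+ k :* k :* p :+ k :* p :+ p := (con 2 :* k :* k :+ k :* k :+ k :+ con 1) :* p) refl
    grow : ∀ k → 2 * k * k * (1 * d * d * d) + k * k * (1 * 1 * d * d) + k * (1 * 1 * 1 * d) + (1 * 1 * 1 * d) ≤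
                 2 * k * k * r⁴ + k * k * r⁴ + k * r⁴ + r⁴
    grow k = ℕ.+-mono-≤ (ℕ.+-mono-≤ (ℕ.+-mono-≤ (ℕ.*-monoʳ-≤ (2 * k * k) (≤r⁴ 1≤r d≤r d≤r d≤r)) (ℕ.*-monoʳ-≤ (k * k) (≤r⁴ 1≤r 1≤r d≤r d≤r)))
      (ℕ.*-monoʳ-≤ k (≤r⁴ 1≤r 1≤r 1≤r d≤r))) (≤r⁴ 1≤r 1≤r 1≤r d≤r)
    general : ∀ k → k * d * (2 * (k * d) * d + k * d + 1) + d ≤ (2 * k * k + k * k + k + 1) * r⁴
    general k = ℕ.≤-trans (ℕ.≤-reflexive (expand k d)) (ℕ.≤-trans (grow k) (ℕ.≤-reflexive (collect k r⁴)))
    x≤ : x ≤ c * r⁴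
    x≤ = general k

-- Since 8^r = 4^r 2^r and q^r is at most 2 r! (q choose r), each error is at most 2 (q choose r) /
-- 2^r. Twice the deviation is at most the sum of both errors, and 2 (n + 1) ≤ r < 2^r converts the
-- factor 2^(-r) into 1/(n + 1).
error-bound : ∀ n r q a (E₁ E₂ : ℤ) → 1 ≤ r → 2 * suc n ≤ r → q ^ r ≤ 2 * falling q r →
  + a ℤ.* + (2 ^ r) ≡ (+ (q C r) ℤ.+ E₁) ℤ.+ (+ (q C r) ℤ.+ E₂) →
  8 ^ r * r ! * ℤ.∣ E₁ ∣ ≤ 4 ^ r * q ^ r → 8 ^ r * r ! * ℤ.∣ E₂ ∣ ≤ 4 ^ r * q ^ r →
  suc n * ∣ a * 2 ^ (r ∸ 1) - q C r ∣ ≤ q C r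
error-bound n r@(suc r′) q a E₁ E₂ _ 2n≤r q^r≤ main b₁ b₂ = ℕ.*-cancelˡ-≤ 4 (begin
    4 * (suc n * X)                            ≡⟨ solve 2 (λ n x → con 4 :* (n :* x) := con 2 :* n :* (con 2 :* x)) refl (suc n) X ⟩
    2 * suc n * (2 * X)                        ≤⟨ ℕ.*-mono-≤ (ℕ.≤-trans 2n≤r (ℕ.<⇒≤ (n<2^n r))) 2X≤ ⟩
    2 ^ r * (e₁ + e₂)                          ≤⟨ ℕ.*-cancelˡ-≤ (4 ^ r * r !) {{ℕ.m*n≢0 (4 ^ r) (r !) {{ℕ.m^n≢0 4 r}} {{r ℕ.!≢0}}}} cancelled ⟩
    4 * c                                      ∎)
  where
  open ℕ.≤-Reasoning
  X e₁ e₂ c : ℕ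
  X = ∣ a * 2 ^ r′ - c ∣
  e₁ = ℤ.∣ E₁ ∣
  e₂ = ℤ.∣ E₂ ∣
  c = q C r
  doubled : + 2 ℤ.* (+ (a * 2 ^ r′) ℤ.- + c) ≡ E₁ ℤ.+ E₂
  doubled = trans (cong (λ z → + 2 ℤ.* (z ℤ.- + c)) (ℤ.pos-* a (2 ^ r′)))
    (trans (Zs.solve 3 (λ a p c → Zs.con (+ 2) Zs.:* (a Zs.:* p Zs.:- c) Zs.:= a Zs.:* (Zs.con (+ 2) Zs.:* p) Zs.:- (c Zs.:+ c)) refl (+ a) (+ (2 ^ r′)) (+ c))
    (trans (cong (λ z → + a ℤ.* z ℤ.- (+ c ℤ.+ + c)) (sym (ℤ.pos-* 2 (2 ^ r′))))
    (trans (cong (λ z → z ℤ.- (+ c ℤ.+ + c)) main)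
      (Zs.solve 3 (λ c x y → ((c Zs.:+ x) Zs.:+ (c Zs.:+ y)) Zs.:- (c Zs.:+ c) Zs.:= x Zs.:+ y) refl (+ c) E₁ E₂))))
  2X≤ : 2 * X ≤ e₁ + e₂
  2X≤ = ℕ.≤-trans (ℕ.≤-reflexive (trans (cong (2 *_) (sym (∣⊖∣≡∣-∣ (a * 2 ^ r′) c)))
      (trans (sym (ℤ.abs-* (+ 2) (+ (a * 2 ^ r′) ℤ.- + c))) (cong ℤ.∣_∣ doubled)))) (ℤ.∣i+j∣≤∣i∣+∣j∣ E₁ E₂)
  8^r : 8 ^ r ≡ 4 ^ r * 2 ^ r
  8^r = trans (ℕ.^-*-assoc 2 3 r) (trans (cong (2 ^_) (solve 1 (λ r → con 3 :* r := con 2 :* r :+ r) refl r))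
    (trans (ℕ.^-distribˡ-+-* 2 (2 * r) r) (cong (_* 2 ^ r) (sym (ℕ.^-*-assoc 2 2 r)))))
  cancelled : 4 ^ r * r ! * (2 ^ r * (e₁ + e₂)) ≤ 4 ^ r * r ! * (4 * c)
  cancelled = begin
    4 ^ r * r ! * (2 ^ r * (e₁ + e₂))
      ≡⟨ solve 5 (λ p f t x y → p :* f :* (t :* (x :+ y)) := p :* t :* f :* x :+ p :* t :* f :* y) refl (4 ^ r) (r !) (2 ^ r) e₁ e₂ ⟩
    4 ^ r * 2 ^ r * r ! * e₁ + 4 ^ r * 2 ^ r * r ! * e₂
      ≡⟨ cong (λ z → z * r ! * e₁ + z * r ! * e₂) (sym 8^r) ⟩
    8 ^ r * r ! * e₁ + 8 ^ r * r ! * e₂           ≤⟨ ℕ.+-mono-≤ b₁ b₂ ⟩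
    4 ^ r * q ^ r + 4 ^ r * q ^ r                 ≤⟨ ℕ.+-mono-≤ (ℕ.*-monoʳ-≤ (4 ^ r) q^r≤) (ℕ.*-monoʳ-≤ (4 ^ r) q^r≤) ⟩
    4 ^ r * (2 * (c * r !)) + 4 ^ r * (2 * (c * r !))
      ≡⟨ solve 3 (λ p c f → p :* (con 2 :* (c :* f)) :+ p :* (con 2 :* (c :* f)) := p :* f :* (con 4 :* c)) refl (4 ^ r) c (r !) ⟩
    4 ^ r * r ! * (4 * c) ∎

size-mod-4 : ∀ q → q % 4 ≡ 3 → let l = q / 4 in q ≡ suc (suc (l + l) + suc (l + l))
size-mod-4 q e = trans (m≡m%n+[m/n]*n q 4) (trans (cong (_+ q / 4 * 4) e)
  (solve 1 (λ l → con 3 :+ l :* con 4 := con 1 :+ ((con 1 :+ (l :+ l)) :+ (con 1 :+ (l :+ l)))) refl (q / 4)))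

-- The effective form of the asymptotics: relative error 1/(n + 1) as soon as r ≥ 2 (n + 1) and q ≥
-- (64 r)^4.
evenCount-bound : ∀ (F : FiniteField) n r → let q = FiniteField.size F in
  q % 4 ≡ 3 → 1 ≤ r → r % 4 ≡ 0 ⊎ r % 4 ≡ 1 → 2 * suc n ≤ r → (64 * r) ^ 4 ≤ q →
  suc n * ∣ evenCount F r * 2 ^ (r ∸ 1) - q C r ∣ ≤ q C r
evenCount-bound F n r q%4 1≤r r%4 2n≤r h = error-bound n r q (evenCount F r) E₁ E₂ 1≤r 2n≤r
    (^≤2falling q r {{ℕ.>-nonZero size>0}} (2r²≤q r q 1≤r h)) (main-term 1≤r (ε-mod-4 r r%4))
    (E₁-bound small (2c²r≤q r q 1≤r h)) (E₂-bound small (2c²r≤q r q 1≤r h))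
  where
  open FiniteField F using () renaming (size to q)
  open FieldPoly F using (Distinct; size>0)
  size≡ : q ≡ suc (suc (q / 4 + q / 4) + suc (q / 4 + q / 4))
  size≡ = size-mod-4 q q%4
  open Character F (q / 4) size≡ using (charSum; character-sum-bound)
  module P = Paley F (q / 4) size≡
  E₁ E₂ : ℤ
  E₁ = P.E₁ r
  E₂ = P.E₂ r
  main-term = P.main-term r
  E₁-bound = P.E₁-bound r
  E₂-bound = P.E₂-bound r
  small : ∀ x T → Distinct (x ∷ T) → length (x ∷ T) ≤ r → ℤ.∣ charSum (x ∷ T) ∣ * 128 ≤ q
  small x T d le = character-sum-bound 128 x T d (stepanov-parameters r q 1≤r h (suc (q / 4 + q / 4)) (length (x ∷ T)) size≡ (s≤s z≤n) le)

theorem1p5 : (r : ℕ → ℕ)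
    → (∀ q → Admissible q → 1 ≤ r q × (r q % 4 ≡ 0 ⊎ r q % 4 ≡ 1))
    → (∀ M → ∃[ Q ] (∀ q → Q ≤ q → Admissible q → M ≤ r q))
    → (∀ n → ∃[ Q ] (∀ q → Q ≤ q → Admissible q → (suc n * r q) ^ 4 ≤ q))
    → ∀ n → ∃[ Q ] (∀ (F : FiniteField) → Q ≤ FiniteField.size F
        → FiniteField.size F % 4 ≡ 3
        → suc n * ∣ evenCount F (r (FiniteField.size F)) * 2 ^ (r (FiniteField.size F) ∸ 1)
                    - FiniteField.size F C r (FiniteField.size F) ∣
          ≤ FiniteField.size F C r (FiniteField.size F))
theorem1p5 r residue grows slow n = Q₁ ⊔ Q₂ , bound
  where
  Q₁ Q₂ : ℕ
  -- Growth of r is used at the level 2 (n + 1). The argument 63 below stands for the factor 64, as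
  -- `slow` takes the predecessor.
  Q₁ = proj₁ (grows (2 * suc n))
  Q₂ = proj₁ (slow 63)
  bound : ∀ (F : FiniteField) → let q = FiniteField.size F in
    Q₁ ⊔ Q₂ ≤ q → q % 4 ≡ 3 → suc n * ∣ evenCount F (r q) * 2 ^ (r q ∸ 1) - q C r q ∣ ≤ q C r q
  bound F Q≤q q%4 = evenCount-bound F n (r q) q%4 (proj₁ (residue q admissible)) (proj₂ (residue q admissible))
      (proj₂ (grows (2 * suc n)) q (ℕ.≤-trans (ℕ.m≤m⊔n Q₁ Q₂) Q≤q) admissible)
      (proj₂ (slow 63) q (ℕ.≤-trans (ℕ.m≤n⊔m Q₁ Q₂) Q≤q) admissible)
    where
    q : ℕ
    q = FiniteField.size F
    -- The hypotheses on r concern prime powers, while F is an arbitrary finite field, so the order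
    -- of F must be shown to be a prime power.
    admissible : Admissible q
    admissible = PrimePower.size-prime-power F , q%4
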